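{- We have $c_0^\times \leq_B E^C_{\mathrm{Diff}([0,1])}$.
   Context: $\mathcal{H}^+([0,1])$ is the group of increasing homeomorphisms of $[0,1]$ onto itself, with the supremum metric. $\mathrm{Diff}([0,1]) = \{f \in \mathcal{H}^+([0,1]) : f' \in \mathcal{C}([0,1]),\ (f^{ -1})' \in \mathcal{C}([0,1])\}$ (one-sided derivatives at the endpoints), with the metric $d_{\mathrm{Diff}}(f,g) = \sup_{t\in[0,1]}|f(t)-g(t)| + \sup_{t\in[0,1]}|f'(t)-g'(t)|$; this makes it a Polish group whose Borel structure coincides with that generated by the supremum metric. $E^C_{\mathrm{Diff}([0,1])}$ is the conjugation equivalence relation on $\mathrm{Diff}([0,1])$: $f_1\, E^C_{\mathrm{Diff}([0,1])}\, f_2$ iff there is $g \in \mathrm{Diff}([0,1])$ with $g\circ f_1 \circ g^{ -1} = f_2$. $c_0^\times$ is the equivalence relation on $(0,1)^{\mathbb{N}}$ given by $(x_n)\, c_0^\times\, (y_n)$ iff $\lim_{n\to\infty} x_n/y_n = 1$. For equivalence relations $E, F$ on standard Borel spaces $X, Y$: $E \leq_B F$ means there is a Borel map $f: X \to Y$ with $x E y \iff f(x) F f(y)$ for all $x,y\in X$. -}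

module Defs where

open import Algebra.Core using (Op₁; Op₂)
open import Algebra.Structures using (IsCommutativeRing)
open import Data.Nat.Base as ℕ using (ℕ)
open import Data.Product.Base using (Σ-syntax; ∃; ∃-syntax; _×_; _,_)
open import Data.Refinement using (Refinement-syntax; value)
open import Function.Bundles using (_⇔_; _↔_; module Inverse)
open import Level using (0ℓ; suc)
open import Relation.Binary.Bundles using (TotalOrder)
open import Relation.Binary.Core using (Rel)
open import Relation.Binary.PropositionalEquality using (_≡_; _≢_)
open import Relation.Binary.Structures using (IsTotalOrder)
open import Relation.Unary using (Pred; ∁; _≐_; _⊢_)

import Algebra.Construct.NaturalChoice.Max as Max
import Relation.Binary.Construct.NonStrictToStrict as ToStrict

module Bounds {A : Set} (_≤_ : Rel A 0ℓ) where

  IsUpperBound : Pred A 0ℓ → Pred A 0ℓ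
  IsUpperBound S b = ∀ x → S x → x ≤ b

  IsSup : Pred A 0ℓ → Pred A 0ℓ
  IsSup S s = IsUpperBound S s × (∀ b → IsUpperBound S b → s ≤ b)

-- The real numbers, axiomatised up to isomorphism as a Dedekind-complete
-- ordered field.  The inverse is a total function, unspecified at 0#.

record RealNumbers : Set₁ where
  infix  4 _≤_
  infixl 6 _+_
  infixl 7 _*_
  infix  8 -_ _⁻¹
  field
    ℝ                 : Set
    _≤_               : Rel ℝ 0ℓ
    _+_ _*_           : Op₂ ℝ
    -_ _⁻¹            : Op₁ ℝ
    0# 1#             : ℝ
    isCommutativeRing : IsCommutativeRing _≡_ _+_ _*_ -_ 0# 1#
    0≢1               : 0# ≢ 1#
    *-inverseʳ        : ∀ x → x ≢ 0# → x * x ⁻¹ ≡ 1#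
    isTotalOrder      : IsTotalOrder _≡_ _≤_
    +-monoˡ-≤         : ∀ z {x y} → x ≤ y → x + z ≤ y + z
    *-nonNegative     : ∀ {x y} → 0# ≤ x → 0# ≤ y → 0# ≤ x * y

  open Bounds _≤_ public

  field
    complete : (S : Pred ℝ 0ℓ) → ∃ S → ∃ (IsUpperBound S) → ∃ (IsSup S)

  totalOrder : TotalOrder 0ℓ 0ℓ 0ℓ
  totalOrder = record { isTotalOrder = isTotalOrder }

  open ToStrict _≡_ _≤_ public using (_<_)
  open Max totalOrder public using (_⊔_)

  infixl 6 _-_
  infixl 7 _/_

  _-_ : Op₂ ℝ
  x - y = x + (- y)

  _/_ : Op₂ ℝ
  x / y = x * y ⁻¹

  ∣_∣ : Op₁ ℝ
  ∣ x ∣ = x ⊔ (- x)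

-- The σ-algebra generated by a family of open sets.  The last constructor
-- identifies predicates with the same elements.

data Borel {X : Set} (Open : Pred (Pred X 0ℓ) 0ℓ) : Pred (Pred X 0ℓ) (suc 0ℓ) where
  open-set   : ∀ {U} → Open U → Borel Open U
  complement : ∀ {U} → Borel Open U → Borel Open (∁ U)
  union      : ∀ {U : ℕ → Pred X 0ℓ} → (∀ n → Borel Open (U n)) →
               Borel Open (λ x → ∃[ n ] U n x)
  resp-≐     : ∀ {U V} → U ≐ V → Borel Open U → Borel Open V

IsBorelMap : {X Y : Set} → Pred (Pred X 0ℓ) 0ℓ → Pred (Pred Y 0ℓ) 0ℓ →
             (X → Y) → Set₁
IsBorelMap OpenX OpenY φ = ∀ B → Borel OpenY B → Borel OpenX (φ ⊢ B)

-- E ≤_B F, where the Borel structures on X and Y are given by topologies.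

BorelReducible : {X Y : Set} → Pred (Pred X 0ℓ) 0ℓ → Pred (Pred Y 0ℓ) 0ℓ →
                 Rel X 0ℓ → Rel Y 0ℓ → Set₁
BorelReducible {X} {Y} OpenX OpenY E F =
  Σ[ φ ∈ (X → Y) ] IsBorelMap OpenX OpenY φ × (∀ x y → E x y ⇔ F (φ x) (φ y))

module Spaces (R : RealNumbers) where
  open RealNumbers R

  ]0,1[ : Set
  ]0,1[ = [ x ∈ ℝ ∣ 0# < x × x < 1# ]

  Sequences : Set
  Sequences = ℕ → ]0,1[

  -- The product topology: basic neighbourhoods restrict finitely many
  -- coordinates.

  OpenSequences : Pred (Pred Sequences 0ℓ) 0ℓ
  OpenSequences U = ∀ x → U x →
    ∃[ N ] ∃[ ε ] 0# < ε ×
      (∀ y → (∀ n → n ℕ.< N → ∣ value (y n) - value (x n) ∣ < ε) → U y)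

  _⟶_ : (ℕ → ℝ) → ℝ → Set
  a ⟶ l = ∀ ε → 0# < ε → ∃[ N ] (∀ n → N ℕ.≤ n → ∣ a n - l ∣ < ε)

  c₀ˣ : Rel Sequences 0ℓ
  c₀ˣ x y = (λ n → value (x n) / value (y n)) ⟶ 1#

  [0,1] : Set
  [0,1] = [ x ∈ ℝ ∣ 0# ≤ x × x ≤ 1# ]

  IsContinuous : Pred ([0,1] → ℝ) 0ℓ
  IsContinuous h = ∀ t ε → 0# < ε → ∃[ δ ] 0# < δ ×
    (∀ s → ∣ value s - value t ∣ < δ → ∣ h s - h t ∣ < ε)

  -- Since s ranges over [0,1] only, this is the one-sided derivative at the
  -- endpoints.

  HasDerivativeAt : ([0,1] → ℝ) → [0,1] → ℝ → Set
  HasDerivativeAt h t l = ∀ ε → 0# < ε → ∃[ δ ] 0# < δ ×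
    (∀ s → value s ≢ value t → ∣ value s - value t ∣ < δ →
      ∣ (h s - h t) / (value s - value t) - l ∣ < ε)

  record Homeo⁺ : Set where
    field
      bijection : [0,1] ↔ [0,1]

    open Inverse bijection public using (to; from)

    field
      increasing      : ∀ s t → value s < value t → value (to s) < value (to t)
      to-continuous   : IsContinuous (λ t → value (to t))
      from-continuous : IsContinuous (λ t → value (from t))

  record ContinuouslyDifferentiable (h : [0,1] → ℝ) : Set where
    field
      derivative            : [0,1] → ℝ
      hasDerivative         : ∀ t → HasDerivativeAt h t (derivative t)
      derivative-continuous : IsContinuous derivative

  record Diff : Set where
    field
      homeo : Homeo⁺

    open Homeo⁺ homeo public

    field
      to-C¹   : ContinuouslyDifferentiable (λ t → value (to t))
      from-C¹ : ContinuouslyDifferentiable (λ t → value (from t))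

    to′ : [0,1] → ℝ
    to′ = ContinuouslyDifferentiable.derivative to-C¹

  open Diff using (to; from; to′)

  IsSupDistance : ([0,1] → ℝ) → ([0,1] → ℝ) → ℝ → Set
  IsSupDistance h k = IsSup (λ r → ∃[ t ] r ≡ ∣ h t - k t ∣)

  -- The graph of the metric d_Diff.

  IsDistance : Diff → Diff → ℝ → Set
  IsDistance f g d = ∃[ a ] ∃[ b ]
    IsSupDistance (λ t → value (to f t)) (λ t → value (to g t)) a ×
    IsSupDistance (to′ f) (to′ g) b ×
    d ≡ a + b

  OpenDiff : Pred (Pred Diff 0ℓ) 0ℓ
  OpenDiff U = ∀ f → U f → ∃[ ε ] 0# < ε ×
    (∀ g d → IsDistance f g d → d < ε → U g)

  -- Equality in Diff is pointwise equality of maps on [0,1].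

  ConjugateDiff : Rel Diff 0ℓ
  ConjugateDiff f₁ f₂ =
    Σ[ g ∈ Diff ] (∀ t → to g (to f₁ (from g t)) ≡ to f₂ t)

-- In the n-th dyadic cell of (0,1] take an interval of length proportional to
-- xₙ times the length of the cell, and let f_x be the identity modified on each
-- of these intervals by a rescaled copy of one odd profile, with amplitudes
-- tending to 0 so that f_x is C¹ at 0.
--
-- If xₙ / yₙ → 1, a diffeomorphism that is a homothety on each interval and the
-- identity between the cells conjugates f_x to f_y; it is C¹ at 0 because the
-- ratios tend to 1.  Homotheties of ratio at most 1 are easily interpolated, so
-- f_x and f_y are both conjugated to f_z with z = min(x,y).
--
-- Conversely, a conjugating diffeomorphism g maps the components of {f_x < id}
-- to those of {f_y < id} in order.  Hence it fixes their left endpoints, which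
-- tend to 0, so g′(0) = 1, and by continuity of g′ and the mean value inequality
-- the ratios of the lengths of corresponding components tend to 1.

module Submission where

open import Defs
open import Axiom.ExcludedMiddle using (ExcludedMiddle)
open import Algebra.Bundles using (CommutativeRing)
open import Algebra.Solver.Ring.AlmostCommutativeRing using (_-Raw-AlmostCommutative⟶_; fromCommutativeRing)
open import Data.Bool.Base using (Bool; true; false)
open import Data.Integer.Base as ℤ using (ℤ; -[1+_])
import Data.Integer.Properties as ℤ
open import Data.Irrelevant using (Irrelevant; [_])
open import Data.List.Base using (List; []; _∷_)
open import Data.Maybe.Base using (Maybe; just; nothing)
open import Data.Nat.Base as ℕ using (ℕ; zero; suc)
import Data.Nat.Properties as ℕ
open import Data.Product.Base using (Σ-syntax; ∃; ∃-syntax; _×_; _,_; proj₁; proj₂)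
open import Data.Refinement using (value; proof; value-injective; _,_)
open import Data.Sum.Base using (_⊎_; inj₁; inj₂)
open import Data.Unit.Base using (⊤; tt)
open import Data.Vec.Base using (Vec; []; _∷_; tabulate)
open import Data.Vec.N-ary using (N-ary; _$ⁿ_)
open import Function.Bundles using (mk⇔; mk↔ₛ′; module Inverse)
open import Level using (0ℓ)
open import Relation.Binary.Definitions using (tri<; tri≈; tri>)
open import Relation.Binary.PropositionalEquality using (_≡_; _≢_; refl; sym; trans; cong; cong₂; subst; subst₂; module ≡-Reasoning)
open import Relation.Binary.Structures using (IsTotalOrder)
open import Relation.Nullary using (¬_; Dec; yes; no; contradiction)
open import Relation.Nullary.Decidable using (recompute)
open import Relation.Unary using (Pred)

-- On cell `n`, both `f_x` and the conjugating map have the form `t - α n * (σ n * profile ((t -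
-- center n) * σ n ⁻¹))`, so that a single construction serves for both.
--
-- For `f_x` only the width `σ` depends on `x`. The amplitude must not: `1 - α n` is the derivative
-- of `f_x` at the fixed point `center n`, hence a conjugation invariant, whereas the width is
-- rescaled by a homothety. For the conjugating map the width is the fixed `halves n` and the
-- amplitude is one minus the ratio of the two lengths; as the profile is the identity on [-1,1],
-- the map is there a homothety of exactly that ratio about `center n`. A profile of one sign could
-- not do this, and its change of sign also makes `center n` an end of a component of {f_x < id}.
--
-- The delicate point is 0, where the cells accumulate. There an estimate uniform over all bumps
-- takes the place of a computation of derivatives, and it makes inversion, composition and
-- restriction to [0,1] insensitive to this point.

-- Ordered field arithmetic and certified polynomial inequalities.

module Arithmetic (em : ExcludedMiddle 0ℓ) (R : RealNumbers) where

  open RealNumbers R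
  open import Algebra.Construct.NaturalChoice.Max totalOrder public using (x≤x⊔y; x≤y⊔x; ⊔-sel)
  open import Algebra.Construct.NaturalChoice.Min totalOrder public using (_⊓_; x⊓y≤x; x⊓y≤y; ⊓-sel)

  open IsTotalOrder isTotalOrder public using ()
    renaming (refl to ≤-refl; reflexive to ≤-reflexive; trans to ≤-trans; antisym to ≤-antisym; total to ≤-total)

  realRing : CommutativeRing 0ℓ 0ℓ
  realRing = record { isCommutativeRing = isCommutativeRing }

  open CommutativeRing realRing using
    ( semiring; ring; +-abelianGroup; +-assoc; +-comm; +-identityˡ; +-identityʳ; -‿inverseʳ
    ; *-identityˡ; zeroˡ; zeroʳ )
  open import Algebra.Properties.Semiring.Mult.TCOptimised semiring using (×-homo-+; ×1-homo-*; 1+×)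
    renaming (_×_ to _ᴺ×_)
  open import Algebra.Properties.Ring ring using (-‿distribˡ-*; -‿distribʳ-*; -0#≈0#; -‿involutive)
  open import Algebra.Properties.AbelianGroup +-abelianGroup using (⁻¹-∙-comm)

  num : ℕ → ℝ
  num n = n ᴺ× 1#

  int : ℤ → ℝ
  int (ℤ.+ n)    = num n
  int -[1+ n ] = - num (suc n)

  int-neg : ∀ i → int (ℤ.- i) ≡ - int i
  int-neg (ℤ.+ zero)  = sym -0#≈0#
  int-neg (ℤ.+ suc n) = refl
  int-neg -[1+ n ]  = sym (-‿involutive _)

  -- Written out by hand because it belongs to the verification of the coefficient map on which the
  -- ring solver rests.
  shift-suc : ∀ a b → a - b ≡ (1# + a) - (1# + b)
  shift-suc a b = begin
    a + - b                    ≡⟨ cong (_+ - b) (sym (+-identityˡ a)) ⟩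
    0# + a + - b               ≡⟨ cong (λ c → c + a + - b) (sym (-‿inverseʳ 1#)) ⟩
    1# + - 1# + a + - b
      ≡⟨ cong (_+ - b) (trans (+-assoc _ _ _) (trans (cong (1# +_) (+-comm _ _)) (sym (+-assoc _ _ _)))) ⟩
    1# + a + - 1# + - b        ≡⟨ +-assoc _ _ _ ⟩
    1# + a + (- 1# + - b)      ≡⟨ cong (1# + a +_) (⁻¹-∙-comm 1# b) ⟩
    (1# + a) - (1# + b)        ∎
    where open ≡-Reasoning

  int-⊖ : ∀ m n → int (m ℤ.⊖ n) ≡ num m - num n
  int-⊖ m zero = trans (sym (+-identityʳ _)) (cong (num m +_) (sym -0#≈0#))
  int-⊖ zero (suc n) = sym (+-identityˡ _)
  int-⊖ (suc m) (suc n) = begin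
    int (suc m ℤ.⊖ suc n)            ≡⟨ cong int (ℤ.[1+m]⊖[1+n]≡m⊖n m n) ⟩
    int (m ℤ.⊖ n)                    ≡⟨ int-⊖ m n ⟩
    num m - num n                    ≡⟨ shift-suc (num m) (num n) ⟩
    (1# + num m) - (1# + num n)      ≡⟨ sym (cong₂ _-_ (1+× m 1#) (1+× n 1#)) ⟩
    num (suc m) - num (suc n)        ∎
    where open ≡-Reasoning

  int-+ : ∀ i j → int (i ℤ.+ j) ≡ int i + int j
  int-+ (ℤ.+ m) (ℤ.+ n)       = ×-homo-+ 1# m n
  int-+ (ℤ.+ m) -[1+ n ]    = int-⊖ m (suc n)
  int-+ -[1+ m ] (ℤ.+ n)    = trans (int-⊖ n (suc m)) (+-comm _ _)
  int-+ -[1+ m ] -[1+ n ] = begin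
    - num (suc (suc (m ℕ.+ n)))        ≡⟨ cong (λ k → - num (suc k)) (sym (ℕ.+-suc m n)) ⟩
    - num (suc m ℕ.+ suc n)            ≡⟨ cong -_ (×-homo-+ 1# (suc m) (suc n)) ⟩
    - (num (suc m) + num (suc n))      ≡⟨ sym (⁻¹-∙-comm _ _) ⟩
    - num (suc m) + - num (suc n)      ∎
    where open ≡-Reasoning

  int-*-+ : ∀ m n → int ((ℤ.+ m) ℤ.* (ℤ.+ n)) ≡ num m * num n
  int-*-+ m n = trans (cong int (sym (ℤ.pos-* m n))) (×1-homo-* m n)

  int-* : ∀ i j → int (i ℤ.* j) ≡ int i * int j
  int-* (ℤ.+ m) (ℤ.+ n)       = int-*-+ m n
  int-* (ℤ.+ m) -[1+ n ]    = begin
    int ((ℤ.+ m) ℤ.* -[1+ n ])           ≡⟨ cong int (sym (ℤ.neg-distribʳ-* (ℤ.+ m) (ℤ.+ suc n))) ⟩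
    int (ℤ.- ((ℤ.+ m) ℤ.* (ℤ.+ suc n)))    ≡⟨ int-neg ((ℤ.+ m) ℤ.* (ℤ.+ suc n)) ⟩
    - int ((ℤ.+ m) ℤ.* (ℤ.+ suc n))        ≡⟨ cong -_ (int-*-+ m (suc n)) ⟩
    - (num m * num (suc n))            ≡⟨ -‿distribʳ-* _ _ ⟩
    num m * - num (suc n)              ∎
    where open ≡-Reasoning
  int-* -[1+ m ] (ℤ.+ n) = begin
    int (-[1+ m ] ℤ.* (ℤ.+ n))           ≡⟨ cong int (sym (ℤ.neg-distribˡ-* (ℤ.+ suc m) (ℤ.+ n))) ⟩
    int (ℤ.- ((ℤ.+ suc m) ℤ.* (ℤ.+ n)))    ≡⟨ int-neg ((ℤ.+ suc m) ℤ.* (ℤ.+ n)) ⟩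
    - int ((ℤ.+ suc m) ℤ.* (ℤ.+ n))        ≡⟨ cong -_ (int-*-+ (suc m) n) ⟩
    - (num (suc m) * num n)            ≡⟨ -‿distribˡ-* _ _ ⟩
    - num (suc m) * num n              ∎
    where open ≡-Reasoning
  int-* -[1+ m ] -[1+ n ] = begin
    num (suc m ℕ.* suc n)              ≡⟨ ×1-homo-* (suc m) (suc n) ⟩
    num (suc m) * num (suc n)          ≡⟨ sym (-‿involutive _) ⟩
    - - (num (suc m) * num (suc n))    ≡⟨ cong -_ (-‿distribˡ-* _ _) ⟩
    - (- num (suc m) * num (suc n))    ≡⟨ -‿distribʳ-* _ _ ⟩
    - num (suc m) * - num (suc n)      ∎
    where open ≡-Reasoning

  -- Equality of integers is decided by computation, equality in `ℝ` is not; with integer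
  -- coefficients, normal forms of polynomials can be compared by `refl`.
  int-homomorphism : ℤ.+-*-rawRing -Raw-AlmostCommutative⟶ fromCommutativeRing realRing
  int-homomorphism = record
    { ⟦_⟧    = int
    ; +-homo = int-+
    ; *-homo = int-*
    ; -‿homo = int-neg
    ; 0-homo = refl
    ; 1-homo = refl
    }

  int-≟ : ∀ i j → Maybe (int i ≡ int j)
  int-≟ i j with i ℤ.≟ j
  ... | yes i≡j = just (cong int i≡j)
  ... | no  _   = nothing

  open import Algebra.Solver.Ring ℤ.+-*-rawRing (fromCommutativeRing realRing) int-homomorphism int-≟ public
    using (Polynomial; Normal; var; con; _:+_; _:*_; _:-_; :-_; normalise; 0N; 0N-homo; correct; solve; _:=_)
    renaming (⟦_⟧ to ⟦_⟧ₚ; ⟦_⟧N to ⟦_⟧ₙ)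

  <⇒≤ : ∀ {x y} → x < y → x ≤ y
  <⇒≤ = proj₁

  <-irrefl : ∀ {x} → ¬ (x < x)
  <-irrefl (_ , x≢x) = x≢x refl

  ≤-<-trans : ∀ {x y z} → x ≤ y → y < z → x < z
  ≤-<-trans x≤y (y≤z , y≢z) = ≤-trans x≤y y≤z , λ { refl → y≢z (≤-antisym y≤z x≤y) }

  <-≤-trans : ∀ {x y z} → x < y → y ≤ z → x < z
  <-≤-trans (x≤y , x≢y) y≤z = ≤-trans x≤y y≤z , λ { refl → x≢y (≤-antisym x≤y y≤z) }

  <-trans : ∀ {x y z} → x < y → y < z → x < z
  <-trans x<y y<z = <-≤-trans x<y (<⇒≤ y<z)

  ≤⇒≯ : ∀ {x y} → x ≤ y → ¬ (y < x)
  ≤⇒≯ x≤y y<x = <-irrefl (≤-<-trans x≤y y<x)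

  ≤⊎> : ∀ x y → x ≤ y ⊎ y < x
  ≤⊎> x y with ≤-total x y
  ... | inj₁ x≤y = inj₁ x≤y
  ... | inj₂ y≤x with em {y ≡ x}
  ...   | yes refl = inj₁ ≤-refl
  ...   | no y≢x   = inj₂ (y≤x , y≢x)

  ≮⇒≥ : ∀ {x y} → ¬ (y < x) → x ≤ y
  ≮⇒≥ {x} {y} y≮x with ≤⊎> x y
  ... | inj₁ x≤y = x≤y
  ... | inj₂ y<x = contradiction y<x y≮x

  ≰⇒> : ∀ {x y} → ¬ (x ≤ y) → y < x
  ≰⇒> {x} {y} x≰y with ≤⊎> x y
  ... | inj₁ x≤y = contradiction x≤y x≰y
  ... | inj₂ y<x = y<x

  ≤⇒0≤- : ∀ {x y} → x ≤ y → 0# ≤ y - x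
  ≤⇒0≤- {x} {y} x≤y = subst (_≤ y - x) (-‿inverseʳ x) (+-monoˡ-≤ (- x) x≤y)

  -+-cancel : ∀ x y → y - x + x ≡ y
  -+-cancel = solve 2 (λ x y → y :- x :+ x := y) refl

  0≤-⇒≤ : ∀ {x y} → 0# ≤ y - x → x ≤ y
  0≤-⇒≤ {x} {y} 0≤d = subst₂ _≤_ (+-identityˡ x) (-+-cancel x y) (+-monoˡ-≤ x 0≤d)

  <⇒0<- : ∀ {x y} → x < y → 0# < y - x
  <⇒0<- {x} {y} (x≤y , x≢y) = ≤⇒0≤- x≤y ,
    λ 0≡d → x≢y (trans (sym (+-identityˡ x)) (trans (cong (_+ x) 0≡d) (-+-cancel x y)))

  0<-⇒< : ∀ {x y} → 0# < y - x → x < y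
  0<-⇒< {x} (0≤d , 0≢d) = 0≤-⇒≤ 0≤d , λ { refl → 0≢d (sym (-‿inverseʳ x)) }

  *-cancel-0 : ∀ {x y} → x ≢ 0# → x * y ≡ 0# → y ≡ 0#
  *-cancel-0 {x} {y} x≢0 xy≡0 = begin
    y                ≡⟨ sym (*-identityˡ y) ⟩
    1# * y           ≡⟨ cong (_* y) (sym (*-inverseʳ x x≢0)) ⟩
    x * x ⁻¹ * y     ≡⟨ solve 3 (λ a b c → a :* b :* c := b :* (a :* c)) refl x (x ⁻¹) y ⟩
    x ⁻¹ * (x * y)   ≡⟨ cong (x ⁻¹ *_) xy≡0 ⟩
    x ⁻¹ * 0#        ≡⟨ zeroʳ _ ⟩
    0#               ∎
    where open ≡-Reasoning

  abstract
    *-positive : ∀ {x y} → 0# < x → 0# < y → 0# < x * y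
    *-positive (0≤x , 0≢x) (0≤y , 0≢y) = *-nonNegative 0≤x 0≤y ,
      λ 0≡xy → 0≢y (sym (*-cancel-0 (λ x≡0 → 0≢x (sym x≡0)) (sym 0≡xy)))

  sq-nonNegative : ∀ x → 0# ≤ x * x
  sq-nonNegative x with ≤-total 0# x
  ... | inj₁ 0≤x = *-nonNegative 0≤x 0≤x
  ... | inj₂ x≤0 = subst (0# ≤_) (solve 1 (λ x → (con (ℤ.+ 0) :- x) :* (con (ℤ.+ 0) :- x) := x :* x) refl x)
                     (*-nonNegative (≤⇒0≤- x≤0) (≤⇒0≤- x≤0))

  0≤1 : 0# ≤ 1#
  0≤1 = subst (0# ≤_) (*-identityˡ 1#) (sq-nonNegative 1#)

  +-nonNegative : ∀ {x y} → 0# ≤ x → 0# ≤ y → 0# ≤ x + y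
  +-nonNegative {x} {y} 0≤x 0≤y = ≤-trans 0≤y (subst (_≤ x + y) (+-identityˡ y) (+-monoˡ-≤ y 0≤x))

  +-positiveˡ : ∀ {x y} → 0# < x → 0# ≤ y → 0# < x + y
  +-positiveˡ {x} {y} 0<x 0≤y = <-≤-trans 0<x
    (0≤-⇒≤ (subst (0# ≤_) (solve 2 (λ x y → y := x :+ y :- x) refl x y) 0≤y))

  +-positiveʳ : ∀ {x y} → 0# ≤ x → 0# < y → 0# < x + y
  +-positiveʳ {x} {y} 0≤x 0<y = subst (0# <_) (+-comm y x) (+-positiveˡ 0<y 0≤x)

  abstract
    num-nonNegative : ∀ n → 0# ≤ num n
    num-positive    : ∀ n → 0# < num (suc n)

    num-nonNegative zero    = ≤-refl
    num-nonNegative (suc n) = <⇒≤ (num-positive n)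

    num-positive zero    = 0≤1 , 0≢1
    num-positive (suc n) = +-positiveʳ (<⇒≤ (num-positive n)) (0≤1 , 0≢1)

  -- A consequence of hypotheses 0 ≤ hᵢ is certified by writing it as a
  -- combination of products of the hᵢ; the resulting polynomial identity is
  -- decided by computing normal forms.

  infix 6 _:≤_ _:<_ _:≡_

  κ : ∀ {n} → ℕ → Polynomial n
  κ k = con (ℤ.+ k)

  data Relation (n : ℕ) : Set where
    _:≤_ _:<_ _:≡_ : (p q : Polynomial n) → Relation n

  difference : ∀ {n} → Relation n → Polynomial n
  difference (p :≤ q) = q :- p
  difference (p :< q) = q :- p
  difference (p :≡ q) = q :- p

  -- An equation may be multiplied by a polynomial of unknown sign, an inequality may not. The value
  -- 0 on inequalities makes such a multiple vacuous.
  equationDifference : ∀ {n} → Relation n → Polynomial n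
  equationDifference (p :≤ q) = con (ℤ.+ 0)
  equationDifference (p :< q) = con (ℤ.+ 0)
  equationDifference (p :≡ q) = q :- p

  ⟦_⟧ᵣ : ∀ {n} → Relation n → Vec ℝ n → Set
  ⟦ p :≤ q ⟧ᵣ ρ = ⟦ p ⟧ₚ ρ ≤ ⟦ q ⟧ₚ ρ
  ⟦ p :< q ⟧ᵣ ρ = ⟦ p ⟧ₚ ρ < ⟦ q ⟧ₚ ρ
  ⟦ p :≡ q ⟧ᵣ ρ = ⟦ p ⟧ₚ ρ ≡ ⟦ q ⟧ₚ ρ

  data Sign : Set where
    null positive nonnegative : Sign

  HasSign : Sign → ℝ → Set
  HasSign null        x = x ≡ 0#
  HasSign positive    x = 0# < x
  HasSign nonnegative x = 0# ≤ x

  sign : ∀ {n} → Relation n → Sign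
  sign (_ :≤ _) = nonnegative
  sign (_ :< _) = positive
  sign (_ :≡ _) = null

  _+ˢ_ _*ˢ_ : Sign → Sign → Sign
  null        +ˢ s           = s
  s           +ˢ null        = s
  positive    +ˢ _           = positive
  _           +ˢ positive    = positive
  nonnegative +ˢ nonnegative = nonnegative
  null        *ˢ _           = null
  _           *ˢ null        = null
  positive    *ˢ positive    = positive
  _           *ˢ _           = nonnegative

  infixl 6 _⊕_
  infixl 7 _⊗_

  -- The preordering generated by the hypotheses, as in the Positivstellensatz, together with the
  -- ideal generated by those hypotheses that are equations.
  data Certificate (n : ℕ) : Set where
    hyp     : ℕ → Certificate n
    _⊕_ _⊗_ : Certificate n → Certificate n → Certificate n
    lit     : ℕ → Certificate n
    sq      : Polynomial n → Certificate n
    multiple : Polynomial n → ℕ → Certificate n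

  -- The default `0 = 0` holds under every assignment, so an index is sound whatever its size.
  nth : ∀ {n} → List (Relation n) → ℕ → Relation n
  nth []       _       = con (ℤ.+ 0) :≡ con (ℤ.+ 0)
  nth (r ∷ rs) zero    = r
  nth (r ∷ rs) (suc i) = nth rs i

  module _ {n : ℕ} (hyps : List (Relation n)) where

    certified : Certificate n → Polynomial n
    certified (hyp i)        = difference (nth hyps i)
    certified (c ⊕ d)        = certified c :+ certified d
    certified (c ⊗ d)        = certified c :* certified d
    certified (lit k)        = con (ℤ.+ k)
    certified (sq p)         = p :* p
    certified (multiple p i) = p :* equationDifference (nth hyps i)

    certifiedSign : Certificate n → Sign
    certifiedSign (hyp i)        = sign (nth hyps i)
    certifiedSign (c ⊕ d)        = certifiedSign c +ˢ certifiedSign d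
    certifiedSign (c ⊗ d)        = certifiedSign c *ˢ certifiedSign d
    certifiedSign (lit zero)     = null
    certifiedSign (lit (suc k))  = positive
    certifiedSign (sq p)         = nonnegative
    certifiedSign (multiple _ _) = null

  _≤ˢ_ : Sign → Sign → Bool
  null        ≤ˢ null        = true
  nonnegative ≤ˢ _           = true
  positive    ≤ˢ positive    = true
  _           ≤ˢ _           = false

  infix 2 _⊢_

  data Sequent (n : ℕ) : Set where
    _⊢_ : List (Relation n) → Relation n → Sequent n

  -- The polynomial identity and the check of signs are paired in one equation, so that one `refl`
  -- settles both.
  Certifies : ∀ {n} → Certificate n → ℕ → Sequent n → Set
  Certifies {n} c k (hyps ⊢ goal) = _≡_ {A = Normal n × Bool}
    (normalise (con (ℤ.+ suc k) :* difference goal :- certified hyps c) , (sign goal ≤ˢ certifiedSign hyps c))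
    (0N , true)

  Holds : ∀ {n} → Sequent n → Vec ℝ n → Set
  Holds ([]       ⊢ goal) ρ = ⟦ goal ⟧ᵣ ρ
  Holds (h ∷ hyps ⊢ goal) ρ = ⟦ h ⟧ᵣ ρ → Holds (hyps ⊢ goal) ρ

  Π : ∀ n → (Vec ℝ n → Set) → Set
  Π zero    P = P []
  Π (suc n) P = ∀ x → Π n (λ ρ → P (x ∷ ρ))

  Π-intro : ∀ n {P : Vec ℝ n → Set} → (∀ ρ → P ρ) → Π n P
  Π-intro zero    f = f []
  Π-intro (suc n) f = λ x → Π-intro n (λ ρ → f (x ∷ ρ))

  null+ : ∀ {x} y → x ≡ 0# → x + y ≡ y
  null+ y refl = +-identityˡ y

  +null : ∀ x {y} → y ≡ 0# → x + y ≡ x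
  +null x refl = +-identityʳ x

  +-sign : ∀ s t {x y} → HasSign s x → HasSign t y → HasSign (s +ˢ t) (x + y)
  +-sign null        t           {y = y} p q = subst (HasSign t) (sym (null+ y p)) q
  +-sign positive    null        {x}     p q = subst (0# <_) (sym (+null x q)) p
  +-sign nonnegative null        {x}     p q = subst (0# ≤_) (sym (+null x q)) p
  +-sign positive    positive    p q = +-positiveˡ p (<⇒≤ q)
  +-sign positive    nonnegative p q = +-positiveˡ p q
  +-sign nonnegative positive    p q = +-positiveʳ p q
  +-sign nonnegative nonnegative p q = +-nonNegative p q

  *-sign : ∀ s t {x y} → HasSign s x → HasSign t y → HasSign (s *ˢ t) (x * y)
  *-sign null        t           {y = y} refl q = zeroˡ y
  *-sign positive    null        {x}     p refl = zeroʳ x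
  *-sign nonnegative null        {x}     p refl = zeroʳ x
  *-sign positive    positive    p q = *-positive p q
  *-sign positive    nonnegative p q = *-nonNegative (<⇒≤ p) q
  *-sign nonnegative positive    p q = *-nonNegative p (<⇒≤ q)
  *-sign nonnegative nonnegative p q = *-nonNegative p q

  difference-sign : ∀ {n} (r : Relation n) ρ → ⟦ r ⟧ᵣ ρ → HasSign (sign r) (⟦ difference r ⟧ₚ ρ)
  difference-sign (p :≤ q) ρ h = ≤⇒0≤- h
  difference-sign (p :< q) ρ h = <⇒0<- h
  difference-sign (p :≡ q) ρ h = trans (cong (λ x → ⟦ q ⟧ₚ ρ - x) h) (-‿inverseʳ _)

  equationDifference-null : ∀ {n} (r : Relation n) ρ → ⟦ r ⟧ᵣ ρ → ⟦ equationDifference r ⟧ₚ ρ ≡ 0#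
  equationDifference-null (p :≤ q) ρ h = refl
  equationDifference-null (p :< q) ρ h = refl
  equationDifference-null (p :≡ q) ρ h = difference-sign (p :≡ q) ρ h

  module _ {n : ℕ} (hyps : List (Relation n)) (ρ : Vec ℝ n) (valid : ∀ i → ⟦ nth hyps i ⟧ᵣ ρ) where

    certified-sign : ∀ c → HasSign (certifiedSign hyps c) (⟦ certified hyps c ⟧ₚ ρ)
    certified-sign (hyp i)       = difference-sign (nth hyps i) ρ (valid i)
    certified-sign (c ⊕ d)       =
      +-sign (certifiedSign hyps c) (certifiedSign hyps d) (certified-sign c) (certified-sign d)
    certified-sign (c ⊗ d)       =
      *-sign (certifiedSign hyps c) (certifiedSign hyps d) (certified-sign c) (certified-sign d)
    certified-sign (lit zero)    = refl
    certified-sign (lit (suc k)) = num-positive k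
    certified-sign (sq p)        = sq-nonNegative _
    certified-sign (multiple p i) =
      trans (cong (⟦ p ⟧ₚ ρ *_) (equationDifference-null (nth hyps i) ρ (valid i))) (zeroʳ _)

  normalise-zero : ∀ {n} (p : Polynomial n) → normalise p ≡ 0N → ∀ ρ → ⟦ p ⟧ₚ ρ ≡ 0#
  normalise-zero p eq ρ = trans (sym (correct p ρ)) (trans (cong (λ N → ⟦ N ⟧ₙ ρ) eq) (0N-homo ρ))

  num≢0 : ∀ k → num (suc k) ≢ 0#
  num≢0 k eq = proj₂ (num-positive k) (sym eq)

  *-cancelˡ-nonNegative : ∀ {c x} → 0# < c → 0# ≤ c * x → 0# ≤ x
  *-cancelˡ-nonNegative {c} {x} 0<c 0≤cx with ≤⊎> 0# x
  ... | inj₁ 0≤x = 0≤x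
  ... | inj₂ x<0 = contradiction
    (subst (0# <_) (solve 2 (λ c x → c :* (con (ℤ.+ 0) :- x) := con (ℤ.+ 0) :- c :* x) refl c x)
      (*-positive 0<c (<⇒0<- x<0)))
    (≤⇒≯ (0≤-⇒≤ (subst (0# ≤_) (solve 2 (λ c x → c :* x := con (ℤ.+ 0) :- (con (ℤ.+ 0) :- c :* x)) refl c x) 0≤cx)))

  *-cancelˡ-positive : ∀ {c x} → 0# < c → 0# < c * x → 0# < x
  *-cancelˡ-positive {c} {x} 0<c 0<cx = *-cancelˡ-nonNegative 0<c (<⇒≤ 0<cx) ,
    λ { refl → proj₂ 0<cx (sym (zeroʳ c)) }

  conclude : ∀ {n} (goal : Relation n) s {k} ρ {x} →
             num (suc k) * ⟦ difference goal ⟧ₚ ρ ≡ x → HasSign s x → (sign goal ≤ˢ s) ≡ true → ⟦ goal ⟧ᵣ ρ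
  conclude (p :≤ q) null        {k} ρ eq h _ =
    0≤-⇒≤ (*-cancelˡ-nonNegative (num-positive k) (≤-reflexive (sym (trans eq h))))
  conclude (p :≤ q) positive    {k} ρ eq h _ =
    0≤-⇒≤ (*-cancelˡ-nonNegative (num-positive k) (subst (0# ≤_) (sym eq) (<⇒≤ h)))
  conclude (p :≤ q) nonnegative {k} ρ eq h _ =
    0≤-⇒≤ (*-cancelˡ-nonNegative (num-positive k) (subst (0# ≤_) (sym eq) h))
  conclude (p :< q) positive    {k} ρ eq h _ = 0<-⇒< (*-cancelˡ-positive (num-positive k) (subst (0# <_) (sym eq) h))
  conclude (p :≡ q) null        {k} ρ eq h _ =
    sym (trans (sym (-+-cancel (⟦ p ⟧ₚ ρ) (⟦ q ⟧ₚ ρ))) (null+ _ (*-cancel-0 (num≢0 k) (trans eq h))))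

  entail : ∀ {n} c k (s : Sequent n) → Certifies c k s → ∀ ρ → Holds s ρ
  entail c k (hyps ⊢ goal) ok ρ = go hyps λ valid →
    conclude goal (certifiedSign hyps c) {k} ρ
      (trans (sym (-+-cancel (⟦ certified hyps c ⟧ₚ ρ) _)) (null+ _
        (normalise-zero (con (ℤ.+ suc k) :* difference goal :- certified hyps c) (cong proj₁ ok) ρ)))
      (certified-sign hyps ρ valid c) (cong proj₂ ok)
    where
    go : ∀ hs → ((∀ i → ⟦ nth hs i ⟧ᵣ ρ) → ⟦ goal ⟧ᵣ ρ) → Holds (hs ⊢ goal) ρ
    go []       f = f λ _ → refl
    go (h ∷ hs) f = λ p → go hs λ v → f λ { zero → p ; (suc i) → v i }

  variables : ∀ n → Vec (Polynomial n) n
  variables n = tabulate var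

  -- The certificate c is for suc k times the goal, so that its coefficients are natural numbers.

  abstract
    arith : ∀ n (f : N-ary n (Polynomial n) (Sequent n)) (c : N-ary n (Polynomial n) (Certificate n)) k →
            Certifies (c $ⁿ variables n) k (f $ⁿ variables n) → Π n (Holds (f $ⁿ variables n))
    arith n f c k ok = Π-intro n (entail (c $ⁿ variables n) k (f $ⁿ variables n) ok)

-- Absolute values, uniform choices of δ, and powers of one half.

module RealBounds (em : ExcludedMiddle 0ℓ) (R : RealNumbers) where

  open RealNumbers R
  open Arithmetic em R

  abstract
    *-inverse : ∀ {x} → 0# < x → x * x ⁻¹ ≡ 1#
    *-inverse {x} (_ , 0≢x) = *-inverseʳ x λ x≡0 → 0≢x (sym x≡0)

    ⁻¹-positive : ∀ {x} → 0# < x → 0# < x ⁻¹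
    ⁻¹-positive {x} 0<x = *-cancelˡ-positive 0<x (subst (0# <_) (sym (*-inverse 0<x)) (num-positive 0))

  *-cancelˡ-≤ : ∀ {c} x y → 0# < c → c * x ≤ c * y → x ≤ y
  *-cancelˡ-≤ {c} x y 0<c cx≤cy =
    0≤-⇒≤ (*-cancelˡ-nonNegative 0<c
          (arith 3 (λ c x y → (c :* x :≤ c :* y ∷ []) ⊢ κ 0 :≤ c :* (y :- x))
            (λ _ _ _ → hyp 0) 0 refl c x y cx≤cy))

  ½ : ℝ
  ½ = num 2 ⁻¹

  abstract
    2*½ : num 2 * ½ ≡ 1#
    2*½ = *-inverse (num-positive 1)

    ½-positive : 0# < ½
    ½-positive = ⁻¹-positive (num-positive 1)

    ½*-positive : ∀ {x} → 0# < x → 0# < ½ * x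
    ½*-positive 0<x = *-positive ½-positive 0<x

    ½*-< : ∀ {x} → 0# < x → ½ * x < x
    ½*-< {x} 0<x =
          (arith 2 (λ h x → (κ 2 :* h :≡ κ 1 ∷ κ 0 :< h ∷ κ 0 :< x ∷ []) ⊢ h :* x :< x)
            (λ _ x → hyp 2 ⊕ multiple x 0) 1 refl ½ x 2*½ ½-positive 0<x)

  -- If `y < x`, then for `η = (x - y) / (1 + c)` the slack `η * c` is smaller than `x - y`. The
  -- summand 1 covers the case `c = 0`.
  ≤-from-slack : ∀ x y c → 0# ≤ c → (∀ η → 0# < η → x ≤ y + η * c) → x ≤ y
  ≤-from-slack x y c 0≤c slack with ≤⊎> x y
  ... | inj₁ x≤y = x≤y
  ... | inj₂ y<x = contradiction
    (arith 4 (λ x y c i → (x :≤ y :+ (x :- y) :* i :* c ∷ κ 0 :< (x :- y) :* i ∷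
         (κ 1 :+ c) :* i :≡ κ 1 ∷ [])
         ⊢ κ 0 :< κ 0)
      (λ x y _ _ → hyp 0 ⊕ hyp 1 ⊕ multiple (x :- y) 2)
      0 refl x y c ((1# + c) ⁻¹) (slack _ 0<η) 0<η (*-inverse 0<1+c))
    <-irrefl
    where
    0<1+c : 0# < 1# + c
    0<1+c = (arith 1 (λ c → (κ 0 :≤ c ∷ []) ⊢ κ 0 :< κ 1 :+ c) (λ _ → lit 1 ⊕ hyp 0) 0 refl c 0≤c)
    0<η : 0# < (x - y) * (1# + c) ⁻¹
    0<η = *-positive (<⇒0<- y<x) (⁻¹-positive 0<1+c)

  -- Two linear inequalities in place of `∣ x ∣ ≤ e`, because a maximum is not a polynomial and
  -- certificates cannot see through it.
  record Within (e x : ℝ) : Set where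
    constructor _,_
    field
      lower : - e ≤ x
      upper : x ≤ e

  open Within public

  x≤∣x∣ : ∀ x → x ≤ ∣ x ∣
  x≤∣x∣ x = x≤x⊔y x (- x)

  -x≤∣x∣ : ∀ x → - x ≤ ∣ x ∣
  -x≤∣x∣ x = x≤y⊔x x (- x)

  ∣∣-cases : ∀ x → ∣ x ∣ ≡ x ⊎ ∣ x ∣ ≡ - x
  ∣∣-cases x = ⊔-sel x (- x)

  within-∣∣ : ∀ x → Within ∣ x ∣ x
  within-∣∣ x = (arith 2 (λ x a → (:- x :≤ a ∷ []) ⊢ :- a :≤ x)
                  (λ _ _ → hyp 0) 0 refl x (∣ x ∣) (-x≤∣x∣ x)) , x≤∣x∣ x

  ∣∣≤ : ∀ {e x} → Within e x → ∣ x ∣ ≤ e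
  ∣∣≤ {e} {x} (l , u) with ∣∣-cases x
  ... | inj₁ eq = subst (_≤ e) (sym eq) u
  ... | inj₂ eq = subst (_≤ e) (sym eq)
        (arith 2 (λ x e → (:- e :≤ x ∷ []) ⊢ :- x :≤ e)
          (λ _ _ → hyp 0) 0 refl x e l)

  ∣∣<⇒within : ∀ {e x} → ∣ x ∣ < e → Within e x
  ∣∣<⇒within {e} {x} a<e =
    (arith 3 (λ x a e → (:- x :≤ a ∷ a :< e ∷ []) ⊢ :- e :≤ x)
      (λ _ _ _ → hyp 0 ⊕ hyp 1) 0 refl x (∣ x ∣) e (-x≤∣x∣ x) a<e) , ≤-trans (x≤∣x∣ x) (<⇒≤ a<e)

  ∣∣-nonNegative : ∀ x → 0# ≤ ∣ x ∣
  ∣∣-nonNegative x =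
        (arith 2 (λ x a → (:- x :≤ a ∷ x :≤ a ∷ []) ⊢ κ 0 :≤ a)
          (λ _ _ → hyp 0 ⊕ hyp 1) 1 refl x (∣ x ∣) (-x≤∣x∣ x) (x≤∣x∣ x))

  within-nonNegative : ∀ {e x} → Within e x → 0# ≤ e
  within-nonNegative {e} {x} (l , u) =
        (arith 2 (λ e x → (:- e :≤ x ∷ x :≤ e ∷ []) ⊢ κ 0 :≤ e)
          (λ _ _ → hyp 0 ⊕ hyp 1) 1 refl e x l u)

  within-≤ : ∀ {d e x} → Within d x → d ≤ e → Within e x
  within-≤ {d} {e} {x} (l , u) d≤e =
        (arith 3 (λ d e x → (:- d :≤ x ∷ d :≤ e ∷ []) ⊢ :- e :≤ x)
          (λ _ _ _ → hyp 0 ⊕ hyp 1) 0 refl d e x l d≤e) , ≤-trans u d≤e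

  within-0 : ∀ {e x} → 0# ≤ e → x ≡ 0# → Within e x
  within-0 {e} 0≤e refl = (arith 1 (λ e → (κ 0 :≤ e ∷ []) ⊢ :- e :≤ κ 0) (λ _ → hyp 0) 0 refl e 0≤e) , 0≤e

  within-+ : ∀ {d e x y} → Within d x → Within e y → Within (d + e) (x + y)
  within-+ {d} {e} {x} {y} (l , u) (l′ , u′) =
    (arith 4 (λ d e x y → (:- d :≤ x ∷ :- e :≤ y ∷ []) ⊢ :- (d :+ e) :≤ x :+ y)
      (λ _ _ _ _ → hyp 0 ⊕ hyp 1) 0 refl d e x y l l′) ,
    (arith 4 (λ d e x y → (x :≤ d ∷ y :≤ e ∷ []) ⊢ x :+ y :≤ d :+ e)
      (λ _ _ _ _ → hyp 0 ⊕ hyp 1) 0 refl d e x y u u′)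

  within-neg : ∀ {e x} → Within e x → Within e (- x)
  within-neg {e} {x} (l , u) =
        (arith 2 (λ e x → (x :≤ e ∷ []) ⊢ :- e :≤ :- x)
          (λ _ _ → hyp 0) 0 refl e x u) ,
                (arith 2 (λ e x → (:- e :≤ x ∷ []) ⊢ :- x :≤ e)
                  (λ _ _ → hyp 0) 0 refl e x l)

  -- From `(d + x)(e + y) + (d - x)(e - y) = 2 (d e + x
  -- y)` and its companion with `y` negated; the factor 2 is the `suc k` of the certificates.
  within-* : ∀ {d e x y} → Within d x → Within e y → Within (d * e) (x * y)
  within-* {d} {e} {x} {y} (l , u) (l′ , u′) =
    (arith 4 (λ d e x y → (:- d :≤ x ∷ x :≤ d ∷ :- e :≤ y ∷ y :≤ e ∷ []) ⊢ :- (d :* e) :≤ x :* y)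
      (λ _ _ _ _ → hyp 0 ⊗ hyp 2 ⊕ hyp 1 ⊗ hyp 3) 1 refl d e x y l u l′ u′) ,
    (arith 4 (λ d e x y → (:- d :≤ x ∷ x :≤ d ∷ :- e :≤ y ∷ y :≤ e ∷ []) ⊢ x :* y :≤ d :* e)
      (λ _ _ _ _ → hyp 0 ⊗ hyp 3 ⊕ hyp 1 ⊗ hyp 2) 1 refl d e x y l u l′ u′)

  within-scale : ∀ {c e x} → 0# ≤ c → Within e x → Within (c * e) (c * x)
  within-scale {c} {e} {x} 0≤c (l , u) =
    (arith 3 (λ c e x → (κ 0 :≤ c ∷ :- e :≤ x ∷ []) ⊢ :- (c :* e) :≤ c :* x)
      (λ _ _ _ → hyp 0 ⊗ hyp 1) 0 refl c e x 0≤c l) ,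
    (arith 3 (λ c e x → (κ 0 :≤ c ∷ x :≤ e ∷ []) ⊢ c :* x :≤ c :* e)
      (λ _ _ _ → hyp 0 ⊗ hyp 1) 0 refl c e x 0≤c u)

  within-cancel : ∀ {c e x} → 0# < c → Within (c * e) (c * x) → Within e x
  within-cancel {c} {e} {x} 0<c (l , u) =
    *-cancelˡ-≤ (- e) x 0<c
          (arith 3 (λ c e x → (:- (c :* e) :≤ c :* x ∷ []) ⊢ c :* (:- e) :≤ c :* x)
            (λ _ _ _ → hyp 0) 0 refl c e x l) , *-cancelˡ-≤ x e 0<c u

  ⊓-elim : (P : ℝ → Set) → ∀ {x y} → P x → P y → P (x ⊓ y)
  ⊓-elim P {x} {y} px py with ⊓-sel x y
  ... | inj₁ eq = subst P (sym eq) px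
  ... | inj₂ eq = subst P (sym eq) py

  finite-uniform : (P : ℕ → ℝ → Set) → (∀ n {δ δ′} → δ′ ≤ δ → P n δ → P n δ′) →
                   (∀ n → ∃[ δ ] 0# < δ × P n δ) →
                   ∀ N → ∃[ δ ] 0# < δ × (∀ n → n ℕ.< N → P n δ)
  finite-uniform P shrink each zero    = 1# , num-positive 0 , λ _ ()
  finite-uniform P shrink each (suc N) with finite-uniform P shrink each N | each N
  ... | δ₁ , 0<δ₁ , p₁ | δ₂ , 0<δ₂ , p₂ = δ₁ ⊓ δ₂ , ⊓-elim (0# <_) 0<δ₁ 0<δ₂ , all
    where
    all : ∀ n → n ℕ.< suc N → P n (δ₁ ⊓ δ₂)
    all n n<1+N with ℕ.m≤n⇒m<n∨m≡n (ℕ.≤-pred n<1+N)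
    ... | inj₁ n<N  = shrink n (x⊓y≤x δ₁ δ₂) (p₁ n n<N)
    ... | inj₂ refl = shrink n (x⊓y≤y δ₁ δ₂) p₂

  tail-uniform : (P : ℕ → ℝ → Set) → (∀ n {δ δ′} → δ′ ≤ δ → P n δ → P n δ′) →
                 (∀ n → ∃[ δ ] 0# < δ × P n δ) → ∀ N → (∀ n → N ℕ.≤ n → ∀ δ → P n δ) →
                 ∃[ δ ] 0# < δ × (∀ n → P n δ)
  tail-uniform P shrink each N tail with finite-uniform P shrink each N
  ... | δ , 0<δ , p = δ , 0<δ , all
    where
    all : ∀ n → P n δ
    all n with n ℕ.<? N
    ... | yes n<N = p n n<N
    ... | no n≮N  = tail n (ℕ.≮⇒≥ n≮N) δ

  -- The powers `2^-(n+3)`. Starting at 1/8 lets the cells from `4 * halves n` to `8 * halves n`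
  -- begin at 1, with ends and centers integer multiples of `halves n`.
  halves : ℕ → ℝ
  halves zero    = ½ * (½ * ½)
  halves (suc n) = ½ * halves n

  halves-positive : ∀ n → 0# < halves n
  halves-positive zero    = ½*-positive (½*-positive ½-positive)
  halves-positive (suc n) = ½*-positive (halves-positive n)

  halves-suc : ∀ n → num 2 * halves (suc n) ≡ halves n
  halves-suc n =
        (arith 2 (λ h w → (κ 2 :* h :≡ κ 1 ∷ []) ⊢ κ 2 :* (h :* w) :≡ w)
          (λ _ w → multiple w 0) 0 refl ½ (halves n) 2*½)

  halves-antitone : ∀ {m n} → m ℕ.≤ n → halves n ≤ halves m
  halves-antitone {m} m≤n = go (ℕ.≤⇒≤′ m≤n)
    where
    go : ∀ {n} → m ℕ.≤′ n → halves n ≤ halves m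
    go ℕ.≤′-refl             = ≤-refl
    go (ℕ.≤′-step {n} m≤′n) = ≤-trans (<⇒≤ (½*-< (halves-positive n))) (go m≤′n)

  8*halves≤1 : ∀ n → num 8 * halves n ≤ 1#
  8*halves≤1 n =
        (arith 2 (λ h w → (κ 2 :* h :≡ κ 1 ∷ w :≤ h :* (h :* h) ∷ []) ⊢ κ 8 :* w :≤ κ 1)
          (λ h _ → lit 8 ⊗ hyp 1 ⊕ multiple (κ 1 :+ κ 2 :* h :+ κ 4 :* h :* h) 0)
          0 refl ½ (halves n) 2*½ (halves-antitone {0} {n} ℕ.z≤n))

  -- The Archimedean property, from completeness. The infimum `c` is formed as the supremum of the
  -- lower bounds; doubling a lower bound gives a lower bound, since each term is twice the next.
  -- Hence `2 c ≤ c`, which no positive `ε ≤ c` permits.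
  halves→0 : ∀ ε → 0# < ε → ∃[ N ] (∀ n → N ℕ.≤ n → halves n < ε)
  halves→0 ε 0<ε with em {∃[ N ] halves N < ε}
  ... | yes (N , wN<ε) = N , λ n N≤n → ≤-<-trans (halves-antitone N≤n) wN<ε
  ... | no none = contradiction 0<ε (≤⇒≯ (≤-trans ε≤c c≤0))
    where
    Below : Pred ℝ 0ℓ
    Below x = ∀ n → x ≤ halves n
    ε-below : Below ε
    ε-below n = ≮⇒≥ λ wn<ε → none (n , wn<ε)
    sup : ∃ (IsSup Below)
    sup = complete Below (ε , ε-below) (halves 0 , λ x below → below 0)
    c : ℝ
    c = proj₁ sup
    ε≤c : ε ≤ c
    ε≤c = proj₁ (proj₂ sup) ε ε-below
    c-below : Below c
    c-below n = proj₂ (proj₂ sup) (halves n) λ x below → below n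
    c≤0 : c ≤ 0#
    c≤0 = (arith 1 (λ c → (κ 2 :* c :≤ c ∷ []) ⊢ c :≤ κ 0)
            (λ _ → hyp 0) 0 refl c (proj₁ (proj₂ sup) (num 2 * c) twice))
      where
      twice : Below (num 2 * c)
      twice n = (arith 3 (λ c w v → (κ 2 :* v :≡ w ∷ c :≤ v ∷ []) ⊢ κ 2 :* c :≤ w)
                  (λ _ _ _ → lit 2 ⊗ hyp 1 ⊕ multiple (κ 1) 0)
                  0 refl c (halves n) (halves (suc n)) (halves-suc n) (c-below (suc n)))

  -- Membership proofs in a refinement type are irrelevant; excluded middle decides the proposition
  -- and so yields a proof that may be used.
  irrelevant-proof : ∀ {P : Set} → Irrelevant P → P
  irrelevant-proof [ p ] = recompute em p

-- The mean value inequality and uniformly C¹ functions.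

module UniformlyDifferentiable (em : ExcludedMiddle 0ℓ) (R : RealNumbers) where

  open RealNumbers R
  open Arithmetic em R
  open RealBounds em R

  -- Continuous induction. Some point reached from `p` lies less than `δ` to the left of the
  -- supremum `c` of all of them, and the local hypothesis at `c` leads from it to any point less
  -- than `δ` to the right of `c`. So `c + δ / 2` would be reached as well, unless `q` comes before
  -- it.
  real-induction : (P : ℝ → ℝ → Set) → (∀ {s t u} → P s t → P t u → P s u) → ∀ p q → p ≤ q →
    (∀ u → p ≤ u → u ≤ q → ∃[ δ ] 0# < δ ×
      (∀ s t → p ≤ s → s ≤ u → u ≤ t → t ≤ q → u - δ < s → t < u + δ → P s t)) →
    P p q
  real-induction P P-trans p q p≤q local =
    conclusion (complete Reached (p , p-reached) (q , λ u r → proj₁ (proj₂ r)))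
    where
    Reached : Pred ℝ 0ℓ
    Reached u = p ≤ u × u ≤ q × P p u
    p-reached : Reached p
    p-reached with local p ≤-refl p≤q
    ... | δ , 0<δ , near = ≤-refl , p≤q , near p p ≤-refl ≤-refl ≤-refl p≤q
      (arith 2 (λ p δ → (κ 0 :< δ ∷ []) ⊢ p :- δ :< p) (λ _ _ → hyp 0) 0 refl p δ 0<δ)
            (arith 2 (λ p δ → (κ 0 :< δ ∷ []) ⊢ p :< p :+ δ)
              (λ _ _ → hyp 0) 0 refl p δ 0<δ)
    module AtSup (c : ℝ) (upper : IsUpperBound Reached c) (least : ∀ b → IsUpperBound Reached b → c ≤ b)
                 (δ : ℝ) (0<δ : 0# < δ)
                 (near : ∀ s t → p ≤ s → s ≤ c → c ≤ t → t ≤ q → c - δ < s → t < c + δ → P s t) where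
      close : ∃[ s ] Reached s × c - δ < s
      close with em {∃[ s ] Reached s × c - δ < s}
      ... | yes found = found
      ... | no none = contradiction
        (least (c - δ) λ s r → ≮⇒≥ λ lt → none (s , r , lt))
        (λ c≤c-δ → <-irrefl
              (arith 2 (λ c δ → (κ 0 :< δ ∷ c :≤ c :- δ ∷ []) ⊢ κ 0 :< κ 0)
                (λ _ _ → hyp 0 ⊕ hyp 1) 0 refl c δ 0<δ c≤c-δ))
      extend : ∀ t → c ≤ t → t ≤ q → t < c + δ → P p t
      extend t c≤t t≤q t<c+δ with close
      ... | s , (p≤s , s≤q , p-s) , c-δ<s =
        P-trans p-s (near s t p≤s (upper s (p≤s , s≤q , p-s)) c≤t t≤q c-δ<s t<c+δ)
      finish : p ≤ c → c ≤ q → P p q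
      finish p≤c c≤q with ≤⊎> q (c + ½ * δ)
      ... | inj₁ q≤t = extend q c≤q ≤-refl (≤-<-trans q≤t
            (arith 3 (λ c e δ → (e :< δ ∷ []) ⊢ c :+ e :< c :+ δ)
              (λ _ _ _ → hyp 0) 0 refl c (½ * δ) δ (½*-< 0<δ)))
      ... | inj₂ t<q = contradiction
        (upper (c + ½ * δ) (≤-trans p≤c (<⇒≤ c<t) , <⇒≤ t<q ,
          extend (c + ½ * δ) (<⇒≤ c<t) (<⇒≤ t<q)
                (arith 3 (λ c e δ → (e :< δ ∷ []) ⊢ c :+ e :< c :+ δ)
                  (λ _ _ _ → hyp 0) 0 refl c (½ * δ) δ (½*-< 0<δ))))
        (λ t≤c → ≤⇒≯ t≤c c<t)
        where
        c<t : c < c + ½ * δ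
        c<t = (arith 2 (λ c e → (κ 0 :< e ∷ []) ⊢ c :< c :+ e)
                (λ _ _ → hyp 0) 0 refl c (½ * δ) (½*-positive 0<δ))
    conclusion : ∃ (IsSup Reached) → P p q
    conclusion (c , upper , least) =
      let p≤c = upper p p-reached
          c≤q = least q (λ u r → proj₁ (proj₂ r))
          δ , 0<δ , near = local c p≤c c≤q
      in AtSup.finish c upper least δ 0<δ near p≤c c≤q

  record Slopes (F : ℝ → ℝ) (lo hi s t : ℝ) : Set where
    constructor _,_
    field
      lower : lo * (t - s) ≤ F t - F s
      upper : F t - F s ≤ hi * (t - s)

  slopes-trans : ∀ F {lo hi s t u} → Slopes F lo hi s t → Slopes F lo hi t u → Slopes F lo hi s u
  slopes-trans F {lo} {hi} {s} {t} {u} (l , r) (l′ , r′) =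
    (arith 7 (λ lo s t u x y z → (lo :* (t :- s) :≤ y :- x ∷ lo :* (u :- t) :≤ z :- y ∷ [])
         ⊢ lo :* (u :- s) :≤ z :- x)
      (λ _ _ _ _ _ _ _ → hyp 0 ⊕ hyp 1) 0 refl lo s t u (F s) (F t) (F u) l l′) ,
    (arith 7 (λ hi s t u x y z → (y :- x :≤ hi :* (t :- s) ∷ z :- y :≤ hi :* (u :- t) ∷ [])
         ⊢ z :- x :≤ hi :* (u :- s))
      (λ _ _ _ _ _ _ _ → hyp 0 ⊕ hyp 1) 0 refl hi s t u (F s) (F t) (F u) r r′)

  -- Bounds on increments add up over adjacent intervals, which is the transitivity that continuous
  -- induction asks for. The two sides of `u` are treated separately and joined at `u`.
  mean-value : ∀ F lo hi p q → p ≤ q →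
    (∀ u → p ≤ u → u ≤ q → ∃[ δ ] 0# < δ ×
      (∀ v → p ≤ v → v ≤ q → u ≤ v → v < u + δ → Slopes F lo hi u v) ×
      (∀ v → p ≤ v → v ≤ q → v ≤ u → u - δ < v → Slopes F lo hi v u)) →
    Slopes F lo hi p q
  mean-value F lo hi p q p≤q local =
    real-induction (Slopes F lo hi) (slopes-trans F) p q p≤q near
    where
    near : ∀ u → p ≤ u → u ≤ q → ∃[ δ ] 0# < δ ×
      (∀ s t → p ≤ s → s ≤ u → u ≤ t → t ≤ q → u - δ < s → t < u + δ → Slopes F lo hi s t)
    near u p≤u u≤q with local u p≤u u≤q
    ... | δ , 0<δ , right , left = δ , 0<δ , λ s t p≤s s≤u u≤t t≤q u-δ<s t<u+δ →
      slopes-trans F (left s p≤s (≤-trans s≤u u≤q) s≤u u-δ<s) (right t (≤-trans p≤u u≤t) t≤q u≤t t<u+δ)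

  -- On a compact interval this is the same as being C¹, and unlike pointwise
  -- differentiability it passes to uniform limits in the C¹ norm.

  record UniformlyC¹ (F F′ : ℝ → ℝ) : Set where
    constructor uniformly
    field
      estimate : ∀ ε → 0# < ε → ∃[ δ ] 0# < δ ×
        (∀ s t d → Within d (t - s) → d < δ → Within (ε * d) (F t - F s - F′ s * (t - s)))

  open UniformlyC¹ public

  -- The error `η * d` of the estimate widens the slope bounds by `η` on each side; `η` then tends
  -- to 0 through `≤-from-slack`.
  uniform-slopes : ∀ {F F′ lo hi} → UniformlyC¹ F F′ → (∀ u → lo ≤ F′ u × F′ u ≤ hi) →
                   ∀ {p q} → p ≤ q → Slopes F lo hi p q
  uniform-slopes {F} {F′} {lo} {hi} C¹ bounds {p} {q} p≤q =
    ≤-from-slack _ _ (q - p) (≤⇒0≤- p≤q) (λ η 0<η →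
      (arith 4 (λ lo η d x → ((lo :- η) :* d :≤ x ∷ []) ⊢ lo :* d :≤ x :+ η :* d)
        (λ _ _ _ _ → hyp 0) 0 refl lo η (q - p) (F q - F p) (Slopes.lower (widened η 0<η)))) ,
    ≤-from-slack _ _ (q - p) (≤⇒0≤- p≤q) (λ η 0<η →
      (arith 4 (λ hi η d x → (x :≤ (hi :+ η) :* d ∷ []) ⊢ x :≤ hi :* d :+ η :* d)
        (λ _ _ _ _ → hyp 0) 0 refl hi η (q - p) (F q - F p) (Slopes.upper (widened η 0<η))))
    where
    widened : ∀ η → 0# < η → Slopes F (lo - η) (hi + η) p q
    widened η 0<η with estimate C¹ η 0<η
    ... | δ , 0<δ , est = mean-value F (lo - η) (hi + η) p q p≤q λ u _ _ → δ , 0<δ ,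
      (λ v _ _ u≤v v<u+δ →
        let l , r = est u v (v - u) (
              (arith 2 (λ u v → (u :≤ v ∷ []) ⊢ :- (v :- u) :≤ v :- u)
                (λ _ _ → lit 2 ⊗ hyp 0) 0 refl u v u≤v) , ≤-refl)
                      (arith 3 (λ u v δ → (v :< u :+ δ ∷ []) ⊢ v :- u :< δ)
                        (λ _ _ _ → hyp 0) 0 refl u v δ v<u+δ)
            lo≤ , ≤hi = bounds u
        in (arith 7 (λ lo η u v x y m → (lo :≤ m ∷ u :≤ v ∷
                :- (η :* (v :- u)) :≤ y :- x :- m :* (v :- u) ∷ [])
                ⊢ (lo :- η) :* (v :- u) :≤ y :- x)
             (λ _ _ _ _ _ _ _ → hyp 2 ⊕ hyp 0 ⊗ hyp 1) 0 refl lo η u v (F u) (F v) (F′ u) lo≤ u≤v l) ,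
           (arith 7 (λ hi η u v x y m → (m :≤ hi ∷ u :≤ v ∷
                y :- x :- m :* (v :- u) :≤ η :* (v :- u) ∷ [])
                ⊢ y :- x :≤ (hi :+ η) :* (v :- u))
             (λ _ _ _ _ _ _ _ → hyp 2 ⊕ hyp 0 ⊗ hyp 1) 0 refl hi η u v (F u) (F v) (F′ u) ≤hi u≤v r)) ,
      (λ v _ _ v≤u u-δ<v →
        let l , r = est u v (u - v) (
              (arith 2 (λ u v → [] ⊢ :- (u :- v) :≤ v :- u)
                (λ _ _ → lit 0) 0 refl u v) ,
                      (arith 2 (λ u v → (v :≤ u ∷ []) ⊢ v :- u :≤ u :- v)
                        (λ _ _ → lit 2 ⊗ hyp 0) 0 refl u v v≤u))
                              (arith 3 (λ u v δ → (u :- δ :< v ∷ []) ⊢ u :- v :< δ)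
                                (λ _ _ _ → hyp 0) 0 refl u v δ u-δ<v)
            lo≤ , ≤hi = bounds u
        in (arith 7 (λ lo η u v x y m → (lo :≤ m ∷ v :≤ u ∷
                y :- x :- m :* (v :- u) :≤ η :* (u :- v) ∷ [])
                ⊢ (lo :- η) :* (u :- v) :≤ x :- y)
             (λ _ _ _ _ _ _ _ → hyp 2 ⊕ hyp 0 ⊗ hyp 1) 0 refl lo η u v (F u) (F v) (F′ u) lo≤ v≤u r) ,
           (arith 7 (λ hi η u v x y m → (m :≤ hi ∷ v :≤ u ∷
                :- (η :* (u :- v)) :≤ y :- x :- m :* (v :- u) ∷ [])
                ⊢ x :- y :≤ (hi :+ η) :* (u :- v))
             (λ _ _ _ _ _ _ _ → hyp 2 ⊕ hyp 0 ⊗ hyp 1) 0 refl hi η u v (F u) (F v) (F′ u) ≤hi v≤u l))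

  slopes-within : ∀ {F K} → (∀ {p q} → p ≤ q → Slopes F (- K) K p q) →
                  ∀ s t d → Within d (t - s) → 0# ≤ K → Within (K * d) (F t - F s)
  slopes-within {F} {K} slopes s t d (l , r) 0≤K with ≤-total s t
  ... | inj₁ s≤t = let a , b = slopes s≤t in
    (arith 6 (λ K d s t x y → ((:- K) :* (t :- s) :≤ y :- x ∷ t :- s :≤ d ∷ κ 0 :≤ K ∷ [])
         ⊢ :- (K :* d) :≤ y :- x)
      (λ _ _ _ _ _ _ → hyp 0 ⊕ hyp 1 ⊗ hyp 2) 0 refl K d s t (F s) (F t) a r 0≤K) ,
    (arith 6 (λ K d s t x y → (y :- x :≤ K :* (t :- s) ∷ t :- s :≤ d ∷ κ 0 :≤ K ∷ [])
         ⊢ y :- x :≤ K :* d)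
      (λ _ _ _ _ _ _ → hyp 0 ⊕ hyp 1 ⊗ hyp 2) 0 refl K d s t (F s) (F t) b r 0≤K)
  ... | inj₂ t≤s = let a , b = slopes t≤s in
    (arith 6 (λ K d s t x y → (x :- y :≤ K :* (s :- t) ∷ :- d :≤ t :- s ∷ κ 0 :≤ K ∷ [])
         ⊢ :- (K :* d) :≤ y :- x)
      (λ _ _ _ _ _ _ → hyp 0 ⊕ hyp 1 ⊗ hyp 2) 0 refl K d s t (F s) (F t) b l 0≤K) ,
    (arith 6 (λ K d s t x y → ((:- K) :* (s :- t) :≤ x :- y ∷ :- d :≤ t :- s ∷ κ 0 :≤ K ∷ [])
         ⊢ y :- x :≤ K :* d)
      (λ _ _ _ _ _ _ → hyp 0 ⊕ hyp 1 ⊗ hyp 2) 0 refl K d s t (F s) (F t) a l 0≤K)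

  uniform-lipschitz : ∀ {F F′ K} → UniformlyC¹ F F′ → 0# ≤ K → (∀ u → Within K (F′ u)) →
                      ∀ s t d → Within d (t - s) → Within (K * d) (F t - F s)
  uniform-lipschitz C¹ 0≤K bound s t d w =
    slopes-within (uniform-slopes C¹ λ u → lower (bound u) , upper (bound u)) s t d w 0≤K

  uniform-difference : ∀ {F F′ G G′} → UniformlyC¹ F F′ → UniformlyC¹ G G′ →
                       UniformlyC¹ (λ t → F t - G t) (λ t → F′ t - G′ t)
  uniform-difference {F} {F′} {G} {G′} C¹ D¹ .estimate ε 0<ε
    with estimate C¹ (½ * ε) (½*-positive 0<ε) | estimate D¹ (½ * ε) (½*-positive 0<ε)
  ... | δ , 0<δ , est | δ′ , 0<δ′ , est′ = δ ⊓ δ′ , ⊓-elim (0# <_) 0<δ 0<δ′ , λ s t d w d<δ →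
    subst₂ Within
      (arith 3 (λ h ε d → (κ 2 :* h :≡ κ 1 ∷ []) ⊢ h :* ε :* d :+ h :* ε :* d :≡ ε :* d)
        (λ _ ε d → multiple (d :* ε) 0) 0 refl ½ ε d 2*½)
      (arith 8 (λ a b c a′ b′ c′ s t → []
           ⊢ b :- a :- c :* (t :- s) :+ (:- (b′ :- a′ :- c′ :* (t :- s)))
             :≡ b :- b′ :- (a :- a′) :- (c :- c′) :* (t :- s))
        (λ _ _ _ _ _ _ _ _ → lit 0) 0 refl (F s) (F t) (F′ s) (G s) (G t) (G′ s) s t)
      (within-+ (est s t d w (<-≤-trans d<δ (x⊓y≤x δ δ′))) (within-neg (est′ s t d w (<-≤-trans d<δ (x⊓y≤y δ δ′)))))

  identity-uniform : UniformlyC¹ (λ t → t) (λ _ → 1#)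
  identity-uniform .estimate ε 0<ε = 1# , num-positive 0 , λ s t d w _ →
    within-0 (*-nonNegative (<⇒≤ 0<ε) (within-nonNegative w))
          (arith 2 (λ s t → [] ⊢ t :- s :- κ 1 :* (t :- s) :≡ κ 0)
            (λ _ _ → lit 0) 0 refl s t)

  -- The sum of the estimates based at `s` and at `t` is `(t - s) * (F′ t - F′ s)`, since the
  -- increments of `F` cancel. Dividing by `t - s` leaves twice the tolerance, hence `½ * ε`.
  derivative-uniformly-continuous : ∀ {F F′} → UniformlyC¹ F F′ → ∀ ε → 0# < ε →
    ∃[ δ ] 0# < δ × (∀ s t → ∣ t - s ∣ < δ → Within ε (F′ t - F′ s))
  derivative-uniformly-continuous {F} {F′} C¹ ε 0<ε with estimate C¹ (½ * ε) (½*-positive 0<ε)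
  ... | δ , 0<δ , est = δ , 0<δ , near
    where
    ordered : ∀ s t → s < t → t - s < δ → Within ε (F′ t - F′ s)
    ordered s t s<t d<δ = within-cancel (<⇒0<- s<t) (subst₂ Within
      (arith 4 (λ h ε s t → (κ 2 :* h :≡ κ 1 ∷ [])
           ⊢ h :* ε :* (t :- s) :+ h :* ε :* (t :- s) :≡ (t :- s) :* ε)
        (λ _ ε s t → multiple (t :* ε :- s :* ε) 0) 0 refl ½ ε s t 2*½)
      (arith 6 (λ a b c c′ s t → []
           ⊢ b :- a :- c :* (t :- s) :+ (a :- b :- c′ :* (s :- t)) :≡ (t :- s) :* (c′ :- c))
        (λ _ _ _ _ _ _ → lit 0) 0 refl (F s) (F t) (F′ s) (F′ t) s t)
      (within-+ (est s t (t - s) (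
            (arith 2 (λ s t → (s :≤ t ∷ []) ⊢ :- (t :- s) :≤ t :- s)
              (λ _ _ → lit 2 ⊗ hyp 0) 0 refl s t (<⇒≤ s<t)) , ≤-refl) d<δ)
                (est t s (t - s) (
                      (arith 2 (λ s t → [] ⊢ :- (t :- s) :≤ s :- t)
                        (λ _ _ → lit 0) 0 refl s t) ,
                              (arith 2 (λ s t → (s :≤ t ∷ []) ⊢ s :- t :≤ t :- s)
                                (λ _ _ → lit 2 ⊗ hyp 0) 0 refl s t (<⇒≤ s<t))) d<δ)))
    near : ∀ s t → ∣ t - s ∣ < δ → Within ε (F′ t - F′ s)
    near s t a<δ with ≤⊎> s t
    ... | inj₂ t<s = subst (Within ε)
          (arith 2 (λ a b → [] ⊢ :- (a :- b) :≡ b :- a)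
            (λ _ _ → lit 0) 0 refl (F′ s) (F′ t))
                       (within-neg (ordered t s t<s (≤-<-trans
                             (arith 3 (λ s t a → (:- (t :- s) :≤ a ∷ []) ⊢ s :- t :≤ a)
                               (λ _ _ _ → hyp 0) 0 refl s t (∣ t - s ∣) (-x≤∣x∣ (t - s))) a<δ)))
    ... | inj₁ s≤t with em {s ≡ t}
    ...   | yes refl = within-0 (<⇒≤ 0<ε)
          (arith 1 (λ a → [] ⊢ a :- a :≡ κ 0)
            (λ _ → lit 0) 0 refl (F′ s))
    ...   | no s≢t   = ordered s t (s≤t , s≢t) (≤-<-trans (x≤∣x∣ (t - s)) a<δ)

  uniform-compose : ∀ {F F′ G G′ K L} → UniformlyC¹ F F′ → UniformlyC¹ G G′ → 0# < K → 0# < L →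
    (∀ u → Within K (F′ u)) → (∀ u → Within L (G′ u)) →
    UniformlyC¹ (λ t → G (F t)) (λ t → G′ (F t) * F′ t)
  uniform-compose {F} {F′} {G} {G′} {K} {L} C¹ D¹ 0<K 0<L F′-bound G′-bound .estimate ε 0<ε =
    δ ⊓ (δ′ * K ⁻¹) , ⊓-elim (0# <_) 0<δ (*-positive 0<δ′ (⁻¹-positive 0<K)) , λ s t d w d<min →
    let image : Within (K * d) (F t - F s)
        image = uniform-lipschitz C¹ (<⇒≤ 0<K) F′-bound s t d w
        Kd<δ′ : K * d < δ′
        Kd<δ′ = (arith 4 (λ K i d δ′ → (κ 0 :< K ∷ K :* i :≡ κ 1 ∷ d :< δ′ :* i ∷ [])
                     ⊢ K :* d :< δ′)
                  (λ _ _ _ δ′ → hyp 0 ⊗ hyp 2 ⊕ multiple δ′ 1)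
                  0 refl K (K ⁻¹) d δ′ 0<K (*-inverse 0<K) (<-≤-trans d<min (x⊓y≤y δ _)))
    in subst₂ Within
        (arith 7 (λ h K i L j d ε → (κ 2 :* h :≡ κ 1 ∷ K :* i :≡ κ 1 ∷ L :* j :≡ κ 1 ∷ [])
             ⊢ h :* ε :* i :* (K :* d) :+ L :* (h :* ε :* j :* d) :≡ ε :* d)
          (λ h _ _ _ _ d ε → multiple (d :* ε) 0 ⊕ multiple (d :* h :* ε) 1 ⊕ multiple (d :* h :* ε)
            2)
          0 refl ½ K (K ⁻¹) L (L ⁻¹) d ε 2*½ (*-inverse 0<K) (*-inverse 0<L))
        (arith 8 (λ a b m x y l s t → []
             ⊢ y :- x :- l :* (b :- a) :+ l :* (b :- a :- m :* (t :- s))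
               :≡ y :- x :- l :* m :* (t :- s))
          (λ _ _ _ _ _ _ _ _ → lit 0) 0 refl (F s) (F t) (F′ s) (G (F s)) (G (F t)) (G′ (F s)) s t)
        (within-+ (est′ (F s) (F t) (K * d) image Kd<δ′)
                  (within-* (G′-bound (F s)) (est s t d w (<-≤-trans d<min (x⊓y≤x δ _)))))
    where
    ε₁ ε₂ : ℝ
    -- The error of `F` gets multiplied by a value of `G′`, at most `L`; the error of `G` is
    -- incurred on an increment of size `K * d`. Each then contributes `½ * ε * d`.
    ε₁ = ½ * ε * L ⁻¹
    ε₂ = ½ * ε * K ⁻¹
    D = estimate C¹ ε₁ (*-positive (½*-positive 0<ε) (⁻¹-positive 0<L))
    D′ = estimate D¹ ε₂ (*-positive (½*-positive 0<ε) (⁻¹-positive 0<K))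
    δ δ′ : ℝ
    δ = proj₁ D
    δ′ = proj₁ D′
    0<δ : 0# < δ
    0<δ = proj₁ (proj₂ D)
    0<δ′ : 0# < δ′
    0<δ′ = proj₁ (proj₂ D′)
    est = proj₂ (proj₂ D)
    est′ = proj₂ (proj₂ D′)

-- The piecewise cubic profile of a bump.

module Profile (em : ExcludedMiddle 0ℓ) (R : RealNumbers) where

  open RealNumbers R
  open Arithmetic em R
  open RealBounds em R
  open UniformlyDifferentiable em R

  glue : ℝ → (F G : ℝ → ℝ) → ℝ → ℝ
  glue k F G v with ≤⊎> v k
  ... | inj₁ _ = F v
  ... | inj₂ _ = G v

  glue-elim : (P : ℝ → ℝ → Set) → ∀ {k F G} v → (v ≤ k → P v (F v)) → (k < v → P v (G v)) → P v (glue k F G v)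
  glue-elim P {k} v l r with ≤⊎> v k
  ... | inj₁ v≤k = l v≤k
  ... | inj₂ k<v = r k<v

  glue-≤ : ∀ {k F G v} → v ≤ k → glue k F G v ≡ F v
  glue-≤ {k} {F} {G} {v} v≤k =
    glue-elim (λ v y → y ≡ F v) {k} {F} {G} v (λ _ → refl) (λ k<v → contradiction k<v (≤⇒≯ v≤k))

  glue-≥ : ∀ {k F G v} → F k ≡ G k → k ≤ v → glue k F G v ≡ G v
  glue-≥ {k} {F} {G} {v} eq k≤v = glue-elim (λ v y → k ≤ v → y ≡ G v) {k} {F} {G} v
    (λ v≤k k≤v → subst (λ w → F w ≡ G w) (≤-antisym k≤v v≤k) eq) (λ _ _ → refl) k≤v

  -- A second order estimate that survives gluing; the constant 8 suits all pieces below.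

  record Taylor (F F′ : ℝ → ℝ) (u v : ℝ) : Set where
    constructor taylor
    field
      forward    : Within (num 8 * ((v - u) * (v - u))) (F v - F u - F′ u * (v - u))
      backward   : Within (num 8 * ((v - u) * (v - u))) (F u - F v - F′ v * (u - v))
      derivative : Within (num 16 * (v - u)) (F′ v - F′ u)

  -- With `a = k - u` and `b = v - k`, moving the base point of the derivative costs `16 a b`, and
  -- `8 a² + 8 b² + 16 a b = 8 (a + b)²`. So the constants 8 and 16 reproduce themselves, which is
  -- what allows repeated gluing.
  taylor-trans : ∀ {F F′ u k v} → u ≤ k → k ≤ v → Taylor F F′ u k → Taylor F F′ k v → Taylor F F′ u v
  taylor-trans {F} {F′} {u} {k} {v} u≤k k≤v
    (taylor (a , a⁺) (b , b⁺) (c , c⁺)) (taylor (a′ , a′⁺) (b′ , b′⁺) (c′ , c′⁺)) = record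
    { forward =
        (arith 8 (λ u k v x y z l m → (u :≤ k ∷ k :≤ v ∷
             :- (κ 8 :* ((k :- u) :* (k :- u))) :≤ y :- x :- l :* (k :- u) ∷
             :- (κ 8 :* ((v :- k) :* (v :- k))) :≤ z :- y :- m :* (v :- k) ∷
             :- (κ 16 :* (k :- u)) :≤ m :- l ∷ [])
             ⊢ :- (κ 8 :* ((v :- u) :* (v :- u))) :≤ z :- x :- l :* (v :- u))
          (λ _ _ _ _ _ _ _ _ → hyp 2 ⊕ hyp 3 ⊕ hyp 1 ⊗ hyp 4)
          0 refl u k v (F u) (F k) (F v) (F′ u) (F′ k) u≤k k≤v a a′ c) ,
        (arith 8 (λ u k v x y z l m → (u :≤ k ∷ k :≤ v ∷
             y :- x :- l :* (k :- u) :≤ κ 8 :* ((k :- u) :* (k :- u)) ∷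
             z :- y :- m :* (v :- k) :≤ κ 8 :* ((v :- k) :* (v :- k)) ∷ m :- l :≤ κ 16 :* (k :- u) ∷
             [])
             ⊢ z :- x :- l :* (v :- u) :≤ κ 8 :* ((v :- u) :* (v :- u)))
          (λ _ _ _ _ _ _ _ _ → hyp 2 ⊕ hyp 3 ⊕ hyp 1 ⊗ hyp 4)
          0 refl u k v (F u) (F k) (F v) (F′ u) (F′ k) u≤k k≤v a⁺ a′⁺ c⁺)
    ; backward =
        (arith 8 (λ u k v x y z m n → (u :≤ k ∷ k :≤ v ∷
             :- (κ 8 :* ((k :- u) :* (k :- u))) :≤ x :- y :- m :* (u :- k) ∷
             :- (κ 8 :* ((v :- k) :* (v :- k))) :≤ y :- z :- n :* (k :- v) ∷
             :- (κ 16 :* (v :- k)) :≤ n :- m ∷ [])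
             ⊢ :- (κ 8 :* ((v :- u) :* (v :- u))) :≤ x :- z :- n :* (u :- v))
          (λ _ _ _ _ _ _ _ _ → hyp 2 ⊕ hyp 3 ⊕ hyp 0 ⊗ hyp 4)
          0 refl u k v (F u) (F k) (F v) (F′ k) (F′ v) u≤k k≤v b b′ c′) ,
        (arith 8 (λ u k v x y z m n → (u :≤ k ∷ k :≤ v ∷
             x :- y :- m :* (u :- k) :≤ κ 8 :* ((k :- u) :* (k :- u)) ∷
             y :- z :- n :* (k :- v) :≤ κ 8 :* ((v :- k) :* (v :- k)) ∷ n :- m :≤ κ 16 :* (v :- k) ∷
             [])
             ⊢ x :- z :- n :* (u :- v) :≤ κ 8 :* ((v :- u) :* (v :- u)))
          (λ _ _ _ _ _ _ _ _ → hyp 2 ⊕ hyp 3 ⊕ hyp 0 ⊗ hyp 4)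
          0 refl u k v (F u) (F k) (F v) (F′ k) (F′ v) u≤k k≤v b⁺ b′⁺ c′⁺)
    ; derivative =
        (arith 6 (λ u k v l m n → (:- (κ 16 :* (k :- u)) :≤ m :- l ∷
             :- (κ 16 :* (v :- k)) :≤ n :- m ∷ [])
             ⊢ :- (κ 16 :* (v :- u)) :≤ n :- l)
          (λ _ _ _ _ _ _ → hyp 0 ⊕ hyp 1) 0 refl u k v (F′ u) (F′ k) (F′ v) c c′) ,
        (arith 6 (λ u k v l m n → (m :- l :≤ κ 16 :* (k :- u) ∷ n :- m :≤ κ 16 :* (v :- k) ∷ [])
             ⊢ n :- l :≤ κ 16 :* (v :- u))
          (λ _ _ _ _ _ _ → hyp 0 ⊕ hyp 1) 0 refl u k v (F′ u) (F′ k) (F′ v) c⁺ c′⁺)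
    }

  Smooth : Pred ℝ 0ℓ → (F F′ : ℝ → ℝ) → Set
  Smooth D F F′ = ∀ u v → D u → D v → u ≤ v → Taylor F F′ u v

  taylor-cong : ∀ {F F′ G G′ u v} → F u ≡ G u → F v ≡ G v → F′ u ≡ G′ u → F′ v ≡ G′ v →
                Taylor G G′ u v → Taylor F F′ u v
  taylor-cong {F} {F′} {G} {G′} {u} {v} a b c d (taylor f g h) = taylor
    (subst (Within _) (sym (cong₂ _-_ (cong₂ _-_ b a) (cong (_* (v - u)) c))) f)
    (subst (Within _) (sym (cong₂ _-_ (cong₂ _-_ a b) (cong (_* (u - v)) d))) g)
    (subst (Within _) (sym (cong₂ _-_ d c)) h)

  glue-smooth : ∀ {D : Pred ℝ 0ℓ} k {F F′ G G′} → D k → F k ≡ G k → F′ k ≡ G′ k →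
                Smooth (λ v → D v × v ≤ k) F F′ → Smooth (k ≤_) G G′ →
                Smooth D (glue k F G) (glue k F′ G′)
  glue-smooth {D} k {F} {F′} {G} {G′} Dk eq eq′ left right = smooth
    where
    smoothˡ : ∀ u v → D u → D v → u ≤ v → v ≤ k → Taylor (glue k F G) (glue k F′ G′) u v
    smoothˡ u v Du Dv u≤v v≤k = taylor-cong (glue-≤ u≤k) (glue-≤ v≤k) (glue-≤ u≤k) (glue-≤ v≤k)
      (left u v (Du , u≤k) (Dv , v≤k) u≤v)
      where
      u≤k = ≤-trans u≤v v≤k
    smoothʳ : ∀ u v → u ≤ v → k ≤ u → Taylor (glue k F G) (glue k F′ G′) u v
    smoothʳ u v u≤v k≤u = taylor-cong (glue-≥ eq k≤u) (glue-≥ eq k≤v) (glue-≥ eq′ k≤u) (glue-≥ eq′ k≤v)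
      (right u v k≤u k≤v u≤v)
      where
      k≤v = ≤-trans k≤u u≤v
    smooth : Smooth D (glue k F G) (glue k F′ G′)
    smooth u v Du Dv u≤v with ≤-total v k
    ... | inj₁ v≤k = smoothˡ u v Du Dv u≤v v≤k
    ... | inj₂ k≤v with ≤-total u k
    ...   | inj₁ u≤k = taylor-trans u≤k k≤v (smoothˡ u k Du Dk u≤k ≤-refl) (smoothʳ k v k≤v ≤-refl)
    ...   | inj₂ k≤u = smoothʳ u v u≤v k≤u

  -- The Hermite cubic with value and slope 1 at 1 and value and slope 0 at 2.

  cubic cubic′ : ℝ → ℝ
  cubic  v = (num 2 - v) * (num 2 - v) * (num 3 * v - num 2)
  cubic′ v = (num 2 - v) * (num 10 - num 9 * v)

  -- On [1,2] the second derivative `18 v - 28` runs from -10 to 8, well within 16 in absolute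
  -- value.
  cubic-smooth : Smooth (λ v → 1# ≤ v × v ≤ num 2) cubic cubic′
  cubic-smooth u v (1≤u , u≤2) (1≤v , v≤2) u≤v = taylor
    ((arith 2 (λ u v → (κ 1 :≤ u ∷ u :≤ v ∷ v :≤ κ 2 ∷ [])
          ⊢ :- (κ 8 :* ((v :- u) :* (v :- u)))
            :≤ (κ 2 :- v) :* (κ 2 :- v) :* (κ 3 :* v :- κ 2) :- (κ 2 :- u) :* (κ 2
              :- u) :* (κ 3 :* u :- κ 2) :- (κ 2 :- u) :* (κ 10 :- κ 9 :* u) :* (v :- u))
       (λ _ _ → lit 3 ⊗ hyp 1 ⊗ hyp 1 ⊕ lit 9 ⊗ hyp 0 ⊗ hyp 1 ⊗ hyp 1
         ⊕ lit 3 ⊗ hyp 1 ⊗ hyp 1 ⊗ hyp 1)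
       0 refl u v 1≤u u≤v v≤2) ,
     (arith 2 (λ u v → (κ 1 :≤ u ∷ u :≤ v ∷ v :≤ κ 2 ∷ [])
          ⊢ (κ 2 :- v) :* (κ 2 :- v) :* (κ 3 :* v :- κ 2) :- (κ 2 :- u) :* (κ 2 :- u) :* (κ 3 :* u
              :- κ 2) :- (κ 2 :- u) :* (κ 10 :- κ 9 :* u) :* (v :- u)
            :≤ κ 8 :* ((v :- u) :* (v :- u)))
       (λ _ _ → lit 4 ⊗ hyp 1 ⊗ hyp 1 ⊕ lit 6 ⊗ hyp 1 ⊗ hyp 1 ⊗ hyp 1
         ⊕ lit 9 ⊗ hyp 1 ⊗ hyp 1 ⊗ hyp 2)
       0 refl u v 1≤u u≤v v≤2))
    ((arith 2 (λ u v → (κ 1 :≤ u ∷ u :≤ v ∷ v :≤ κ 2 ∷ [])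
          ⊢ :- (κ 8 :* ((v :- u) :* (v :- u)))
            :≤ (κ 2 :- u) :* (κ 2 :- u) :* (κ 3 :* u :- κ 2) :- (κ 2 :- v) :* (κ 2
              :- v) :* (κ 3 :* v :- κ 2) :- (κ 2 :- v) :* (κ 10 :- κ 9 :* v) :* (u :- v))
       (λ _ _ → lit 3 ⊗ hyp 1 ⊗ hyp 1 ⊕ lit 9 ⊗ hyp 0 ⊗ hyp 1 ⊗ hyp 1
         ⊕ lit 6 ⊗ hyp 1 ⊗ hyp 1 ⊗ hyp 1)
       0 refl u v 1≤u u≤v v≤2) ,
     (arith 2 (λ u v → (κ 1 :≤ u ∷ u :≤ v ∷ v :≤ κ 2 ∷ [])
          ⊢ (κ 2 :- u) :* (κ 2 :- u) :* (κ 3 :* u :- κ 2) :- (κ 2 :- v) :* (κ 2 :- v) :* (κ 3 :* v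
              :- κ 2) :- (κ 2 :- v) :* (κ 10 :- κ 9 :* v) :* (u :- v)
            :≤ κ 8 :* ((v :- u) :* (v :- u)))
       (λ _ _ → lit 4 ⊗ hyp 1 ⊗ hyp 1 ⊕ lit 3 ⊗ hyp 1 ⊗ hyp 1 ⊗ hyp 1
         ⊕ lit 9 ⊗ hyp 1 ⊗ hyp 1 ⊗ hyp 2)
       0 refl u v 1≤u u≤v v≤2))
    ((arith 2 (λ u v → (κ 1 :≤ u ∷ u :≤ v ∷ v :≤ κ 2 ∷ [])
          ⊢ :- (κ 16 :* (v :- u))
            :≤ (κ 2 :- v) :* (κ 10 :- κ 9 :* v) :- (κ 2 :- u) :* (κ 10 :- κ 9 :* u))
       (λ _ _ → lit 6 ⊗ hyp 1 ⊕ lit 18 ⊗ hyp 0 ⊗ hyp 1 ⊕ lit 9 ⊗ hyp 1 ⊗ hyp 1)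
       0 refl u v 1≤u u≤v v≤2) ,
     (arith 2 (λ u v → (κ 1 :≤ u ∷ u :≤ v ∷ v :≤ κ 2 ∷ [])
          ⊢ (κ 2 :- v) :* (κ 10 :- κ 9 :* v) :- (κ 2 :- u) :* (κ 10 :- κ 9 :* u)
            :≤ κ 16 :* (v :- u))
       (λ _ _ → lit 8 ⊗ hyp 1 ⊕ lit 9 ⊗ hyp 1 ⊗ hyp 1 ⊕ lit 18 ⊗ hyp 1 ⊗ hyp 2)
       0 refl u v 1≤u u≤v v≤2))

  -- Reflection reverses the order of the two points and thus exchanges the forward and the backward
  -- estimate.
  odd-smooth : ∀ {D : Pred ℝ 0ℓ} {F F′} → Smooth D F F′ → Smooth (λ v → D (- v)) (λ v → - F (- v)) (λ v → F′ (- v))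
  odd-smooth {F = F} {F′} smooth u v Du Dv u≤v with smooth (- v) (- u) Dv Du
        (arith 2 (λ u v → (u :≤ v ∷ []) ⊢ :- v :≤ :- u)
          (λ _ _ → hyp 0) 0 refl u v u≤v)
  ... | taylor f b d = taylor
    (subst₂ Within
          (arith 2 (λ u v → []
               ⊢ κ 8 :* (((:- u) :- (:- v)) :* ((:- u) :- (:- v))) :≡ κ 8 :* ((v :- u) :* (v :- u)))
            (λ _ _ → lit 0) 0 refl u v)
      (arith 5 (λ u v x y l → []
           ⊢ :- (y :- x :- l :* ((:- v) :- (:- u))) :≡ (:- y) :- (:- x) :- l :* (v :- u))
        (λ _ _ _ _ _ → lit 0) 0 refl u v (F (- u)) (F (- v)) (F′ (- u)))
      (within-neg b))
    (subst₂ Within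
          (arith 2 (λ u v → []
               ⊢ κ 8 :* (((:- u) :- (:- v)) :* ((:- u) :- (:- v))) :≡ κ 8 :* ((v :- u) :* (v :- u)))
            (λ _ _ → lit 0) 0 refl u v)
      (arith 5 (λ u v x y l → []
           ⊢ :- (x :- y :- l :* ((:- u) :- (:- v))) :≡ (:- x) :- (:- y) :- l :* (u :- v))
        (λ _ _ _ _ _ → lit 0) 0 refl u v (F (- u)) (F (- v)) (F′ (- v)))
      (within-neg f))
    (subst₂ Within
          (arith 2 (λ u v → [] ⊢ κ 16 :* ((:- u) :- (:- v)) :≡ κ 16 :* (v :- u))
            (λ _ _ → lit 0) 0 refl u v)
      (arith 2 (λ x y → [] ⊢ :- (x :- y) :≡ y :- x) (λ _ _ → lit 0) 0 refl (F′ (- u)) (F′ (- v)))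
      (within-neg d))

  linear-smooth : ∀ {D : Pred ℝ 0ℓ} m → Smooth D (λ v → m * v) (λ _ → m)
  linear-smooth m u v _ _ u≤v = taylor
    (within-0 square
          (arith 3 (λ m u v → [] ⊢ m :* v :- m :* u :- m :* (v :- u) :≡ κ 0)
            (λ _ _ _ → lit 0) 0 refl m u v)) (within-0 square
                  (arith 3 (λ m u v → [] ⊢ m :* u :- m :* v :- m :* (u :- v) :≡ κ 0)
                    (λ _ _ _ → lit 0) 0 refl m u v))
    (within-0 (arith 2 (λ u v → (u :≤ v ∷ []) ⊢ κ 0 :≤ κ 16 :* (v :- u))
                (λ _ _ → lit 16 ⊗ hyp 0) 0 refl u v u≤v)
                      (arith 1 (λ m → [] ⊢ m :- m :≡ κ 0)
                        (λ _ → lit 0) 0 refl m))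
    where
    square : 0# ≤ num 8 * ((v - u) * (v - u))
    square = (arith 2 (λ u v → (u :≤ v ∷ []) ⊢ κ 0 :≤ κ 8 :* ((v :- u) :* (v :- u)))
               (λ _ _ → lit 8 ⊗ hyp 0 ⊗ hyp 0) 0 refl u v u≤v)

  -- The odd function equal to the identity on [-1,1], to the cubic on [1,2] and to 0 beyond.

  profile₁ profile₂ profile₃ profile profile₁′ profile₂′ profile₃′ profile′ : ℝ → ℝ
  profile₃  = glue (num 2) cubic (0# *_)
  profile₃′ = glue (num 2) cubic′ (λ _ → 0#)
  profile₂  = glue 1# (1# *_) profile₃
  profile₂′ = glue 1# (λ _ → 1#) profile₃′
  profile₁  = glue (- 1#) (λ v → - cubic (- v)) profile₂
  profile₁′ = glue (- 1#) (λ v → cubic′ (- v)) profile₂′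
  profile   = glue (- num 2) (0# *_) profile₁
  profile′  = glue (- num 2) (λ _ → 0#) profile₁′

  2-node : cubic (num 2) ≡ 0# * num 2
  2-node = (arith 1 (λ x → [] ⊢ (κ 2 :- κ 2) :* (κ 2 :- κ 2) :* (κ 3 :* κ 2 :- κ 2) :≡ κ 0 :* κ 2)
             (λ _ → lit 0) 0 refl 0#)

  2-node′ : cubic′ (num 2) ≡ 0#
  2-node′ = (arith 1 (λ x → [] ⊢ (κ 2 :- κ 2) :* (κ 10 :- κ 9 :* κ 2) :≡ κ 0)
              (λ _ → lit 0) 0 refl 0#)

  1≤2 : 1# ≤ num 2
  1≤2 = (arith 1 (λ x → [] ⊢ κ 1 :≤ κ 2) (λ _ → lit 1) 0 refl 0#)

  1-node : 1# * 1# ≡ profile₃ 1#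
  1-node = sym (trans (glue-≤ 1≤2)
        (arith 1 (λ x → [] ⊢ (κ 2 :- κ 1) :* (κ 2 :- κ 1) :* (κ 3 :* κ 1 :- κ 2) :≡ κ 1 :* κ 1)
          (λ _ → lit 0) 0 refl 0#))

  1-node′ : 1# ≡ profile₃′ 1#
  1-node′ = sym (trans (glue-≤ 1≤2)
        (arith 1 (λ x → [] ⊢ (κ 2 :- κ 1) :* (κ 10 :- κ 9 :* κ 1) :≡ κ 1)
          (λ _ → lit 0) 0 refl 0#))

  -1≤1 : - 1# ≤ 1#
  -1≤1 = (arith 1 (λ x → [] ⊢ :- κ 1 :≤ κ 1) (λ _ → lit 2) 0 refl 0#)

  -1-node : - cubic (- - 1#) ≡ profile₂ (- 1#)
  -1-node = sym (trans (glue-≤ -1≤1)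
        (arith 1 (λ x → []
             ⊢ κ 1 :* (:- κ 1)
               :≡ :- ((κ 2 :- (:- (:- κ 1))) :* (κ 2 :- (:- (:- κ 1))) :* (κ 3 :* (:- (:- κ 1))
                 :- κ 2)))
          (λ _ → lit 0) 0 refl 0#))

  -1-node′ : cubic′ (- - 1#) ≡ profile₂′ (- 1#)
  -1-node′ = sym (trans (glue-≤ -1≤1)
        (arith 1 (λ x → [] ⊢ κ 1 :≡ (κ 2 :- (:- (:- κ 1))) :* (κ 10 :- κ 9 :* (:- (:- κ 1))))
          (λ _ → lit 0) 0 refl 0#))

  -2≤-1 : - num 2 ≤ - 1#
  -2≤-1 = (arith 1 (λ x → [] ⊢ :- κ 2 :≤ :- κ 1) (λ _ → lit 1) 0 refl 0#)

  -2-node : 0# * - num 2 ≡ profile₁ (- num 2)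
  -2-node = sym (trans (glue-≤ -2≤-1)
        (arith 1 (λ x → []
             ⊢ :- ((κ 2 :- (:- (:- κ 2))) :* (κ 2 :- (:- (:- κ 2))) :* (κ 3 :* (:- (:- κ 2))
                 :- κ 2))
               :≡ κ 0 :* (:- κ 2))
          (λ _ → lit 0) 0 refl 0#))

  -2-node′ : 0# ≡ profile₁′ (- num 2)
  -2-node′ = sym (trans (glue-≤ -2≤-1)
        (arith 1 (λ x → [] ⊢ (κ 2 :- (:- (:- κ 2))) :* (κ 10 :- κ 9 :* (:- (:- κ 2))) :≡ κ 0)
          (λ _ → lit 0) 0 refl 0#))

  profile-smooth : ∀ u v → u ≤ v → Taylor profile profile′ u v
  profile-smooth u v = glue-smooth {λ _ → ⊤} (- num 2) tt -2-node -2-node′ (linear-smooth 0#)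
    (glue-smooth (- 1#) -2≤-1 -1-node -1-node′
      (λ u v (-2≤u , u≤-1) (-2≤v , v≤-1) → odd-smooth cubic-smooth u v (neg u≤-1 -2≤u) (neg v≤-1 -2≤v))
      (glue-smooth 1# -1≤1 1-node 1-node′ (linear-smooth 1#)
        (glue-smooth (num 2) 1≤2 2-node 2-node′ cubic-smooth (linear-smooth 0#)))) u v tt tt
    where
    neg : ∀ {v} → v ≤ - 1# → - num 2 ≤ v → 1# ≤ - v × - v ≤ num 2
    neg {v} a b = (arith 1 (λ v → (v :≤ :- κ 1 ∷ []) ⊢ κ 1 :≤ :- v) (λ _ → hyp 0) 0 refl v a) ,
          (arith 1 (λ v → (:- κ 2 :≤ v ∷ []) ⊢ :- v :≤ κ 2)
            (λ _ → hyp 0) 0 refl v b)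

  profile-linear : ∀ {v} → - 1# ≤ v → v ≤ 1# → profile v ≡ v
  profile-linear {v} -1≤v v≤1 = trans (glue-≥ -2-node (≤-trans -2≤-1 -1≤v))
    (trans (glue-≥ -1-node -1≤v) (trans (glue-≤ v≤1)
          (arith 1 (λ v → [] ⊢ κ 1 :* v :≡ v)
            (λ _ → lit 0) 0 refl v)))

  profile-cubic : ∀ {v} → 1# ≤ v → v ≤ num 2 → profile v ≡ cubic v
  profile-cubic {v} 1≤v v≤2 = trans (glue-≥ -2-node (≤-trans -2≤-1 (≤-trans -1≤1 1≤v)))
    (trans (glue-≥ -1-node (≤-trans -1≤1 1≤v)) (trans (glue-≥ 1-node 1≤v) (glue-≤ v≤2)))

  profile-right : ∀ {v} → num 2 ≤ v → profile v ≡ 0#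
  profile-right {v} 2≤v = trans (glue-≥ -2-node (≤-trans -2≤-1 -1≤v)) (trans (glue-≥ -1-node -1≤v)
    (trans (glue-≥ 1-node (≤-trans 1≤2 2≤v)) (trans (glue-≥ 2-node 2≤v)
          (arith 1 (λ v → [] ⊢ κ 0 :* v :≡ κ 0)
            (λ _ → lit 0) 0 refl v))))
    where
    -1≤v : - 1# ≤ v
    -1≤v = ≤-trans -1≤1 (≤-trans 1≤2 2≤v)

  profile′-right : ∀ {v} → num 2 ≤ v → profile′ v ≡ 0#
  profile′-right {v} 2≤v = trans (glue-≥ -2-node′ (≤-trans -2≤-1 -1≤v)) (trans (glue-≥ -1-node′ -1≤v)
    (trans (glue-≥ 1-node′ (≤-trans 1≤2 2≤v)) (glue-≥ 2-node′ 2≤v)))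
    where
    -1≤v : - 1# ≤ v
    -1≤v = ≤-trans -1≤1 (≤-trans 1≤2 2≤v)

  profile-left : ∀ {v} → v ≤ - num 2 → profile v ≡ 0#
  profile-left {v} v≤-2 = trans (glue-≤ v≤-2)
        (arith 1 (λ v → [] ⊢ κ 0 :* v :≡ κ 0)
          (λ _ → lit 0) 0 refl v)

  profile′-left : ∀ {v} → v ≤ - num 2 → profile′ v ≡ 0#
  profile′-left {v} v≤-2 = glue-≤ v≤-2

  profile-positive : ∀ {v} → 0# < v → v < num 2 → 0# < profile v
  profile-positive {v} 0<v v<2 with ≤-total v 1#
  ... | inj₁ v≤1 = subst (0# <_) (sym (profile-linear
        (arith 1 (λ v → (κ 0 :< v ∷ []) ⊢ :- κ 1 :≤ v)
          (λ _ → lit 1 ⊕ hyp 0) 0 refl v 0<v) v≤1)) 0<v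
  ... | inj₂ 1≤v = subst (0# <_) (sym (profile-cubic 1≤v (<⇒≤ v<2)))
    (arith 1 (λ v → (κ 1 :≤ v ∷ v :< κ 2 ∷ κ 0 :< (κ 2 :- v) :* (κ 2 :- v) ∷ [])
         ⊢ κ 0 :< (κ 2 :- v) :* (κ 2 :- v) :* (κ 3 :* v :- κ 2))
      (λ _ → hyp 2 ⊕ lit 3 ⊗ hyp 0 ⊗ hyp 2) 0 refl v 1≤v v<2 (*-positive (<⇒0<- v<2) (<⇒0<- v<2)))

  profile-nonPositive : ∀ {v} → v ≤ 0# → profile v ≤ 0#
  profile-nonPositive {v} v≤0 with ≤-total (- 1#) v | ≤-total (- num 2) v
  ... | inj₁ -1≤v | _         = subst (_≤ 0#) (sym (profile-linear -1≤v (≤-trans v≤0 0≤1))) v≤0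
  ... | inj₂ v≤-1 | inj₂ v≤-2 = ≤-reflexive (profile-left v≤-2)
  ... | inj₂ v≤-1 | inj₁ -2≤v = subst (_≤ 0#) (sym (trans (glue-≥ -2-node -2≤v) (glue-≤ v≤-1)))
    (arith 1 (λ v → (v :≤ :- κ 1 ∷ κ 0 :≤ (κ 2 :- (:- v)) :* (κ 2 :- (:- v)) ∷ [])
         ⊢ :- ((κ 2 :- (:- v)) :* (κ 2 :- (:- v)) :* (κ 3 :* (:- v) :- κ 2)) :≤ κ 0)
      (λ _ → hyp 1 ⊕ lit 3 ⊗ hyp 0 ⊗ hyp 1) 0 refl v v≤-1 (sq-nonNegative (num 2 - - v)))

  -- The upper bound 1 is the essential one: it keeps `1 - α * profile′` positive for all amplitudes
  -- `α < 1`. The lower bound is generous, the true minimum being -16/9.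
  cubic′-bounds : ∀ {v} → 1# ≤ v → v ≤ num 2 → - num 8 ≤ cubic′ v × cubic′ v ≤ 1#
  cubic′-bounds {v} 1≤v v≤2 =
    (arith 1 (λ v → (κ 1 :≤ v ∷ v :≤ κ 2 ∷ []) ⊢ :- κ 8 :≤ (κ 2 :- v) :* (κ 10 :- κ 9 :* v))
      (λ _ → lit 4 ⊕ lit 4 ⊗ hyp 0 ⊗ hyp 0 ⊕ lit 5 ⊗ hyp 1 ⊗ hyp 1) 0 refl v 1≤v v≤2) ,
            (arith 1 (λ v → (κ 1 :≤ v ∷ v :≤ κ 2 ∷ []) ⊢ (κ 2 :- v) :* (κ 10 :- κ 9 :* v) :≤ κ 1)
              (λ _ → hyp 0 ⊕ lit 9 ⊗ hyp 0 ⊗ hyp 1) 0 refl v 1≤v v≤2)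

  profile′-bounds : ∀ v → - num 8 ≤ profile′ v × profile′ v ≤ 1#
  profile′-bounds v = glue-elim Bounded v (λ _ → zero-bounds) λ -2<v →
    glue-elim Bounded v
      (λ v≤-1 → cubic′-bounds
            (arith 1 (λ v → (v :≤ :- κ 1 ∷ []) ⊢ κ 1 :≤ :- v)
              (λ _ → hyp 0) 0 refl v v≤-1)
                    (arith 1 (λ v → (:- κ 2 :< v ∷ []) ⊢ :- v :≤ κ 2)
                      (λ _ → hyp 0) 0 refl v -2<v)) λ _ →
    glue-elim Bounded v (λ _ → (arith 1 (λ x → [] ⊢ :- κ 8 :≤ κ 1) (λ _ → lit 9) 0 refl 0#) , ≤-refl) λ 1<v →
    glue-elim Bounded v (λ v≤2 → cubic′-bounds (<⇒≤ 1<v) v≤2) λ _ → zero-bounds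
    where
    Bounded : ℝ → ℝ → Set
    Bounded _ y = - num 8 ≤ y × y ≤ 1#
    zero-bounds : Bounded v 0#
    zero-bounds = (arith 1 (λ x → [] ⊢ :- κ 8 :≤ κ 0) (λ _ → lit 8) 0 refl 0#) , 0≤1

  profile′-within : ∀ v → Within (num 8) (profile′ v)
  profile′-within v = let l , u = profile′-bounds v in l , ≤-trans u
        (arith 1 (λ x → [] ⊢ κ 1 :≤ κ 8)
          (λ _ → lit 7) 0 refl 0#)

  profile-quadratic : ∀ u v d → Within d (v - u) →
                      Within (num 8 * (d * d)) (profile v - profile u - profile′ u * (v - u))
  profile-quadratic u v d (l , r) with ≤-total u v
  ... | inj₁ u≤v = within-≤ (Taylor.forward (profile-smooth u v u≤v))
        (arith 3 (λ u v d → (u :≤ v ∷ v :- u :≤ d ∷ [])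
             ⊢ κ 8 :* ((v :- u) :* (v :- u)) :≤ κ 8 :* (d :* d))
          (λ _ _ _ → lit 16 ⊗ hyp 0 ⊗ hyp 1 ⊕ lit 8 ⊗ hyp 1 ⊗ hyp 1) 0 refl u v d u≤v r)
  ... | inj₂ v≤u = within-≤ (Taylor.backward (profile-smooth v u v≤u))
        (arith 3 (λ u v d → (v :≤ u ∷ :- d :≤ v :- u ∷ [])
             ⊢ κ 8 :* ((u :- v) :* (u :- v)) :≤ κ 8 :* (d :* d))
          (λ _ _ _ → lit 16 ⊗ hyp 0 ⊗ hyp 1 ⊕ lit 8 ⊗ hyp 1 ⊗ hyp 1) 0 refl u v d v≤u l)

  profile′-lipschitz : ∀ u v d → Within d (v - u) → Within (num 16 * d) (profile′ v - profile′ u)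
  profile′-lipschitz u v d (l , r) with ≤-total u v
  ... | inj₁ u≤v = within-≤ (Taylor.derivative (profile-smooth u v u≤v))
        (arith 3 (λ u v d → (v :- u :≤ d ∷ []) ⊢ κ 16 :* (v :- u) :≤ κ 16 :* d)
          (λ _ _ _ → lit 16 ⊗ hyp 0) 0 refl u v d r)
  ... | inj₂ v≤u = subst (Within _)
        (arith 2 (λ x y → [] ⊢ :- (x :- y) :≡ y :- x)
          (λ _ _ → lit 0) 0 refl (profile′ u) (profile′ v))
    (within-neg (within-≤ (Taylor.derivative (profile-smooth v u v≤u))
          (arith 3 (λ u v d → (:- d :≤ v :- u ∷ []) ⊢ κ 16 :* (u :- v) :≤ κ 16 :* d)
            (λ _ _ _ → lit 16 ⊗ hyp 0) 0 refl u v d l)))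

  ⅛ : ℝ
  ⅛ = ½ * (½ * ½)

  8*⅛ : num 8 * ⅛ ≡ 1#
  8*⅛ = (arith 1 (λ h → (κ 2 :* h :≡ κ 1 ∷ []) ⊢ κ 8 :* (h :* (h :* h)) :≡ κ 1)
          (λ h → multiple (κ 1 :+ κ 2 :* h :+ κ 4 :* h :* h) 0) 0 refl ½ 2*½)

  profile-uniform : UniformlyC¹ profile profile′
  profile-uniform .estimate ε 0<ε = ⅛ * ε , *-positive (halves-positive 0) 0<ε , λ s t d w d<δ →
    within-≤ (profile-quadratic s t d w)
      (arith 3 (λ h d ε → (κ 8 :* h :≡ κ 1 ∷ d :< h :* ε ∷ κ 0 :≤ d ∷ [])
           ⊢ κ 8 :* (d :* d) :≤ ε :* d)
        (λ _ d ε → lit 8 ⊗ hyp 1 ⊗ hyp 2 ⊕ multiple (d :* ε) 0)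
        0 refl ⅛ d ε 8*⅛ d<δ (within-nonNegative w))

  profile-lipschitz : ∀ u v d → Within d (v - u) → Within (num 8 * d) (profile v - profile u)
  profile-lipschitz = uniform-lipschitz profile-uniform (num-nonNegative 8) profile′-within

-- Diffeomorphisms of the line fixing 0 and 1, and their restrictions to [0,1].

module Diffeomorphisms (em : ExcludedMiddle 0ℓ) (R : RealNumbers) where

  open RealNumbers R
  open Spaces R
  open Arithmetic em R
  open RealBounds em R
  open UniformlyDifferentiable em R
  open Profile em R

  -- Maps of the whole line, so that no estimate has to treat endpoints. One bound `K` for both
  -- derivatives turns inversion into an exchange of fields. Strict monotonicity comes from
  -- bijectivity, so it is enough to record derivatives as nonnegative.
  record Diffeo : Set where
    field
      to to′ from from′ : ℝ → ℝ
      to-from    : ∀ y → to (from y) ≡ y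
      from-to    : ∀ x → from (to x) ≡ x
      to-C¹      : UniformlyC¹ to to′
      from-C¹    : UniformlyC¹ from from′
      K          : ℝ
      0<K        : 0# < K
      to′-bound   : ∀ u → 0# ≤ to′ u × to′ u ≤ K
      from′-bound : ∀ u → 0# ≤ from′ u × from′ u ≤ K
      to-0       : to 0# ≡ 0#
      to-1       : to 1# ≡ 1#

  inverse : Diffeo → Diffeo
  inverse f = record
    { to = from ; to′ = from′ ; from = to ; from′ = to′
    ; to-from = from-to ; from-to = to-from ; to-C¹ = from-C¹ ; from-C¹ = to-C¹
    ; K = K ; 0<K = 0<K ; to′-bound = from′-bound ; from′-bound = to′-bound
    ; to-0 = trans (cong from (sym to-0)) (from-to 0#)
    ; to-1 = trans (cong from (sym to-1)) (from-to 1#)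
    }
    where open Diffeo f

  within-bound : ∀ {K x} → 0# ≤ x × x ≤ K → Within K x
  within-bound {K} {x} (0≤x , x≤K) =
        (arith 2 (λ K x → (κ 0 :≤ x ∷ x :≤ K ∷ []) ⊢ :- K :≤ x)
          (λ _ _ → lit 2 ⊗ hyp 0 ⊕ hyp 1) 0 refl K x 0≤x x≤K) , x≤K

  product-bound : ∀ {K L x y} → 0# ≤ x × x ≤ K → 0# ≤ y × y ≤ L → 0# ≤ x * y × x * y ≤ K * L
  product-bound {K} {L} {x} {y} (0≤x , x≤K) (0≤y , y≤L) = *-nonNegative 0≤x 0≤y ,
    (arith 4 (λ K L x y → (κ 0 :≤ x ∷ x :≤ K ∷ κ 0 :≤ y ∷ y :≤ L ∷ []) ⊢ x :* y :≤ K :* L)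
      (λ _ _ _ _ → hyp 0 ⊗ hyp 3 ⊕ hyp 1 ⊗ hyp 2 ⊕ hyp 1 ⊗ hyp 3) 0 refl K L x y 0≤x x≤K 0≤y y≤L)

  compose : Diffeo → Diffeo → Diffeo
  compose g f = record
    { to = λ t → G.to (F.to t) ; to′ = λ t → G.to′ (F.to t) * F.to′ t
    ; from = λ t → F.from (G.from t) ; from′ = λ t → F.from′ (G.from t) * G.from′ t
    ; to-from = λ y → trans (cong G.to (F.to-from _)) (G.to-from y)
    ; from-to = λ x → trans (cong F.from (G.from-to _)) (F.from-to x)
    ; to-C¹ = uniform-compose F.to-C¹ G.to-C¹ F.0<K G.0<K
        (λ u → within-bound (F.to′-bound u)) (λ u → within-bound (G.to′-bound u))
    ; from-C¹ = uniform-compose G.from-C¹ F.from-C¹ G.0<K F.0<K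
        (λ u → within-bound (G.from′-bound u)) (λ u → within-bound (F.from′-bound u))
    ; K = G.K * F.K ; 0<K = *-positive G.0<K F.0<K
    ; to′-bound = λ u → product-bound (G.to′-bound _) (F.to′-bound u)
    ; from′-bound = λ u → swap (product-bound (F.from′-bound _) (G.from′-bound u))
    ; to-0 = trans (cong G.to F.to-0) G.to-0
    ; to-1 = trans (cong G.to F.to-1) G.to-1
    }
    where
    module F = Diffeo f
    module G = Diffeo g
    swap : ∀ {x} → 0# ≤ x × x ≤ F.K * G.K → 0# ≤ x × x ≤ G.K * F.K
    swap {x} (0≤x , x≤) = 0≤x ,
          (arith 3 (λ x K L → (x :≤ K :* L ∷ []) ⊢ x :≤ L :* K)
            (λ _ _ _ → hyp 0) 0 refl x F.K G.K x≤)

  -- A global inverse function theorem. The lower bound `ρ` is uniform in `u`, which makes the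
  -- inverse Lipschitz with constant `1 / ρ` and lets the uniform estimate pass to it.
  module Invert {F F′ : ℝ → ℝ} {ρ K : ℝ} (C¹ : UniformlyC¹ F F′)
    (0<ρ : 0# < ρ) (bounds : ∀ u → ρ ≤ F′ u × F′ u ≤ K) where

    0<K : 0# < K
    0<K = <-≤-trans 0<ρ (≤-trans (proj₁ (bounds 0#)) (proj₂ (bounds 0#)))

    slopes : ∀ {s t} → s ≤ t → Slopes F ρ K s t
    slopes = uniform-slopes C¹ bounds

    reflects-≤ : ∀ {s t} → F s ≤ F t → s ≤ t
    reflects-≤ {s} {t} Fs≤Ft = ≮⇒≥ λ t<s → <-irrefl (<-≤-trans
      (*-positive 0<ρ (<⇒0<- t<s))
      (arith 5 (λ ρ s t x y → (ρ :* (s :- t) :≤ x :- y ∷ x :≤ y ∷ []) ⊢ ρ :* (s :- t) :≤ κ 0)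
        (λ _ _ _ _ _ → hyp 0 ⊕ hyp 1)
        0 refl ρ s t (F s) (F t) (Slopes.lower (slopes (<⇒≤ t<s))) Fs≤Ft))

    injective : ∀ {s t} → F s ≡ F t → s ≡ t
    injective eq = ≤-antisym (reflects-≤ (≤-reflexive eq)) (reflects-≤ (≤-reflexive (sym eq)))

    expands : ∀ s t d → Within d (F t - F s) → Within (ρ ⁻¹ * d) (t - s)
    expands s t d (l , u) = within-cancel 0<ρ (subst (λ e → Within e (ρ * (t - s)))
      (arith 3 (λ ρ i d → (ρ :* i :≡ κ 1 ∷ []) ⊢ d :≡ ρ :* (i :* d))
        (λ _ _ d → multiple (:- d) 0) 0 refl ρ (ρ ⁻¹) d (*-inverse 0<ρ)) scaled)
      where
      scaled : Within d (ρ * (t - s))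
      scaled with ≤-total s t
      ... | inj₁ s≤t = let a = Slopes.lower (slopes s≤t) in
        (arith 6 (λ ρ s t d x y → (κ 0 :≤ ρ ∷ s :≤ t ∷ ρ :* (t :- s) :≤ y :- x ∷ y :- x :≤ d ∷ [])
             ⊢ :- d :≤ ρ :* (t :- s))
          (λ _ _ _ _ _ _ → hyp 2 ⊕ hyp 3 ⊕ lit 2 ⊗ hyp 0 ⊗ hyp 1)
          0 refl ρ s t d (F s) (F t) (<⇒≤ 0<ρ) s≤t a u) ,
        (arith 6 (λ ρ s t d x y → (ρ :* (t :- s) :≤ y :- x ∷ y :- x :≤ d ∷ []) ⊢ ρ :* (t :- s) :≤ d)
          (λ _ _ _ _ _ _ → hyp 0 ⊕ hyp 1) 0 refl ρ s t d (F s) (F t) a u)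
      ... | inj₂ t≤s = let a = Slopes.lower (slopes t≤s) in
        (arith 6 (λ ρ s t d x y → (ρ :* (s :- t) :≤ x :- y ∷ :- d :≤ y :- x ∷ [])
             ⊢ :- d :≤ ρ :* (t :- s))
          (λ _ _ _ _ _ _ → hyp 0 ⊕ hyp 1) 0 refl ρ s t d (F s) (F t) a l) ,
        (arith 6 (λ ρ s t d x y → (κ 0 :≤ ρ ∷ t :≤ s ∷ ρ :* (s :- t) :≤ x :- y ∷ :- d :≤ y :- x ∷
             [])
             ⊢ ρ :* (t :- s) :≤ d)
          (λ _ _ _ _ _ _ → hyp 2 ⊕ hyp 3 ⊕ lit 2 ⊗ hyp 0 ⊗ hyp 1)
          0 refl ρ s t d (F s) (F t) (<⇒≤ 0<ρ) t≤s a l)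

    -- Slopes of at least `ρ` force `F` past `y` within distance `∣ F 0 - y ∣ / ρ` of 0, so `Below`
    -- is inhabited and bounded. Slopes of at most `K` mean that a gap between `F c` and `y` at the
    -- supremum `c` cannot be closed before moving by the gap divided by `K`. A move to the right by
    -- that much would stay in `Below`, a move to the left would give a smaller upper bound.
    surjective : ∀ y → ∃[ x ] F x ≡ y
    surjective y = c , ≤-antisym Fc≤y y≤Fc
      where
      r : ℝ
      r = ∣ F 0# - y ∣ * ρ ⁻¹
      0≤r : 0# ≤ r
      0≤r = *-nonNegative (∣∣-nonNegative _) (<⇒≤ (⁻¹-positive 0<ρ))
      Below : Pred ℝ 0ℓ
      Below u = F u ≤ y
      -r-below : Below (- r)
      -r-below = (arith 6 (λ ρ i x a y z → (ρ :* i :≡ κ 1 ∷ x :- y :≤ a ∷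
                      ρ :* (κ 0 :- (:- (a :* i))) :≤ x :- z ∷ [])
                      ⊢ z :≤ y)
                   (λ _ _ _ a _ _ → hyp 1 ⊕ hyp 2 ⊕ multiple (:- a) 0)
                   0 refl ρ (ρ ⁻¹) (F 0#) (∣ F 0# - y ∣) y (F (- r)) (*-inverse 0<ρ) (x≤∣x∣ (F 0# -
                     y)) (Slopes.lower (slopes (0≤⇒-≤0))))
        where
        0≤⇒-≤0 : - r ≤ 0#
        0≤⇒-≤0 = (arith 1 (λ r → (κ 0 :≤ r ∷ []) ⊢ :- r :≤ κ 0) (λ _ → hyp 0) 0 refl r 0≤r)
      y≤Fr : y ≤ F r
      y≤Fr = (arith 6 (λ ρ i x a y z → (ρ :* i :≡ κ 1 ∷ :- (x :- y) :≤ a ∷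
                  ρ :* (a :* i :- κ 0) :≤ z :- x ∷ [])
                  ⊢ y :≤ z)
               (λ _ _ _ a _ _ → hyp 1 ⊕ hyp 2 ⊕ multiple (:- a) 0)
               0 refl ρ (ρ ⁻¹) (F 0#) (∣ F 0# - y ∣) y (F r) (*-inverse 0<ρ) (-x≤∣x∣ (F 0# - y))
                 (Slopes.lower (slopes 0≤r)))
      sup : ∃ (IsSup Below)
      sup = complete Below (- r , -r-below) (r , λ u Fu≤y → reflects-≤ (≤-trans Fu≤y y≤Fr))
      c : ℝ
      c = proj₁ sup
      y≤Fc : y ≤ F c
      y≤Fc = ≮⇒≥ λ Fc<y →
        let 0<δ : 0# < (y - F c) * K ⁻¹
            0<δ = *-positive (<⇒0<- Fc<y) (⁻¹-positive 0<K)
            c≤c+δ : c ≤ c + (y - F c) * K ⁻¹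
            c≤c+δ = (arith 2 (λ c δ → (κ 0 :< δ ∷ []) ⊢ c :≤ c :+ δ)
                      (λ _ _ → hyp 0) 0 refl c ((y - F c) * K ⁻¹) 0<δ)
        in <-irrefl (arith 4 (λ c y z i → (κ 0 :< (y :- z) :* i ∷ c :+ (y :- z) :* i :≤ c ∷ [])
                         ⊢ κ 0 :< κ 0)
                      (λ _ _ _ _ → hyp 0 ⊕ hyp 1)
                      0 refl c y (F c) (K ⁻¹) 0<δ (proj₁ (proj₂ sup) _ (below (Slopes.upper (slopes
                        c≤c+δ)))))
        where
        below : ∀ {w} → w - F c ≤ K * (c + (y - F c) * K ⁻¹ - c) → w ≤ y
        below {w} h = (arith 6 (λ K i c y z w → (K :* i :≡ κ 1 ∷
                           w :- z :≤ K :* (c :+ (y :- z) :* i :- c) ∷ [])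
                           ⊢ w :≤ y)
                        (λ _ _ _ y z _ → hyp 1 ⊕ multiple (y :- z) 0)
                        0 refl K (K ⁻¹) c y (F c) w (*-inverse 0<K) h)
      Fc≤y : F c ≤ y
      Fc≤y = ≮⇒≥ λ y<Fc →
        let 0<δ : 0# < (F c - y) * K ⁻¹
            0<δ = *-positive (<⇒0<- y<Fc) (⁻¹-positive 0<K)
            c-δ≤c : c - (F c - y) * K ⁻¹ ≤ c
            c-δ≤c = (arith 2 (λ c δ → (κ 0 :< δ ∷ []) ⊢ c :- δ :≤ c)
                      (λ _ _ → hyp 0) 0 refl c ((F c - y) * K ⁻¹) 0<δ)
        in <-irrefl (arith 4 (λ c y z i → (κ 0 :< (z :- y) :* i ∷ c :≤ c :- (z :- y) :* i ∷ [])
                         ⊢ κ 0 :< κ 0)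
                      (λ _ _ _ _ → hyp 0 ⊕ hyp 1)
                      0 refl c y (F c) (K ⁻¹) 0<δ (proj₂ (proj₂ sup) _ (λ u Fu≤y → reflects-≤
                        (≤-trans Fu≤y (above (Slopes.upper (slopes c-δ≤c)))))))
        where
        above : ∀ {w} → F c - w ≤ K * (c - (c - (F c - y) * K ⁻¹)) → y ≤ w
        above {w} h = (arith 6 (λ K i c y z w → (K :* i :≡ κ 1 ∷
                           z :- w :≤ K :* (c :- (c :- (z :- y) :* i)) ∷ [])
                           ⊢ y :≤ w)
                        (λ _ _ _ y z _ → hyp 1 ⊕ multiple (z :- y) 0)
                        0 refl K (K ⁻¹) c y (F c) w (*-inverse 0<K) h)

    G G′ : ℝ → ℝ
    G y = proj₁ (surjective y)
    G′ y = F′ (G y) ⁻¹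

    F-G : ∀ y → F (G y) ≡ y
    F-G y = proj₂ (surjective y)

    F′-positive : ∀ u → 0# < F′ u
    F′-positive u = <-≤-trans 0<ρ (proj₁ (bounds u))

    ρ*G′≤1 : ∀ y → ρ * G′ y ≤ 1#
    ρ*G′≤1 y = (arith 3 (λ ρ m j → (ρ :≤ m ∷ m :* j :≡ κ 1 ∷ κ 0 :< j ∷ []) ⊢ ρ :* j :≤ κ 1)
                 (λ _ _ _ → hyp 0 ⊗ hyp 2 ⊕ multiple (κ 1) 1)
                 0 refl ρ (F′ (G y)) (G′ y) (proj₁ (bounds (G y))) (*-inverse (F′-positive (G y)))
                   (⁻¹-positive (F′-positive (G y))))

    G′-bounds : ∀ y → 0# ≤ G′ y × G′ y ≤ ρ ⁻¹
    G′-bounds y = <⇒≤ (⁻¹-positive (F′-positive (G y))) ,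
      (arith 3 (λ ρ i j → (ρ :* i :≡ κ 1 ∷ κ 0 :≤ i ∷ ρ :* j :≤ κ 1 ∷ []) ⊢ j :≤ i)
        (λ _ _ j → hyp 1 ⊗ hyp 2 ⊕ multiple (:- j) 0)
        0 refl ρ (ρ ⁻¹) (G′ y) (*-inverse 0<ρ) (<⇒≤ (⁻¹-positive 0<ρ)) (ρ*G′≤1 y))

    G-C¹ : UniformlyC¹ G G′
    G-C¹ .estimate ε 0<ε =
      -- One factor `ρ` cancels the stretching of increments by `ρ ⁻¹`, the other absorbs the factor
      -- `G′ x`, which is at most `ρ ⁻¹`.
      let δ , 0<δ , est = C¹ .estimate (ρ * ρ * ε) (*-positive (*-positive 0<ρ 0<ρ) 0<ε)
      in ρ * δ , *-positive 0<ρ 0<δ , λ x y d w d<ρδ →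
        let j = G′ x
            m = F′ (G x)
            image : Within (ρ ⁻¹ * d) (G y - G x)
            image = expands (G x) (G y) d (subst₂ (λ a b → Within d (a - b)) (sym (F-G y)) (sym (F-G x)) w)
            small : ρ ⁻¹ * d < δ
            small = (arith 4 (λ ρ i d δ → (ρ :* i :≡ κ 1 ∷ κ 0 :< i ∷ d :< ρ :* δ ∷ [])
                         ⊢ i :* d :< δ)
                      (λ _ _ _ δ → hyp 1 ⊗ hyp 2 ⊕ multiple δ 0)
                      0 refl ρ (ρ ⁻¹) d δ (*-inverse 0<ρ) (⁻¹-positive 0<ρ) d<ρδ)
            near : Within (ρ * ρ * ε * (ρ ⁻¹ * d)) (y - x - m * (G y - G x))
            near = subst₂ (λ a b → Within (ρ * ρ * ε * (ρ ⁻¹ * d)) (a - b - m * (G y - G x))) (F-G y) (F-G x)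
                     (est (G x) (G y) (ρ ⁻¹ * d) image small)
        in within-≤
          (subst₂ Within
            (arith 5 (λ ρ i d ε j → (ρ :* i :≡ κ 1 ∷ [])
                 ⊢ j :* (ρ :* ρ :* ε :* (i :* d)) :≡ ρ :* j :* (ε :* d))
              (λ ρ _ d ε j → multiple (d :* j :* ε :* ρ) 0) 0 refl ρ (ρ ⁻¹) d ε j (*-inverse 0<ρ))
            (arith 6 (λ x y s t m j → (m :* j :≡ κ 1 ∷ [])
                 ⊢ j :* (:- (y :- x :- m :* (t :- s))) :≡ t :- s :- j :* (y :- x))
              (λ _ _ s t _ _ → multiple (t :- s) 0)
              0 refl x y (G x) (G y) m j (*-inverse (F′-positive (G x))))
            (within-scale (proj₁ (G′-bounds x)) (within-neg near)))
          (arith 3 (λ p ε d → (p :≤ κ 1 ∷ κ 0 :< ε ∷ κ 0 :≤ d ∷ []) ⊢ p :* (ε :* d) :≤ ε :* d)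
            (λ _ _ _ → hyp 0 ⊗ hyp 1 ⊗ hyp 2)
            0 refl (ρ * G′ x) ε d (ρ*G′≤1 x) 0<ε (within-nonNegative w))

    diffeo : F 0# ≡ 0# → F 1# ≡ 1# → Diffeo
    diffeo F-0 F-1 = record
      { to = F ; to′ = F′ ; from = G ; from′ = G′
      ; to-from = F-G ; from-to = λ x → injective (F-G (F x))
      ; to-C¹ = C¹ ; from-C¹ = G-C¹
      ; K = K + ρ ⁻¹ ; 0<K = +-positiveˡ 0<K (<⇒≤ (⁻¹-positive 0<ρ))
      ; to′-bound = λ u → <⇒≤ (F′-positive u) ,
          (arith 3 (λ m K i → (m :≤ K ∷ κ 0 :< i ∷ []) ⊢ m :≤ K :+ i)
            (λ _ _ _ → hyp 0 ⊕ hyp 1) 0 refl (F′ u) K (ρ ⁻¹) (proj₂ (bounds u)) (⁻¹-positive 0<ρ))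
      ; from′-bound = λ u → proj₁ (G′-bounds u) ,
          (arith 3 (λ m K i → (m :≤ i ∷ κ 0 :< K ∷ []) ⊢ m :≤ K :+ i)
            (λ _ _ _ → hyp 0 ⊕ hyp 1) 0 refl (G′ u) K (ρ ⁻¹) (proj₂ (G′-bounds u)) 0<K)
      ; to-0 = F-0 ; to-1 = F-1
      }

  unit : (t : [0,1]) → 0# ≤ value t × value t ≤ 1#
  unit t = irrelevant-proof (proof t)

  within-cancel-∣∣ : ∀ {x e z} → x ≢ 0# → Within (∣ x ∣ * e) (x * z) → Within e z
  within-cancel-∣∣ {x} {e} {z} x≢0 w with ∣∣-cases x
  ... | inj₁ eq = within-cancel 0<∣x∣ (subst (λ y → Within (∣ x ∣ * e) (y * z)) (sym eq) w)
    where
    0<∣x∣ : 0# < ∣ x ∣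
    0<∣x∣ = ∣∣-nonNegative x , λ 0≡a → x≢0 (trans (sym eq) (sym 0≡a))
  ... | inj₂ eq = subst (Within e) (arith 1 (λ z → [] ⊢ :- (:- z) :≡ z) (λ _ → lit 0) 0 refl z)
    (within-neg (within-cancel 0<∣x∣
      (subst (Within (∣ x ∣ * e))
            (arith 3 (λ x z a → (a :≡ :- x ∷ []) ⊢ x :* z :≡ a :* (:- z))
              (λ _ z _ → multiple z 0) 0 refl x z (∣ x ∣) eq) w)))
    where
    0<∣x∣ : 0# < ∣ x ∣
    0<∣x∣ = ∣∣-nonNegative x , λ 0≡a → x≢0
          (arith 2 (λ x a → (a :≡ :- x ∷ κ 0 :≡ a ∷ []) ⊢ x :≡ κ 0)
            (λ _ _ → multiple (κ 1) 0 ⊕ multiple (κ 1) 1) 0 refl x (∣ x ∣) eq 0≡a)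

  module Restrict (f : Diffeo) where
    open Diffeo f

    monotone : ∀ {s t} → s ≤ t → to s ≤ to t
    monotone {s} {t} s≤t =
      (arith 4 (λ s t x y → (κ 0 :* (t :- s) :≤ y :- x ∷ []) ⊢ x :≤ y)
        (λ _ _ _ _ → hyp 0)
        0 refl s t (to s) (to t) (Slopes.lower (uniform-slopes to-C¹ to′-bound s≤t)))

    strictlyMonotone : ∀ {s t} → s < t → to s < to t
    strictlyMonotone {s} {t} (s≤t , s≢t) = monotone s≤t ,
      λ eq → s≢t (trans (sym (from-to s)) (trans (cong from eq) (from-to t)))

    restricted : [0,1] → [0,1]
    restricted t = to (value t) , [ subst (_≤ to (value t)) to-0 (monotone (proj₁ (unit t))) ,
                                    subst (to (value t) ≤_) to-1 (monotone (proj₂ (unit t))) ]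

    continuous : IsContinuous (λ t → value (restricted t))
    continuous t ε 0<ε = ε * K ⁻¹ , *-positive 0<ε (⁻¹-positive 0<K) , λ s d<δ →
      ≤-<-trans
        (∣∣≤ (uniform-lipschitz to-C¹ (<⇒≤ 0<K) (λ u → within-bound (to′-bound u))
          (value t) (value s) _ (within-∣∣ _)))
        (arith 4 (λ K i ε d → (K :* i :≡ κ 1 ∷ κ 0 :< K ∷ d :< ε :* i ∷ []) ⊢ K :* d :< ε)
          (λ _ _ ε _ → hyp 1 ⊗ hyp 2 ⊕ multiple ε 0)
          0 refl K (K ⁻¹) ε (∣ value s - value t ∣) (*-inverse 0<K) 0<K d<δ)

    continuouslyDifferentiable : ContinuouslyDifferentiable (λ t → value (restricted t))
    continuouslyDifferentiable = record
      { derivative = λ t → to′ (value t)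
      ; hasDerivative = λ t ε 0<ε →
          let δ , 0<δ , est = estimate to-C¹ (½ * ε) (½*-positive 0<ε)
          in δ , 0<δ , λ s s≢t d<δ →
            let x = value s - value t
                y = to (value s) - to (value t)
                m = to′ (value t)
                x≢0 : x ≢ 0#
                x≢0 x≡0 = s≢t (arith 2 (λ s t → (s :- t :≡ κ 0 ∷ []) ⊢ s :≡ t)
                                (λ _ _ → multiple (κ 1) 0) 0 refl (value s) (value t) x≡0)
            in ≤-<-trans (∣∣≤ (within-cancel-∣∣ x≢0 (subst₂ Within
                 (arith 3 (λ h ε d → [] ⊢ h :* ε :* d :≡ d :* (h :* ε))
                   (λ _ _ _ → lit 0) 0 refl ½ ε (∣ x ∣))
                 (arith 4 (λ x y m j → (x :* j :≡ κ 1 ∷ []) ⊢ y :- m :* x :≡ x :* (y :* j :- m))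
                   (λ _ y _ _ → multiple (:- y) 0) 0 refl x y m (x ⁻¹) (*-inverseʳ x x≢0))
                 (est (value t) (value s) ∣ x ∣ (within-∣∣ x) d<δ))))
               (½*-< 0<ε)
      ; derivative-continuous = λ t ε 0<ε →
          let δ , 0<δ , near = derivative-uniformly-continuous to-C¹ (½ * ε) (½*-positive 0<ε)
          in δ , 0<δ , λ s d<δ → ≤-<-trans (∣∣≤ (near (value t) (value s) d<δ)) (½*-< 0<ε)
      }

  restrict : Diffeo → Diff
  restrict f = record
    { homeo = record
        { bijection = mk↔ₛ′ F.restricted F⁻¹.restricted
            (λ t → value-injective (Diffeo.to-from f (value t)))
            (λ t → value-injective (Diffeo.from-to f (value t)))
        ; increasing = λ s t → F.strictlyMonotone
        ; to-continuous = F.continuous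
        ; from-continuous = F⁻¹.continuous
        }
    ; to-C¹ = F.continuouslyDifferentiable
    ; from-C¹ = F⁻¹.continuouslyDifferentiable
    }
    where
    module F = Restrict f
    module F⁻¹ = Restrict (inverse f)

  conjugate-restrict : ∀ u f₁ f₂ → (∀ t → Diffeo.to u (Diffeo.to f₁ t) ≡ Diffeo.to f₂ (Diffeo.to u t)) →
                       ConjugateDiff (restrict f₁) (restrict f₂)
  conjugate-restrict u f₁ f₂ intertwines = restrict u , λ t → value-injective
    (trans (intertwines (Diffeo.from u (value t))) (cong (Diffeo.to f₂) (Diffeo.to-from u (value t))))

-- Diffeomorphisms built from one bump in each dyadic cell.

module BumpFamilies (em : ExcludedMiddle 0ℓ) (R : RealNumbers) where

  open RealNumbers R
  open Spaces R
  open Arithmetic em R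
  open RealBounds em R
  open UniformlyDifferentiable em R
  open Profile em R
  open Diffeomorphisms em R

  center : ℕ → ℝ
  center n = num 6 * halves n

  -- Consecutive dyadic intervals, since 4 * halves n = 8 * halves (suc n).

  Cell : ℕ → Pred ℝ 0ℓ
  Cell n t = num 4 * halves n < t × t < num 8 * halves n

  cell-order : ∀ {m n t} → Cell m t → Cell n t → ¬ (m ℕ.< n)
  cell-order {m} {n} {t} (lower , _) (_ , upper) m<n = <-irrefl
    (arith 4 (λ t u v w → (κ 4 :* u :< t ∷ t :< κ 8 :* w ∷ κ 2 :* v :≡ u ∷ w :≤ v ∷ [])
         ⊢ κ 0 :< κ 0)
      (λ _ _ _ _ → hyp 0 ⊕ hyp 1 ⊕ lit 8 ⊗ hyp 3 ⊕ multiple (κ 4) 2)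
      0 refl t (halves m) (halves (suc m)) (halves n) lower upper (halves-suc m) (halves-antitone
        m<n))

  cell-unique : ∀ {m n t} → Cell m t → Cell n t → m ≡ n
  cell-unique {m} {n} in-m in-n with ℕ.<-cmp m n
  ... | tri< m<n _ _ = contradiction m<n (cell-order in-m in-n)
  ... | tri≈ _ eq _  = eq
  ... | tri> _ _ n<m = contradiction n<m (cell-order in-n in-m)

  -- Outside all cells the value 0 is harmless, because every bump vanishes there.

  cellIndex : ℝ → ℕ
  cellIndex t with em {∃[ n ] Cell n t}
  ... | yes (n , _) = n
  ... | no _        = 0

  cellIndex-unique : ∀ {n t} → Cell n t → cellIndex t ≡ n
  cellIndex-unique {n} {t} in-n with em {∃[ n ] Cell n t}
  ... | yes (m , in-m) = cell-unique in-m in-n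
  ... | no none        = contradiction (n , in-n) none

  outside : ∀ {n t} → ¬ Cell n t → t ≤ num 4 * halves n ⊎ num 8 * halves n ≤ t
  outside {n} {t} t∉ with ≤⊎> t (num 4 * halves n)
  ... | inj₁ below = inj₁ below
  ... | inj₂ lower = inj₂ (≮⇒≥ λ upper → t∉ (lower , upper))

  -- Since the profile vanishes outside [-2,2], a bump of width `σ n` reaches `2 * σ n` from the
  -- center, and `σ≤w` keeps it inside its cell. The common bound `β < 1` gives the map a derivative
  -- of at least `1 - β`, and `α→0` controls it at 0.
  record Family : Set where
    field
      α σ : ℕ → ℝ
      β   : ℝ
      β<1 : β < 1#
      0≤α : ∀ n → 0# ≤ α n
      α≤β : ∀ n → α n ≤ β
      α→0 : ∀ ε → 0# < ε → ∃[ N ] (∀ n → N ℕ.≤ n → α n ≤ ε)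
      0<σ : ∀ n → 0# < σ n
      σ≤w : ∀ n → σ n ≤ halves n

  module Bumps (family : Family) where
    open Family family

    argument bump bump′ : ℕ → ℝ → ℝ
    argument n t = (t - center n) * σ n ⁻¹
    bump  n t = α n * (σ n * profile (argument n t))
    bump′ n t = α n * profile′ (argument n t)

    α<1 : ∀ n → α n < 1#
    α<1 n = ≤-<-trans (α≤β n) β<1

    argument-≥2 : ∀ {n t} → num 2 * σ n ≤ t - center n → num 2 ≤ argument n t
    argument-≥2 {n} {t} far =
      (arith 3 (λ s i x → (s :* i :≡ κ 1 ∷ κ 0 :< i ∷ κ 2 :* s :≤ x ∷ []) ⊢ κ 2 :≤ x :* i)
        (λ _ _ _ → hyp 1 ⊗ hyp 2 ⊕ multiple (:- (κ 2)) 0)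
        0 refl (σ n) (σ n ⁻¹) (t - center n) (*-inverse (0<σ n)) (⁻¹-positive (0<σ n)) far)

    argument-≤-2 : ∀ {n t} → t - center n ≤ - (num 2 * σ n) → argument n t ≤ - num 2
    argument-≤-2 {n} {t} far =
      (arith 3 (λ s i x → (s :* i :≡ κ 1 ∷ κ 0 :< i ∷ x :≤ :- (κ 2 :* s) ∷ []) ⊢ x :* i :≤ :- κ 2)
        (λ _ _ _ → hyp 1 ⊗ hyp 2 ⊕ multiple (:- (κ 2)) 0)
        0 refl (σ n) (σ n ⁻¹) (t - center n) (*-inverse (0<σ n)) (⁻¹-positive (0<σ n)) far)

    times-0 : ∀ n {y} → y ≡ 0# → α n * (σ n * y) ≡ 0#
    times-0 n refl =
          (arith 2 (λ a s → [] ⊢ a :* (s :* κ 0) :≡ κ 0)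
            (λ _ _ → lit 0) 0 refl (α n) (σ n))

    times-0′ : ∀ n {y} → y ≡ 0# → α n * y ≡ 0#
    times-0′ n refl = (arith 1 (λ a → [] ⊢ a :* κ 0 :≡ κ 0) (λ _ → lit 0) 0 refl (α n))

    Far : ℕ → ℝ → Set
    Far n t = num 2 * σ n ≤ t - center n ⊎ t - center n ≤ - (num 2 * σ n)

    bump-far : ∀ {n t} → Far n t → bump n t ≡ 0#
    bump-far {n} {t} (inj₁ right) = times-0 n (profile-right (argument-≥2 {n} {t} right))
    bump-far {n} {t} (inj₂ left)  = times-0 n (profile-left (argument-≤-2 {n} {t} left))

    bump′-far : ∀ {n t} → Far n t → bump′ n t ≡ 0#
    bump′-far {n} {t} (inj₁ right) = times-0′ n (profile′-right (argument-≥2 {n} {t} right))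
    bump′-far {n} {t} (inj₂ left)  = times-0′ n (profile′-left (argument-≤-2 {n} {t} left))

    outside-far : ∀ {n t} → ¬ Cell n t → Far n t
    outside-far {n} {t} t∉ with outside {n} {t} t∉
    ... | inj₁ below = inj₂
          (arith 3 (λ t w s → (t :≤ κ 4 :* w ∷ s :≤ w ∷ []) ⊢ t :- κ 6 :* w :≤ :- (κ 2 :* s))
            (λ _ _ _ → hyp 0 ⊕ lit 2 ⊗ hyp 1) 0 refl t (halves n) (σ n) below (σ≤w n))
    ... | inj₂ above = inj₁
          (arith 3 (λ t w s → (κ 8 :* w :≤ t ∷ s :≤ w ∷ []) ⊢ κ 2 :* s :≤ t :- κ 6 :* w)
            (λ _ _ _ → hyp 0 ⊕ lit 2 ⊗ hyp 1) 0 refl t (halves n) (σ n) above (σ≤w n))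

    far-other : ∀ {n} t → n ≢ cellIndex t → Far n t
    far-other {n} t n≢ = outside-far {n} {t} λ in-n → n≢ (sym (cellIndex-unique in-n))

    -- At most one bump is nonzero at any point, so selecting the bump of the current cell takes the
    -- place of an infinite sum.
    total total′ to to′ : ℝ → ℝ
    total  t = bump (cellIndex t) t
    total′ t = bump′ (cellIndex t) t
    to  t = t - total t
    to′ t = 1# - total′ t

    argument-within : ∀ n s t {d} → Within d (t - s) → Within (σ n ⁻¹ * d) (argument n t - argument n s)
    argument-within n s t {d} w = subst (Within _)
      (arith 4 (λ s t c i → [] ⊢ i :* (t :- s) :≡ (t :- c) :* i :- (s :- c) :* i)
        (λ _ _ _ _ → lit 0) 0 refl s t (center n) (σ n ⁻¹))
      (within-scale (<⇒≤ (⁻¹-positive (0<σ n))) w)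

    bump-lipschitz : ∀ n s t {d} → Within d (t - s) → Within (num 8 * α n * d) (bump n t - bump n s)
    bump-lipschitz n s t {d} w = subst₂ Within
      (arith 4 (λ a s i d → (s :* i :≡ κ 1 ∷ []) ⊢ a :* (s :* (κ 8 :* (i :* d))) :≡ κ 8 :* a :* d)
        (λ a _ _ d → multiple (κ 8 :* a :* d) 0) 0 refl (α n) (σ n) (σ n ⁻¹) d (*-inverse (0<σ n)))
      (arith 4 (λ a s x y → [] ⊢ a :* (s :* (y :- x)) :≡ a :* (s :* y) :- a :* (s :* x))
        (λ _ _ _ _ → lit 0) 0 refl (α n) (σ n) (profile (argument n s)) (profile (argument n t)))
      (within-scale (0≤α n) (within-scale (<⇒≤ (0<σ n))
        (profile-lipschitz (argument n s) (argument n t) (σ n ⁻¹ * d) (argument-within n s t w))))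

    bump′-within : ∀ n t → Within (num 8 * α n) (bump′ n t)
    bump′-within n t = subst (λ e → Within e (bump′ n t))
          (arith 1 (λ a → [] ⊢ a :* κ 8 :≡ κ 8 :* a)
            (λ _ → lit 0) 0 refl (α n))
      (within-scale (0≤α n) (profile′-within (argument n t)))

    bump-quadratic : ∀ n s t {d} → Within d (t - s) →
      Within (num 8 * α n * σ n ⁻¹ * d * d) (bump n t - bump n s - bump′ n s * (t - s))
    bump-quadratic n s t {d} w = subst₂ Within
      (arith 4 (λ a s i d → (s :* i :≡ κ 1 ∷ [])
           ⊢ a :* (s :* (κ 8 :* (i :* d :* (i :* d)))) :≡ κ 8 :* a :* i :* d :* d)
        (λ a _ i d → multiple (κ 8 :* a :* d :* d :* i) 0)
        0 refl (α n) (σ n) (σ n ⁻¹) d (*-inverse (0<σ n)))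
      (arith 9 (λ a σₙ i s t c x y m → (σₙ :* i :≡ κ 1 ∷ [])
           ⊢ a :* (σₙ :* (y :- x :- m :* ((t :- c) :* i :- (s :- c) :* i)))
             :≡ a :* (σₙ :* y) :- a :* (σₙ :* x) :- a :* m :* (t :- s))
        (λ a _ _ s t _ _ _ m → multiple (a :* m :* s :- a :* m :* t) 0)
        0 refl (α n) (σ n) (σ n ⁻¹) s t (center n) (profile (argument n s)) (profile (argument n t))
          (profile′ (argument n s)) (*-inverse (0<σ n)))
      (within-scale (0≤α n) (within-scale (<⇒≤ (0<σ n))
        (profile-quadratic (argument n s) (argument n t) (σ n ⁻¹ * d) (argument-within n s t w))))

    Estimate : ℝ → ℕ → ℝ → Set
    Estimate ε n δ = ∀ s t d → Within d (t - s) → d < δ → Within (ε * d) (bump n t - bump n s - bump′ n s * (t - s))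

    -- A bump is Lipschitz with constant `8 * α n`, and its derivative is bounded by the same
    -- number. Once `α n ≤ ε / 16`, these two bounds alone give the estimate, whatever `δ` is. The
    -- finitely many other bumps have quadratic errors, with a constant that blows up as `σ n`
    -- decreases.
    bumps-equi-C¹ : ∀ ε → 0# < ε → ∃[ δ ] 0# < δ × (∀ n → Estimate ε n δ)
    bumps-equi-C¹ ε 0<ε = tail-uniform (Estimate ε)
      (λ n δ′≤δ est s t d w d<δ′ → est s t d w (<-≤-trans d<δ′ δ′≤δ))
      single (proj₁ small) (λ n N≤n δ → tail n (proj₂ small n N≤n))
      where
      small : ∃[ N ] (∀ n → N ℕ.≤ n → α n ≤ ½ * (⅛ * ε))
      small = α→0 _ (½*-positive (*-positive (halves-positive 0) 0<ε))
      tail : ∀ n {δ} → α n ≤ ½ * (⅛ * ε) → Estimate ε n δ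
      tail n α≤ s t d w _ = within-≤
        (within-+ (bump-lipschitz n s t w) (within-neg (within-* (bump′-within n s) w)))
        (arith 5 (λ a h e ε d → (κ 2 :* h :≡ κ 1 ∷ κ 16 :* a :≤ ε ∷ κ 0 :≤ d ∷ [])
             ⊢ κ 8 :* a :* d :+ κ 8 :* a :* d :≤ ε :* d)
          (λ _ _ _ _ _ → hyp 1 ⊗ hyp 2) 0 refl (α n) ½ ⅛ ε d 2*½ 16a≤ε (within-nonNegative w))
        where
        16a≤ε : num 16 * α n ≤ ε
        16a≤ε = (arith 4 (λ a h f ε → (κ 2 :* h :≡ κ 1 ∷ κ 8 :* f :≡ ε ∷ a :≤ h :* f ∷ [])
                     ⊢ κ 16 :* a :≤ ε)
                  (λ _ h _ ε → lit 16 ⊗ hyp 2 ⊕ multiple ε 0 ⊕ multiple (κ 2 :* h) 1)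
                  0 refl (α n) ½ (⅛ * ε) ε 2*½ 8f α≤)
          where
          8f : num 8 * (⅛ * ε) ≡ ε
          8f = (arith 2 (λ e ε → (κ 8 :* e :≡ κ 1 ∷ []) ⊢ κ 8 :* (e :* ε) :≡ ε)
                 (λ _ ε → multiple ε 0) 0 refl ⅛ ε 8*⅛)
      single : ∀ n → ∃[ δ ] 0# < δ × Estimate ε n δ
      single n = ⅛ * (ε * σ n) , *-positive (halves-positive 0) (*-positive 0<ε (0<σ n)) , λ s t d w d<δ →
        let 0≤d = within-nonNegative w
            8id≤ε : num 8 * σ n ⁻¹ * d ≤ ε
            8id≤ε = (arith 6 (λ i s e f ε d → (s :* i :≡ κ 1 ∷ κ 0 :< i ∷ κ 8 :* f :≡ ε :* s ∷
                         d :< f ∷ [])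
                         ⊢ κ 8 :* i :* d :≤ ε)
                      (λ i _ _ _ ε _ → lit 8 ⊗ hyp 1 ⊗ hyp 3 ⊕ multiple ε 0 ⊕ multiple i 2)
                      0 refl (σ n ⁻¹) (σ n) ⅛ (⅛ * (ε * σ n)) ε d (*-inverse (0<σ n)) (⁻¹-positive
                        (0<σ n)) (8f n) d<δ)
        in within-≤ (bump-quadratic n s t w)
          (≤-trans
            (arith 4 (λ a p i d → (a :≤ κ 1 ∷ κ 0 :≤ d ∷ κ 0 :≤ i :* d :* d ∷ [])
                 ⊢ κ 8 :* a :* i :* d :* d :≤ κ 8 :* i :* d :* d)
              (λ _ _ _ _ → lit 8 ⊗ hyp 0 ⊗ hyp 2)
              0 refl (α n) (num 8 * σ n ⁻¹ * d) (σ n ⁻¹) d (<⇒≤ (α<1 n)) 0≤d (*-nonNegative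
                (*-nonNegative (<⇒≤ (⁻¹-positive (0<σ n))) 0≤d) 0≤d))
            (arith 3 (λ p ε d → (p :≤ ε ∷ κ 0 :≤ d ∷ []) ⊢ p :* d :≤ ε :* d)
              (λ _ _ _ → hyp 0 ⊗ hyp 1) 0 refl (num 8 * σ n ⁻¹ * d) ε d 8id≤ε 0≤d))
        where
        8f : ∀ n → num 8 * (⅛ * (ε * σ n)) ≡ ε * σ n
        8f n = (arith 2 (λ e x → (κ 8 :* e :≡ κ 1 ∷ []) ⊢ κ 8 :* (e :* x) :≡ x)
                 (λ _ x → multiple x 0) 0 refl ⅛ (ε * σ n) 8*⅛)

    total-C¹ : UniformlyC¹ total total′
    total-C¹ .estimate ε 0<ε =
      let δ , 0<δ , est = bumps-equi-C¹ (½ * ε) (½*-positive 0<ε)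
      in δ , 0<δ , λ s t d w d<δ →
        combine (λ n → est n s t d w d<δ) (within-nonNegative w) (cellIndex s ℕ.≟ cellIndex t)
      where
      combine : ∀ {s t d} → (∀ n → Within (½ * ε * d) (bump n t - bump n s - bump′ n s * (t - s))) → 0# ≤ d →
                Dec (cellIndex s ≡ cellIndex t) → Within (ε * d) (total t - total s - total′ s * (t - s))
      combine {s} {t} {d} est 0≤d (yes eq) = within-≤
        (subst (λ m → Within (½ * ε * d) (bump m t - total s - total′ s * (t - s))) eq (est (cellIndex s)))
        (arith 3 (λ h ε d → (κ 2 :* h :≡ κ 1 ∷ κ 0 :< ε ∷ κ 0 :≤ ε :* d ∷ [])
             ⊢ h :* ε :* d :≤ ε :* d)
          (λ _ ε d → hyp 2 ⊕ multiple (d :* ε) 0) 1 refl ½ ε d 2*½ 0<ε (*-nonNegative (<⇒≤ 0<ε) 0≤d))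
      -- Bump `j` vanishes at `s` together with its derivative, and bump `i` vanishes at `t`. So the
      -- error of `total` is the sum of two errors of single bumps, each allowed half of `ε`.
      combine {s} {t} {d} est 0≤d (no i≢j) = subst₂ Within
        (arith 3 (λ h ε d → (κ 2 :* h :≡ κ 1 ∷ []) ⊢ h :* ε :* d :+ h :* ε :* d :≡ ε :* d)
          (λ _ ε d → multiple (d :* ε) 0) 0 refl ½ ε d 2*½)
        (arith 8 (λ x y y′ z u v s t → (y :≡ κ 0 ∷ y′ :≡ κ 0 ∷ z :≡ κ 0 ∷ [])
             ⊢ x :- y :- y′ :* (t :- s) :+ (z :- u :- v :* (t :- s)) :≡ x :- u :- v :* (t :- s))
          (λ _ _ _ _ _ _ s t → multiple (:- (κ 1)) 0 ⊕ multiple (s :- t) 1 ⊕ multiple (κ 1) 2)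
          0 refl (total t) (bump j s) (bump′ j s) (bump i t) (total s) (total′ s) s t (bump-far {j}
            {s} far-j) (bump′-far {j} {s} far-j) (bump-far {i} {t} (far-other t i≢j)))
        (within-+ (est j) (est i))
        where
        i j : ℕ
        i = cellIndex s
        j = cellIndex t
        far-j : Far j s
        far-j = far-other s λ j≡i → i≢j (sym j≡i)

    to-C¹ : UniformlyC¹ to to′
    to-C¹ = uniform-difference identity-uniform total-C¹

    to′-bounds : ∀ u → 1# - β ≤ to′ u × to′ u ≤ num 9
    to′-bounds u = let l , r = profile′-bounds (argument n u) in
      (arith 3 (λ a k m → (m :≤ κ 1 ∷ κ 0 :≤ a ∷ a :≤ k ∷ []) ⊢ κ 1 :- k :≤ κ 1 :- a :* m)
        (λ _ _ _ → hyp 2 ⊕ hyp 0 ⊗ hyp 1) 0 refl (α n) β (profile′ (argument n u)) r (0≤α n) (α≤β n)) ,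
      (arith 2 (λ a m → (:- κ 8 :≤ m ∷ κ 0 :≤ a ∷ a :≤ κ 1 ∷ []) ⊢ κ 1 :- a :* m :≤ κ 9)
        (λ _ _ → lit 8 ⊗ hyp 2 ⊕ hyp 0 ⊗ hyp 1)
        0 refl (α n) (profile′ (argument n u)) l (0≤α n) (<⇒≤ (α<1 n)))
      where
      n : ℕ
      n = cellIndex u

    to-fixed : ∀ {t} → (∀ n → bump n t ≡ 0#) → to t ≡ t
    to-fixed {t} vanish =
          (arith 2 (λ t b → (b :≡ κ 0 ∷ []) ⊢ t :- b :≡ t)
            (λ _ _ → multiple (:- (κ 1)) 0) 0 refl t (total t) (vanish (cellIndex t)))

    to-in : ∀ {n t} → Cell n t → to t ≡ t - bump n t
    to-in {n} {t} in-n = cong (λ m → t - bump m t) (cellIndex-unique in-n)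

    to-0 : to 0# ≡ 0#
    to-0 = to-fixed λ n → bump-far {n} (outside-far {n} λ (lower , _) →
      ≤⇒≯ (arith 1 (λ w → (κ 0 :≤ w ∷ []) ⊢ κ 0 :≤ κ 4 :* w)
            (λ _ → lit 4 ⊗ hyp 0) 0 refl (halves n) (<⇒≤ (halves-positive n))) lower)

    to-1 : to 1# ≡ 1#
    to-1 = to-fixed λ n → bump-far {n} (outside-far {n} λ (_ , upper) → ≤⇒≯ (8*halves≤1 n) upper)

    diffeo : Diffeo
    diffeo = Invert.diffeo to-C¹ (<⇒0<- β<1) to′-bounds to-0 to-1

-- The reduction, and the conjugation of maps with asymptotic sequences.

module Reduction (em : ExcludedMiddle 0ℓ) (R : RealNumbers) where

  open RealNumbers R
  open Spaces R
  open Arithmetic em R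
  open RealBounds em R
  open UniformlyDifferentiable em R
  open Profile em R
  open Diffeomorphisms em R
  open BumpFamilies em R

  0<seq : (x : Sequences) → ∀ n → 0# < value (x n)
  0<seq x n = proj₁ (irrelevant-proof (proof (x n)))

  seq<1 : (x : Sequences) → ∀ n → value (x n) < 1#
  seq<1 x n = proj₂ (irrelevant-proof (proof (x n)))

  -- Bump n has support [6w - wxₙ, 6w + wxₙ], where w = halves n.

  family : Sequences → Family
  family x = record
    { α = halves
    ; σ = λ n → ½ * (halves n * value (x n))
    ; β = ½
    ; β<1 = (arith 1 (λ h → (κ 2 :* h :≡ κ 1 ∷ κ 0 :< h ∷ []) ⊢ h :< κ 1)
              (λ _ → hyp 1 ⊕ multiple (κ 1) 0) 0 refl ½ 2*½ ½-positive)
    ; 0≤α = λ n → <⇒≤ (halves-positive n)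
    ; α≤β = λ n → (arith 2 (λ w h → (κ 2 :* h :≡ κ 1 ∷ κ 8 :* w :≤ κ 1 ∷ κ 0 :≤ w ∷ []) ⊢ w :≤ h)
                    (λ _ _ → lit 3 ⊕ hyp 1 ⊕ multiple (:- (κ 4)) 0)
                    7 refl (halves n) ½ 2*½ (8*halves≤1 n) (<⇒≤ (halves-positive n)))
    ; α→0 = λ ε 0<ε → let N , small = halves→0 ε 0<ε in N , λ n N≤n → <⇒≤ (small n N≤n)
    ; 0<σ = λ n → ½*-positive (*-positive (halves-positive n) (0<seq x n))
    ; σ≤w = λ n → (arith 3 (λ w h v → (κ 2 :* h :≡ κ 1 ∷ κ 0 :< h ∷ v :< κ 1 ∷ κ 0 :< w ∷
                       κ 0 :< h :* w ∷ [])
                       ⊢ h :* (w :* v) :≤ w)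
                    (λ w _ _ → hyp 3 ⊕ lit 2 ⊗ hyp 2 ⊗ hyp 4 ⊕ multiple w 0)
                    1 refl (halves n) ½ (value (x n)) 2*½ ½-positive (seq<1 x n) (halves-positive n)
                      (*-positive ½-positive (halves-positive n)))
    }

  module Model (x : Sequences) where
    open Bumps (family x) public
    open Family (family x) public
    open Restrict diffeo public using (monotone; strictlyMonotone)

  reduction : Sequences → Diff
  reduction x = restrict (Model.diffeo x)

  -- Contains the support of bump `n` whatever `x` is, as `value (x n) < 1#`, and is exactly where a
  -- bump of width `halves n` is still in the linear range of the profile.
  Near : ℕ → Pred ℝ 0ℓ
  Near n t = center n - halves n ≤ t × t ≤ center n + halves n

  near⇒cell : ∀ {n t} → Near n t → Cell n t
  near⇒cell {n} {t} (l , u) =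
    (arith 2 (λ w t → (κ 0 :< w ∷ κ 6 :* w :- w :≤ t ∷ []) ⊢ κ 4 :* w :< t)
      (λ _ _ → hyp 0 ⊕ hyp 1) 0 refl (halves n) t (halves-positive n) l) ,
    (arith 2 (λ w t → (κ 0 :< w ∷ t :≤ κ 6 :* w :+ w ∷ []) ⊢ t :< κ 8 :* w)
      (λ _ _ → hyp 0 ⊕ hyp 1) 0 refl (halves n) t (halves-positive n) u)

  module _ (x : Sequences) where
    open Model x

    2σ : ∀ n → num 2 * σ n ≡ halves n * value (x n)
    2σ n = (arith 2 (λ h p → (κ 2 :* h :≡ κ 1 ∷ []) ⊢ κ 2 :* (h :* p) :≡ p)
             (λ _ p → multiple p 0) 0 refl ½ (halves n * value (x n)) 2*½)

    2σ≤w : ∀ n → num 2 * σ n ≤ halves n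
    2σ≤w n = subst (_≤ halves n) (sym (2σ n))
          (arith 2 (λ w v → (κ 0 :< w ∷ v :< κ 1 ∷ []) ⊢ w :* v :≤ w)
            (λ _ _ → hyp 0 ⊗ hyp 1) 0 refl (halves n) (value (x n)) (halves-positive n) (seq<1 x n))

    near-edges : ∀ n → to (center n - halves n) ≡ center n - halves n ×
                       to (center n + halves n) ≡ center n + halves n
    near-edges n =
      edge near-left (inj₂
            (arith 3 (λ s c w → (κ 2 :* s :≤ w ∷ []) ⊢ c :- w :- c :≤ :- (κ 2 :* s))
              (λ _ _ _ → hyp 0) 0 refl (σ n) (center n) (halves n) (2σ≤w n))) ,
      edge near-right (inj₁
            (arith 3 (λ s c w → (κ 2 :* s :≤ w ∷ []) ⊢ κ 2 :* s :≤ c :+ w :- c)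
              (λ _ _ _ → hyp 0) 0 refl (σ n) (center n) (halves n) (2σ≤w n)))
      where
      edge : ∀ {t} → Near n t → Far n t → to t ≡ t
      edge {t} near far = trans (to-in (near⇒cell {n} near))
            (arith 2 (λ t b → (b :≡ κ 0 ∷ []) ⊢ t :- b :≡ t)
              (λ _ _ → multiple (:- (κ 1)) 0) 0 refl t (bump n t) (bump-far {n} far))
      near-left : Near n (center n - halves n)
      near-left = ≤-refl ,
            (arith 2 (λ c w → (κ 0 :< w ∷ []) ⊢ c :- w :≤ c :+ w)
              (λ _ _ → lit 2 ⊗ hyp 0) 0 refl (center n) (halves n) (halves-positive n))
      near-right : Near n (center n + halves n)
      near-right = (arith 2 (λ c w → (κ 0 :< w ∷ []) ⊢ c :- w :≤ c :+ w)
                     (λ _ _ → lit 2 ⊗ hyp 0) 0 refl (center n) (halves n) (halves-positive n)) , ≤-refl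

    near-invariant : ∀ {n t} → Near n t → Near n (to t)
    near-invariant {n} {t} (l , u) =
      subst (_≤ to t) (proj₁ (near-edges n)) (monotone l) , subst (to t ≤_) (proj₂ (near-edges n)) (monotone u)

  -- The conjugating diffeomorphism is, near center n, the homothety of ratio
  -- zₙ / xₙ.  The ratio must be at most 1, because profile′ is bounded by 1 from
  -- above but not by -1 from below.

  module Shrink (x z : Sequences) (z≤x : ∀ n → value (z n) ≤ value (x n))
    (close : ∀ ε → 0# < ε → ∃[ N ] (∀ n → N ℕ.≤ n → value (x n) - value (z n) ≤ ε * value (x n))) where

    module X = Model x
    module Z = Model z

    ratio : ℕ → ℝ
    ratio n = value (z n) * value (x n) ⁻¹

    x*x⁻¹ : ∀ n → value (x n) * value (x n) ⁻¹ ≡ 1#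
    x*x⁻¹ n = *-inverse (0<seq x n)

    0<x⁻¹ : ∀ n → 0# < value (x n) ⁻¹
    0<x⁻¹ n = ⁻¹-positive (0<seq x n)

    0<ratio : ∀ n → 0# < ratio n
    0<ratio n = *-positive (0<seq z n) (0<x⁻¹ n)

    ratio≤1 : ∀ n → ratio n ≤ 1#
    ratio≤1 n = (arith 3 (λ x′ i z′ → (x′ :* i :≡ κ 1 ∷ κ 0 :< i ∷ z′ :≤ x′ ∷ []) ⊢ z′ :* i :≤ κ 1)
                  (λ _ _ _ → hyp 1 ⊗ hyp 2 ⊕ multiple (κ 1) 0)
                  0 refl (value (x n)) (value (x n) ⁻¹) (value (z n)) (x*x⁻¹ n) (0<x⁻¹ n) (z≤x n))

    1-ratio→0 : ∀ ε → 0# < ε → ∃[ N ] (∀ n → N ℕ.≤ n → 1# - ratio n ≤ ε)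
    1-ratio→0 ε 0<ε = let N , small = close ε 0<ε in N , λ n N≤n →
      (arith 4 (λ x′ i z′ ε → (x′ :* i :≡ κ 1 ∷ κ 0 :< i ∷ x′ :- z′ :≤ ε :* x′ ∷ [])
           ⊢ κ 1 :- z′ :* i :≤ ε)
        (λ _ _ _ ε → hyp 1 ⊗ hyp 2 ⊕ multiple (ε :- κ 1) 0)
        0 refl (value (x n)) (value (x n) ⁻¹) (value (z n)) ε (x*x⁻¹ n) (0<x⁻¹ n) (small n N≤n))

    -- All but finitely many ratios are at least ½, and the others are positive. This provides the
    -- bound `β < 1` of the family `shrinking`.
    ratio-bounded : ∃[ ρ ] 0# < ρ × (∀ n → ρ ≤ ratio n)
    ratio-bounded =
      let N , small = 1-ratio→0 ½ ½-positive
          -- The cap at ½ makes the predicate true for every `δ` beyond `N`, as `tail-uniform`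
          -- demands.
          ρ , 0<ρ , bound = tail-uniform (λ n δ → δ ⊓ ½ ≤ ratio n)
            (λ n δ′≤δ h → ≤-trans (⊓-elim-pair δ′≤δ) h)
            (λ n → ratio n , 0<ratio n , x⊓y≤x (ratio n) ½)
            N (λ n N≤n δ → ≤-trans (x⊓y≤y δ ½)
                  (arith 2 (λ r h → (κ 2 :* h :≡ κ 1 ∷ κ 1 :- r :≤ h ∷ []) ⊢ h :≤ r)
                    (λ _ _ → hyp 1 ⊕ multiple (κ 1) 0) 0 refl (ratio n) ½ 2*½ (small n N≤n)))
      in ρ ⊓ ½ , ⊓-elim (0# <_) 0<ρ ½-positive , bound
      where
      ⊓-elim-pair : ∀ {δ δ′} → δ′ ≤ δ → δ′ ⊓ ½ ≤ δ ⊓ ½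
      ⊓-elim-pair {δ} {δ′} δ′≤δ = ⊓-elim (δ′ ⊓ ½ ≤_) (≤-trans (x⊓y≤x δ′ ½) δ′≤δ) (x⊓y≤y δ′ ½)

    shrinking : Family
    shrinking = record
      { α = λ n → 1# - ratio n
      ; σ = halves
      ; β = 1# - proj₁ ratio-bounded
      ; β<1 = (arith 1 (λ ρ → (κ 0 :< ρ ∷ []) ⊢ κ 1 :- ρ :< κ 1)
                (λ _ → hyp 0) 0 refl (proj₁ ratio-bounded) (proj₁ (proj₂ ratio-bounded)))
      ; 0≤α = λ n → ≤⇒0≤- (ratio≤1 n)
      ; α≤β = λ n → (arith 2 (λ ρ r → (ρ :≤ r ∷ []) ⊢ κ 1 :- r :≤ κ 1 :- ρ)
                      (λ _ _ → hyp 0)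
                      0 refl (proj₁ ratio-bounded) (ratio n) (proj₂ (proj₂ ratio-bounded) n))
      ; α→0 = 1-ratio→0
      ; 0<σ = halves-positive
      ; σ≤w = λ n → ≤-refl
      }

    module G = Bumps shrinking
    open Restrict G.diffeo using (monotone)

    homothety : ∀ {n t} → Near n t → G.to t ≡ center n + ratio n * (t - center n)
    homothety {n} {t} (l , u) = trans (G.to-in (near⇒cell {n} (l , u)))
      (arith 7 (λ t b r c w i p → (b :≡ (κ 1 :- r) :* (w :* p) ∷ p :≡ (t :- c) :* i ∷
           w :* i :≡ κ 1 ∷ [])
           ⊢ t :- b :≡ c :+ r :* (t :- c))
        (λ t _ r c w _ _ → multiple (:- (κ 1)) 0 ⊕ multiple (r :* w :- w) 1 ⊕ multiple (c :+ r :* t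
          :- t :- c :* r) 2)
        0 refl t (G.bump n t) (ratio n) (center n) (halves n) (halves n ⁻¹) (profile (G.argument n
          t)) refl linear w*i)
      where
      w*i : halves n * halves n ⁻¹ ≡ 1#
      w*i = *-inverse (halves-positive n)
      0<i : 0# < halves n ⁻¹
      0<i = ⁻¹-positive (halves-positive n)
      linear : profile (G.argument n t) ≡ (t - center n) * halves n ⁻¹
      linear = profile-linear
        (arith 4 (λ t c w i → (w :* i :≡ κ 1 ∷ κ 0 :< i ∷ c :- w :≤ t ∷ [])
             ⊢ :- κ 1 :≤ (t :- c) :* i)
          (λ _ _ _ _ → hyp 1 ⊗ hyp 2 ⊕ multiple (κ 1) 0)
          0 refl t (center n) (halves n) (halves n ⁻¹) w*i 0<i l)
        (arith 4 (λ t c w i → (w :* i :≡ κ 1 ∷ κ 0 :< i ∷ t :≤ c :+ w ∷ []) ⊢ (t :- c) :* i :≤ κ 1)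
          (λ _ _ _ _ → hyp 1 ⊗ hyp 2 ⊕ multiple (κ 1) 0)
          0 refl t (center n) (halves n) (halves n ⁻¹) w*i 0<i u)

    σ-ratio : ∀ n → Z.σ n ≡ ratio n * X.σ n
    σ-ratio n = (arith 5 (λ h w x′ i z′ → (x′ :* i :≡ κ 1 ∷ [])
                     ⊢ h :* (w :* z′) :≡ z′ :* i :* (h :* (w :* x′)))
                  (λ h w _ _ z′ → multiple (:- (h :* w :* z′)) 0)
                  0 refl ½ (halves n) (value (x n)) (value (x n) ⁻¹) (value (z n)) (x*x⁻¹ n))

    argument-ratio : ∀ n t → Z.argument n (center n + ratio n * (t - center n)) ≡ X.argument n t
    argument-ratio n t =
          (arith 7 (λ c r t s i s′ j → (i :≡ r :* j ∷ [])
               ⊢ (c :+ r :* (t :- c) :- c) :* j :≡ (t :- c) :* i)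
            (λ c _ t _ _ _ _ → multiple (c :- t) 0)
            0 refl (center n) (ratio n) t (X.σ n) (X.σ n ⁻¹) (Z.σ n) (Z.σ n ⁻¹) i≡rj)
      where
      i≡rj : X.σ n ⁻¹ ≡ ratio n * Z.σ n ⁻¹
      i≡rj = (arith 5 (λ r s i s′ j → (s :* i :≡ κ 1 ∷ s′ :* j :≡ κ 1 ∷ s′ :≡ r :* s ∷ [])
                  ⊢ i :≡ r :* j)
               (λ r _ i _ j → multiple (j :* r) 0 ⊕ multiple (:- i) 1 ⊕ multiple (i :* j) 2)
               0 refl (ratio n) (X.σ n) (X.σ n ⁻¹) (Z.σ n) (Z.σ n ⁻¹) (*-inverse (X.0<σ n))
                 (*-inverse (Z.0<σ n)) (σ-ratio n))

    -- The factor `halves n` is the amplitude for `x` and for `z` alike, so passing from width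
    -- `X.σ n` to `Z.σ n` merely scales the graph by the ratio.
    bump-ratio : ∀ n t → Z.bump n (center n + ratio n * (t - center n)) ≡ ratio n * X.bump n t
    bump-ratio n t = trans
      (cong₂ (λ s p → halves n * (s * p)) (σ-ratio n) (cong profile (argument-ratio n t)))
      (arith 4 (λ w r s p → [] ⊢ w :* (r :* s :* p) :≡ r :* (w :* (s :* p)))
        (λ _ _ _ _ → lit 0) 0 refl (halves n) (ratio n) (X.σ n) (profile (X.argument n t)))

    near-homothety : ∀ {n t} → Near n t → Near n (center n + ratio n * (t - center n))
    near-homothety {n} {t} (l , u) =
      (arith 4 (λ c w r t → (κ 0 :≤ r ∷ r :≤ κ 1 ∷ c :- w :≤ t ∷ κ 0 :≤ w ∷ [])
           ⊢ c :- w :≤ c :+ r :* (t :- c))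
        (λ _ _ _ _ → hyp 0 ⊗ hyp 2 ⊕ hyp 1 ⊗ hyp 3)
        0 refl (center n) (halves n) (ratio n) t (<⇒≤ (0<ratio n)) (ratio≤1 n) l (<⇒≤
          (halves-positive n))) ,
      (arith 4 (λ c w r t → (κ 0 :≤ r ∷ r :≤ κ 1 ∷ t :≤ c :+ w ∷ κ 0 :≤ w ∷ [])
           ⊢ c :+ r :* (t :- c) :≤ c :+ w)
        (λ _ _ _ _ → hyp 0 ⊗ hyp 2 ⊕ hyp 1 ⊗ hyp 3)
        0 refl (center n) (halves n) (ratio n) t (<⇒≤ (0<ratio n)) (ratio≤1 n) u (<⇒≤
          (halves-positive n)))

    intertwines-near : ∀ {n t} → Near n t → G.to (X.to t) ≡ Z.to (G.to t)
    intertwines-near {n} {t} near = begin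
      G.to (X.to t)
        ≡⟨ homothety (near-invariant x {n} near) ⟩
      center n + ratio n * (X.to t - center n)
        ≡⟨ cong (λ y → center n + ratio n * (y - center n)) (X.to-in (near⇒cell {n} near)) ⟩
      center n + ratio n * (t - X.bump n t - center n)
        ≡⟨ (arith 4 (λ c r t b → [] ⊢ c :+ r :* (t :- b :- c) :≡ c :+ r :* (t :- c) :- r :* b)
             (λ _ _ _ _ → lit 0) 0 refl (center n) (ratio n) t (X.bump n t)) ⟩
      center n + ratio n * (t - center n) - ratio n * X.bump n t
        ≡⟨ cong (λ y → center n + ratio n * (t - center n) - y) (sym (bump-ratio n t)) ⟩
      center n + ratio n * (t - center n) - Z.bump n (center n + ratio n * (t - center n))
        ≡⟨ sym (Z.to-in (near⇒cell {n} (near-homothety {n} near))) ⟩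
      Z.to (center n + ratio n * (t - center n))
        ≡⟨ cong Z.to (sym (homothety {n} near)) ⟩
      Z.to (G.to t)
        ∎
      where open ≡-Reasoning

    -- Both sides equal `G.to t`. By monotonicity `G.to t` stays beyond the image of an end of
    -- `Near n`, whose distance from the center is `ratio n * halves n`, at least `2 * Z.σ n`; so
    -- every bump for `z` vanishes there.
    intertwines-far : ∀ {t} → (∀ n → ¬ Near n t) → G.to (X.to t) ≡ Z.to (G.to t)
    intertwines-far {t} none = trans
      (cong G.to (X.to-fixed λ n → X.bump-far {n} (proj₁ (far n (≤⊎> _ t)))))
      (sym (Z.to-fixed λ n → Z.bump-far {n} (proj₂ (far n (≤⊎> _ t)))))
      where
      far : ∀ n → center n - halves n ≤ t ⊎ t < center n - halves n → X.Far n t × Z.Far n (G.to t)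
      far n (inj₁ l) = inj₁
            (arith 4 (λ c w t s → (c :+ w :≤ t ∷ κ 2 :* s :≤ w ∷ []) ⊢ κ 2 :* s :≤ t :- c)
              (λ _ _ _ _ → hyp 0 ⊕ hyp 1) 0 refl (center n) (halves n) t (X.σ n) (<⇒≤ u) (2σ≤w x n)) ,
                     inj₁ (arith 6 (λ c w y r s s′ → (c :+ r :* (c :+ w :- c) :≤ y ∷ κ 2 :* s :≤ w ∷
                               s′ :≡ r :* s ∷ κ 0 :< r ∷ [])
                               ⊢ κ 2 :* s′ :≤ y :- c)
                            (λ _ _ _ _ _ _ → hyp 0 ⊕ hyp 1 ⊗ hyp 3 ⊕ multiple (κ 2) 2)
                            0 refl (center n) (halves n) (G.to t) (ratio n) (X.σ n) (Z.σ n) image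
                              (2σ≤w x n) (σ-ratio n) (0<ratio n))
        where
        u : center n + halves n < t
        u = ≰⇒> λ t≤ → none n (l , t≤)
        image : center n + ratio n * (center n + halves n - center n) ≤ G.to t
        image = subst (_≤ G.to t) (homothety {n} (
              (arith 2 (λ c w → (κ 0 :< w ∷ []) ⊢ c :- w :≤ c :+ w)
                (λ _ _ → lit 2 ⊗ hyp 0) 0 refl (center n) (halves n) (halves-positive n)) , ≤-refl)) (monotone (<⇒≤ u))
      far n (inj₂ t<l) = inj₂
            (arith 4 (λ c w t s → (t :< c :- w ∷ κ 2 :* s :≤ w ∷ []) ⊢ t :- c :≤ :- (κ 2 :* s))
              (λ _ _ _ _ → hyp 0 ⊕ hyp 1) 0 refl (center n) (halves n) t (X.σ n) t<l (2σ≤w x n)) ,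
                       inj₂ (arith 6 (λ c w y r s s′ → (y :≤ c :+ r :* (c :- w :- c) ∷
                                 κ 2 :* s :≤ w ∷ s′ :≡ r :* s ∷ κ 0 :< r ∷ [])
                                 ⊢ y :- c :≤ :- (κ 2 :* s′))
                              (λ _ _ _ _ _ _ → hyp 0 ⊕ hyp 1 ⊗ hyp 3 ⊕ multiple (κ 2) 2)
                              0 refl (center n) (halves n) (G.to t) (ratio n) (X.σ n) (Z.σ n) image
                                (2σ≤w x n) (σ-ratio n) (0<ratio n))
        where
        image : G.to t ≤ center n + ratio n * (center n - halves n - center n)
        image = subst (G.to t ≤_) (homothety {n} (≤-refl ,
              (arith 2 (λ c w → (κ 0 :< w ∷ []) ⊢ c :- w :≤ c :+ w)
                (λ _ _ → lit 2 ⊗ hyp 0) 0 refl (center n) (halves n) (halves-positive n)))) (monotone (<⇒≤ t<l))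

    intertwines : ∀ t → G.to (X.to t) ≡ Z.to (G.to t)
    intertwines t = byCases em
      where
      byCases : Dec (∃[ n ] Near n t) → G.to (X.to t) ≡ Z.to (G.to t)
      byCases (yes (n , near)) = intertwines-near {n} near
      byCases (no none)        = intertwines-far λ n near → none (n , near)

  Intertwiner : Sequences → Sequences → Set
  Intertwiner x z = Σ[ g ∈ Diffeo ] (∀ t → Diffeo.to g (Model.to x t) ≡ Model.to z (Diffeo.to g t))

  shrink : ∀ x z → (∀ n → value (z n) ≤ value (x n)) →
           (∀ ε → 0# < ε → ∃[ N ] (∀ n → N ℕ.≤ n → value (x n) - value (z n) ≤ ε * value (x n))) →
           Intertwiner x z
  shrink x z z≤x close = Shrink.G.diffeo x z z≤x close , Shrink.intertwines x z z≤x close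

  intertwiners⇒conjugate : ∀ {x y z} → Intertwiner x z → Intertwiner y z → ConjugateDiff (reduction x) (reduction y)
  intertwiners⇒conjugate {x} {y} {z} (g , g-intertwines) (h , h-intertwines) =
    conjugate-restrict (compose (inverse h) g) (Model.diffeo x) (Model.diffeo y) intertwines
    where
    module G = Diffeo g
    module H = Diffeo h
    intertwines : ∀ t → H.from (G.to (Model.to x t)) ≡ Model.to y (H.from (G.to t))
    intertwines t = begin
      H.from (G.to (Model.to x t))               ≡⟨ cong H.from (g-intertwines t) ⟩
      H.from (Model.to z (G.to t))               ≡⟨ cong (λ s → H.from (Model.to z s)) (sym (H.to-from (G.to t))) ⟩
      H.from (Model.to z (H.to (H.from (G.to t)))) ≡⟨ cong H.from (sym (h-intertwines (H.from (G.to t)))) ⟩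
      H.from (H.to (Model.to y (H.from (G.to t)))) ≡⟨ H.from-to _ ⟩
      Model.to y (H.from (G.to t))               ∎
      where open ≡-Reasoning

  smaller : Sequences → Sequences → Sequences
  smaller x y n with ≤-total (value (x n)) (value (y n))
  ... | inj₁ _ = x n
  ... | inj₂ _ = y n

  smaller-elim : ∀ (P : ]0,1[ → Set) x y n → (value (x n) ≤ value (y n) → P (x n)) →
                 (value (y n) ≤ value (x n) → P (y n)) → P (smaller x y n)
  smaller-elim P x y n l r with ≤-total (value (x n)) (value (y n))
  ... | inj₁ x≤y = l x≤y
  ... | inj₂ y≤x = r y≤x

  c₀ˣ⇒conjugate : ∀ x y → c₀ˣ x y → ConjugateDiff (reduction x) (reduction y)
  c₀ˣ⇒conjugate x y x~y = intertwiners⇒conjugate {x} {y} {z}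
    (shrink x z
      (λ n → smaller-elim (λ t → value t ≤ value (x n)) x y n (λ _ → ≤-refl) (λ y≤x → y≤x))
      (λ ε 0<ε → let N , near = difference-small ε 0<ε in N , λ n N≤n →
        smaller-elim (λ t → value (x n) - value t ≤ ε * value (x n)) x y n (λ _ → self-close x n 0<ε)
          λ y≤x → (arith 3 (λ u v ε → (u :- v :≤ ε :* v ∷ v :≤ u ∷ κ 0 :< ε ∷ [])
                       ⊢ u :- v :≤ ε :* u)
                    (λ _ _ _ → hyp 0 ⊕ hyp 1 ⊗ hyp 2)
                    0 refl (value (x n)) (value (y n)) ε (upper (near n N≤n)) y≤x 0<ε)))
    (shrink y z
      (λ n → smaller-elim (λ t → value t ≤ value (y n)) x y n (λ x≤y → x≤y) (λ _ → ≤-refl))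
      (λ ε 0<ε → let N , near = difference-small ε 0<ε in N , λ n N≤n →
        smaller-elim (λ t → value (y n) - value t ≤ ε * value (y n)) x y n
          (λ _ → (arith 3 (λ u v ε → (:- (ε :* v) :≤ u :- v ∷ []) ⊢ v :- u :≤ ε :* v)
                   (λ _ _ _ → hyp 0) 0 refl (value (x n)) (value (y n)) ε (lower (near n N≤n))))
          λ _ → self-close y n 0<ε))
    where
    z : Sequences
    z = smaller x y
    difference-small : ∀ ε → 0# < ε → ∃[ N ] (∀ n → N ℕ.≤ n → Within (ε * value (y n)) (value (x n) - value (y n)))
    difference-small ε 0<ε = let N , near = x~y ε 0<ε in N , λ n N≤n →
      subst₂ Within
        (arith 2 (λ v ε → [] ⊢ v :* ε :≡ ε :* v) (λ _ _ → lit 0) 0 refl (value (y n)) ε)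
        (arith 3 (λ u v j → (v :* j :≡ κ 1 ∷ []) ⊢ v :* (u :* j :- κ 1) :≡ u :- v)
          (λ u _ _ → multiple u 0)
          0 refl (value (x n)) (value (y n)) (value (y n) ⁻¹) (*-inverse (0<seq y n)))
        (within-scale (<⇒≤ (0<seq y n)) (∣∣<⇒within (near n N≤n)))
    self-close : ∀ (x : Sequences) n {ε} → 0# < ε → value (x n) - value (x n) ≤ ε * value (x n)
    self-close x n {ε} 0<ε =
          (arith 2 (λ u ε → (κ 0 :< ε ∷ κ 0 :< u ∷ []) ⊢ u :- u :≤ ε :* u)
            (λ _ _ → hyp 0 ⊗ hyp 1) 0 refl (value (x n)) ε 0<ε (0<seq x n))

-- Continuity, hence Borel measurability, of the reduction.

module BorelMeasurability (em : ExcludedMiddle 0ℓ) (R : RealNumbers) where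

  open RealNumbers R
  open Spaces R
  open Arithmetic em R
  open RealBounds em R
  open UniformlyDifferentiable em R
  open Profile em R
  open Diffeomorphisms em R
  open BumpFamilies em R
  open Reduction em R

  module ArgumentEstimate (x y : Sequences) (n : ℕ) where

    private
      X Y p q w v i j : ℝ
      X = value (x n)
      Y = value (y n)
      p = X ⁻¹
      q = Y ⁻¹
      w = halves n
      v = w ⁻¹
      i = Model.σ x n ⁻¹
      j = Model.σ y n ⁻¹

    inverse-scale : ∀ (x : Sequences) → Model.σ x n ⁻¹ ≡ num 2 * value (x n) ⁻¹ * halves n ⁻¹
    inverse-scale x =
          (arith 6 (λ h w v X p i → (κ 2 :* h :≡ κ 1 ∷ h :* (w :* X) :* i :≡ κ 1 ∷ w :* v :≡ κ 1 ∷
               X :* p :≡ κ 1 ∷ i :* (w :* X) :≡ κ 2 ∷ [])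
               ⊢ i :≡ κ 2 :* p :* v)
            (λ _ _ v X p i → multiple (:- (X :* i :* p)) 2 ⊕ multiple (:- i) 3 ⊕ multiple (p :* v)
              4)
            0 refl ½ w v (value (x n)) (value (x n) ⁻¹) (Model.σ x n ⁻¹) 2*½ (*-inverse (Model.0<σ x
              n)) w*v X*p i*i)
      where
      w*v : w * v ≡ 1#
      w*v = *-inverse (halves-positive n)
      X*p : value (x n) * value (x n) ⁻¹ ≡ 1#
      X*p = *-inverse (0<seq x n)
      i*i : Model.σ x n ⁻¹ * (halves n * value (x n)) ≡ num 2
      i*i = (arith 3 (λ h z i → (κ 2 :* h :≡ κ 1 ∷ h :* z :* i :≡ κ 1 ∷ []) ⊢ i :* z :≡ κ 2)
              (λ _ z i → multiple (:- (i :* z)) 0 ⊕ multiple (κ 2) 1)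
              0 refl ½ (halves n * value (x n)) (Model.σ x n ⁻¹) 2*½ (*-inverse (Model.0<σ x n)))

    -- The inverse widths are `2 / (w X)` and `2 / (w Y)`, and a point of the cell is within `2 w`
    -- of the center. In the product `w` cancels and `4 ∣ Y - X ∣ / (X Y)` remains.
    argument-difference : ∀ {t d} → Cell n t → Within d (Y - X) →
      Within (num 4 * (p * q) * d) (Model.argument x n t - Model.argument y n t)
    argument-difference {t} {d} (l , u) near = subst₂ Within
      (arith 5 (λ w v p q d → (w :* v :≡ κ 1 ∷ [])
           ⊢ κ 2 :* w :* (κ 2 :* (p :* q) :* v :* d) :≡ κ 4 :* (p :* q) :* d)
        (λ _ _ p q d → multiple (κ 4 :* d :* p :* q) 0)
        0 refl w v p q d (*-inverse (halves-positive n)))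
      expanded
      (within-* offset (within-scale 0≤2pqv near))
      where
      offset : Within (num 2 * w) (t - center n)
      offset = (arith 2 (λ t w → (κ 4 :* w :< t ∷ []) ⊢ :- (κ 2 :* w) :≤ t :- κ 6 :* w)
                 (λ _ _ → hyp 0) 0 refl t w l) ,
                       (arith 2 (λ t w → (t :< κ 8 :* w ∷ []) ⊢ t :- κ 6 :* w :≤ κ 2 :* w)
                         (λ _ _ → hyp 0) 0 refl t w u)
      0≤2pqv : 0# ≤ num 2 * (p * q) * v
      0≤2pqv = *-nonNegative (*-nonNegative (num-nonNegative 2)
        (*-nonNegative (<⇒≤ (⁻¹-positive (0<seq x n))) (<⇒≤ (⁻¹-positive (0<seq y n)))))
        (<⇒≤ (⁻¹-positive (halves-positive n)))
      p-q : p * q * (Y - X) ≡ p - q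
      p-q = (arith 4 (λ X Y p q → (X :* p :≡ κ 1 ∷ Y :* q :≡ κ 1 ∷ [])
                 ⊢ p :* q :* (Y :- X) :≡ p :- q)
              (λ _ _ p q → multiple (:- q) 0 ⊕ multiple p 1)
              0 refl X Y p q (*-inverse (0<seq x n)) (*-inverse (0<seq y n)))
      expanded : (t - center n) * (num 2 * (p * q) * v * (Y - X)) ≡ Model.argument x n t - Model.argument y n t
      expanded = (arith 9 (λ τ v p q r X Y i j → (r :* (Y :- X) :≡ p :- q ∷ i :≡ κ 2 :* p :* v ∷
                      j :≡ κ 2 :* q :* v ∷ [])
                      ⊢ τ :* (κ 2 :* r :* v :* (Y :- X)) :≡ τ :* i :- τ :* j)
                   (λ τ v _ _ _ _ _ _ _ → multiple (κ 2 :* v :* τ) 0 ⊕ multiple (:- τ) 1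
                     ⊕ multiple τ 2)
                   0 refl (t - center n) v p q (p * q) X Y i j p-q (inverse-scale x) (inverse-scale
                     y))

    -- The first threshold gives `X ≤ 2 Y`, that is `q ≤ 2 p`. With the Lipschitz constant 16 of
    -- `profile′`, the arguments then contribute at most `16 * 4 p q d ≤ 128 p² d`, which is at most
    -- `ε` by the second threshold `ε X² / 128`.
    bump′-difference : ∀ {ε} → 0# < ε → ∣ Y - X ∣ < ½ * X → ∣ Y - X ∣ < ½ * (⅛ * (⅛ * (ε * (X * X)))) →
                       ∀ t → Within ε (Model.bump′ x n t - Model.bump′ y n t)
    bump′-difference {ε} 0<ε d<½X d<δ t = byCases em
      where
      d : ℝ
      d = ∣ Y - X ∣
      X*p : X * p ≡ 1#
      X*p = *-inverse (0<seq x n)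
      Y*q : Y * q ≡ 1#
      Y*q = *-inverse (0<seq y n)
      0<p : 0# < p
      0<p = ⁻¹-positive (0<seq x n)
      0<q : 0# < q
      0<q = ⁻¹-positive (0<seq y n)
      X≤2Y : X ≤ num 2 * Y
      X≤2Y = (arith 4 (λ h X Y d → (κ 2 :* h :≡ κ 1 ∷ :- (Y :- X) :≤ d ∷ d :< h :* X ∷ [])
                  ⊢ X :≤ κ 2 :* Y)
               (λ _ X _ _ → lit 2 ⊗ hyp 1 ⊕ lit 2 ⊗ hyp 2 ⊕ multiple X 0)
               0 refl ½ X Y d 2*½ (-x≤∣x∣ (Y - X)) d<½X)
      q≤2p : q ≤ num 2 * p
      q≤2p = (arith 4 (λ X Y p q → (X :* p :≡ κ 1 ∷ Y :* q :≡ κ 1 ∷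
                  κ 0 :≤ p :* q :* (κ 2 :* Y :- X) ∷ [])
                  ⊢ q :≤ κ 2 :* p)
               (λ _ _ p q → hyp 2 ⊕ multiple (:- q) 0 ⊕ multiple (κ 2 :* p) 1)
               0 refl X Y p q X*p Y*q (*-nonNegative (*-nonNegative (<⇒≤ 0<p) (<⇒≤ 0<q)) (≤⇒0≤-
                 X≤2Y)))
      128δ : num 128 * (½ * (⅛ * (⅛ * (ε * (X * X))))) ≡ ε * (X * X)
      128δ = chain (ε * (X * X))
        where
        chain : ∀ z → num 128 * (½ * (⅛ * (⅛ * z))) ≡ z
        chain z = trans
              (arith 3 (λ h e y → (κ 2 :* h :≡ κ 1 ∷ [])
                   ⊢ κ 128 :* (h :* (e :* y)) :≡ κ 64 :* (e :* y))
                (λ _ e y → multiple (κ 64 :* e :* y) 0) 0 refl ½ ⅛ (⅛ * z) 2*½)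
          (trans (arith 2 (λ e y → (κ 8 :* e :≡ κ 1 ∷ []) ⊢ κ 64 :* (e :* y) :≡ κ 8 :* y)
                   (λ _ y → multiple (κ 8 :* y) 0) 0 refl ⅛ (⅛ * z) 8*⅛)
                         (arith 2 (λ e z → (κ 8 :* e :≡ κ 1 ∷ []) ⊢ κ 8 :* (e :* z) :≡ z)
                           (λ _ z → multiple z 0) 0 refl ⅛ z 8*⅛))
      128d≤ : num 128 * d ≤ ε * (X * X)
      128d≤ = (arith 3 (λ d δ z → (κ 128 :* δ :≡ z ∷ d :< δ ∷ []) ⊢ κ 128 :* d :≤ z)
                (λ _ _ _ → lit 128 ⊗ hyp 1 ⊕ multiple (κ 1) 0)
                0 refl d (½ * (⅛ * (⅛ * (ε * (X * X))))) (ε * (X * X)) 128δ d<δ)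
      bound : num 16 * (num 4 * (p * q) * d) ≤ ε
      bound = ≤-trans
        (arith 3 (λ p q d → (q :≤ κ 2 :* p ∷ κ 0 :≤ p :* d ∷ [])
             ⊢ κ 16 :* (κ 4 :* (p :* q) :* d) :≤ p :* p :* (κ 128 :* d))
          (λ _ _ _ → lit 64 ⊗ hyp 0 ⊗ hyp 1)
          0 refl p q d q≤2p (*-nonNegative (<⇒≤ 0<p) (∣∣-nonNegative (Y - X))))
        (arith 4 (λ p X e ε → (e :≤ ε :* (X :* X) ∷ κ 0 :≤ p :* p ∷ p :* p :* (X :* X) :≡ κ 1 ∷ [])
             ⊢ p :* p :* e :≤ ε)
          (λ _ _ _ ε → hyp 0 ⊗ hyp 1 ⊕ multiple ε 2)
          0 refl p X (num 128 * d) ε 128d≤ (*-nonNegative (<⇒≤ 0<p) (<⇒≤ 0<p)) pX²)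
        where
        pX² : p * p * (X * X) ≡ 1#
        pX² = (arith 2 (λ p X → (X :* p :≡ κ 1 ∷ []) ⊢ p :* p :* (X :* X) :≡ κ 1)
                (λ p X → multiple (κ 1 :+ X :* p) 0) 0 refl p X X*p)
      byCases : Dec (Cell n t) → Within ε (Model.bump′ x n t - Model.bump′ y n t)
      byCases (yes in-n) = subst (Within ε)
        (arith 3 (λ w a b → [] ⊢ w :* (a :- b) :≡ w :* a :- w :* b)
          (λ _ _ _ → lit 0)
          0 refl w (profile′ (Model.argument x n t)) (profile′ (Model.argument y n t)))
        (within-≤ (within-scale (<⇒≤ (halves-positive n))
          (within-≤ (profile′-lipschitz (Model.argument y n t) (Model.argument x n t) _
            (argument-difference in-n (within-∣∣ (Y - X)))) bound))
          (arith 2 (λ w ε → (κ 0 :< ε ∷ κ 8 :* w :≤ κ 1 ∷ κ 0 :< w ∷ []) ⊢ w :* ε :≤ ε)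
            (λ _ _ → lit 7 ⊗ hyp 0 ⊕ hyp 0 ⊗ hyp 1)
            7 refl w ε 0<ε (8*halves≤1 n) (halves-positive n)))
      byCases (no t∉) = within-0 (<⇒≤ 0<ε)
        (arith 2 (λ a b → (a :≡ κ 0 ∷ b :≡ κ 0 ∷ []) ⊢ a :- b :≡ κ 0)
          (λ _ _ → multiple (κ 1) 0 ⊕ multiple (:- (κ 1)) 1)
          0 refl (Model.bump′ x n t) (Model.bump′ y n t) (Model.bump′-far x {n} (Model.outside-far x
            {n} t∉)) (Model.bump′-far y {n} (Model.outside-far y {n} t∉)))

  -- A basic neighbourhood restricts finitely many coordinates only. Beyond `N` both derivatives are
  -- at most `8 * halves n`, less than `ε / 2`, without any condition on `y`.
  bumps-continuous : ∀ (x : Sequences) ε → 0# < ε → ∃[ N ] ∃[ δ ] 0# < δ ×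
    (∀ y → (∀ n → n ℕ.< N → ∣ value (y n) - value (x n) ∣ < δ) →
      ∀ n t → Within ε (Model.bump′ x n t - Model.bump′ y n t))
  bumps-continuous x ε 0<ε = N , δ , proj₁ (proj₂ finite) , λ y close n t → byCases y close n t (n ℕ.<? N)
    where
    NearAt : ℕ → ℝ → Set
    NearAt n δ = ∀ y → ∣ value (y n) - value (x n) ∣ < δ → ∀ t → Within ε (Model.bump′ x n t - Model.bump′ y n t)
    single : ∀ n → ∃[ δ ] 0# < δ × NearAt n δ
    single n = δ₁ ⊓ δ₂ ,
      ⊓-elim (0# <_) (½*-positive (0<seq x n))
        (½*-positive (*-positive (halves-positive 0) (*-positive (halves-positive 0)
          (*-positive 0<ε (*-positive (0<seq x n) (0<seq x n)))))) ,
      λ y d<δ → ArgumentEstimate.bump′-difference x y n 0<ε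
        (<-≤-trans d<δ (x⊓y≤x δ₁ δ₂)) (<-≤-trans d<δ (x⊓y≤y δ₁ δ₂))
      where
      δ₁ δ₂ : ℝ
      δ₁ = ½ * value (x n)
      δ₂ = ½ * (⅛ * (⅛ * (ε * (value (x n) * value (x n)))))
    small : ∃[ N ] (∀ n → N ℕ.≤ n → halves n < ½ * (⅛ * ε))
    small = halves→0 _ (½*-positive (*-positive (halves-positive 0) 0<ε))
    N : ℕ
    N = proj₁ small
    finite : ∃[ δ ] 0# < δ × (∀ n → n ℕ.< N → NearAt n δ)
    finite = finite-uniform NearAt (λ n δ′≤δ near y d<δ′ → near y (<-≤-trans d<δ′ δ′≤δ)) single N
    δ : ℝ
    δ = proj₁ finite
    byCases : ∀ y → (∀ n → n ℕ.< N → ∣ value (y n) - value (x n) ∣ < δ) →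
              ∀ n t → Dec (n ℕ.< N) → Within ε (Model.bump′ x n t - Model.bump′ y n t)
    byCases y close n t (yes n<N) = proj₂ (proj₂ finite) n n<N y (close n n<N) t
    byCases y close n t (no n≮N)  = within-≤
      (within-+ (Model.bump′-within x n t) (within-neg (Model.bump′-within y n t)))
      (arith 4 (λ w h f ε → (κ 2 :* h :≡ κ 1 ∷ κ 8 :* f :≡ ε ∷ w :< h :* f ∷ [])
           ⊢ κ 8 :* w :+ κ 8 :* w :≤ ε)
        (λ _ h _ ε → lit 16 ⊗ hyp 2 ⊕ multiple ε 0 ⊕ multiple (κ 2 :* h) 1)
        0 refl (halves n) ½ (⅛ * ε) ε 2*½ 8f (proj₂ small n (ℕ.≮⇒≥ n≮N)))
      where
      8f : num 8 * (⅛ * ε) ≡ ε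
      8f = (arith 2 (λ e ε → (κ 8 :* e :≡ κ 1 ∷ []) ⊢ κ 8 :* (e :* ε) :≡ ε)
             (λ _ ε → multiple ε 0) 0 refl ⅛ ε 8*⅛)

  -- The metric is given by its graph, so a distance has to be produced by completeness before it
  -- can be estimated.
  supDistance : ∀ (h k : [0,1] → ℝ) {e} → (∀ t → Within e (h t - k t)) → ∃[ a ] IsSupDistance h k a × a ≤ e
  supDistance h k {e} near = let a , isSup = sup in a , isSup , proj₂ isSup e bounded
    where
    Distances : Pred ℝ 0ℓ
    Distances r = ∃[ t ] r ≡ ∣ h t - k t ∣
    bounded : IsUpperBound Distances e
    bounded r (t , refl) = ∣∣≤ (near t)
    zeroPoint : [0,1]
    zeroPoint = 0# , [ ≤-refl , 0≤1 ]
    sup : ∃ (IsSup Distances)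
    sup = complete Distances (_ , zeroPoint , refl) (e , bounded)

  -- Both maps fix 0 and [0,1] has length 1, so a bound on the difference of the derivatives bounds
  -- the difference of the values as well; this accounts for the two summands.
  reduction-distance : ∀ x y {ε} → (∀ n t → Within ε (Model.bump′ x n t - Model.bump′ y n t)) →
                       ∃[ d ] IsDistance (reduction x) (reduction y) d × d ≤ ε + ε
  reduction-distance x y {ε} near =
    let a , a-sup , a≤ε = supDistance (λ t → X.to (value t)) (λ t → Y.to (value t)) values
        b , b-sup , b≤ε = supDistance (λ t → X.to′ (value t)) (λ t → Y.to′ (value t)) (λ t → derivatives (value t))
    in a + b , (a , b , a-sup , b-sup , refl) ,
          (arith 3 (λ a b ε → (a :≤ ε ∷ b :≤ ε ∷ []) ⊢ a :+ b :≤ ε :+ ε)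
            (λ _ _ _ → hyp 0 ⊕ hyp 1) 0 refl a b ε a≤ε b≤ε)
    where
    module X = Model x
    module Y = Model y
    derivatives : ∀ t → Within ε (X.to′ t - Y.to′ t)
    derivatives t = subst (Within ε)
          (arith 2 (λ a b → [] ⊢ :- (a :- b) :≡ κ 1 :- a :- (κ 1 :- b))
            (λ _ _ → lit 0) 0 refl (X.total′ t) (Y.total′ t)) (within-neg (near (cellIndex t) t))
    0≤ε : 0# ≤ ε
    0≤ε = within-nonNegative (derivatives 0#)
    values : ∀ (t : [0,1]) → Within ε (X.to (value t) - Y.to (value t))
    values t = subst₂ Within
      (arith 1 (λ ε → [] ⊢ ε :* κ 1 :≡ ε) (λ _ → lit 0) 0 refl ε)
      (arith 4 (λ a b a₀ b₀ → (a₀ :≡ κ 0 ∷ b₀ :≡ κ 0 ∷ []) ⊢ a :- b :- (a₀ :- b₀) :≡ a :- b)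
        (λ _ _ _ _ → multiple (:- (κ 1)) 0 ⊕ multiple (κ 1) 1)
        0 refl (X.to (value t)) (Y.to (value t)) (X.to 0#) (Y.to 0#) X.to-0 Y.to-0)
      (uniform-lipschitz (uniform-difference X.to-C¹ Y.to-C¹) 0≤ε derivatives 0# (value t) 1# unit-distance)
      where
      unit-distance : Within 1# (value t - 0#)
      unit-distance =
            (arith 1 (λ t → (κ 0 :≤ t ∷ []) ⊢ :- κ 1 :≤ t :- κ 0)
              (λ _ → lit 1 ⊕ hyp 0) 0 refl (value t) (proj₁ (unit t))) ,
                    (arith 1 (λ t → (t :≤ κ 1 ∷ []) ⊢ t :- κ 0 :≤ κ 1)
                      (λ _ → hyp 0) 0 refl (value t) (proj₂ (unit t)))

  reduction-continuous : ∀ {U} → OpenDiff U → OpenSequences (λ x → U (reduction x))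
  reduction-continuous U-open x Ux =
    let ε , 0<ε , ball = U-open (reduction x) Ux
        -- Values and derivatives contribute `ε / 4` each; their sum `ε / 2` is strictly below `ε`.
        N , δ , 0<δ , near = bumps-continuous x (½ * (½ * ε)) (½*-positive (½*-positive 0<ε))
    in N , δ , 0<δ , λ y close →
      let d , isDistance , d≤ = reduction-distance x y (near y close)
      in ball (reduction y) d isDistance (≤-<-trans d≤
           (arith 3 (λ h e ε → (κ 2 :* h :≡ κ 1 ∷ e :< ε ∷ []) ⊢ h :* e :+ h :* e :< ε)
             (λ _ e _ → hyp 1 ⊕ multiple e 0) 0 refl ½ (½ * ε) ε 2*½ (½*-< 0<ε)))

  continuous⇒Borel : ∀ {X Y : Set} {OpenX : Pred (Pred X 0ℓ) 0ℓ} {OpenY : Pred (Pred Y 0ℓ) 0ℓ} (φ : X → Y) →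
                     (∀ {U} → OpenY U → OpenX (λ x → U (φ x))) → IsBorelMap OpenX OpenY φ
  continuous⇒Borel φ continuous B (open-set U-open)        = open-set (continuous U-open)
  continuous⇒Borel φ continuous B (complement borel)       = complement (continuous⇒Borel φ continuous _ borel)
  continuous⇒Borel φ continuous B (union borel)            = union λ n → continuous⇒Borel φ continuous _ (borel n)
  continuous⇒Borel φ continuous B (resp-≐ (⊆ , ⊇) borel) = resp-≐ (⊆ , ⊇) (continuous⇒Borel φ continuous _ borel)

-- Conjugate maps come from asymptotic sequences.

module Invariants (em : ExcludedMiddle 0ℓ) (R : RealNumbers) where

  open RealNumbers R
  open Spaces R
  open Arithmetic em R
  open RealBounds em R
  open UniformlyDifferentiable em R
  open Profile em R
  open Diffeomorphisms em R
  open BumpFamilies em R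
  open Reduction em R
  open BorelMeasurability em R

  strictlyIncreasing-≥ : ∀ {f : ℕ → ℕ} → (∀ {m n} → m ℕ.< n → f m ℕ.< f n) → ∀ n → n ℕ.≤ f n
  strictlyIncreasing-≥ mono zero    = ℕ.z≤n
  strictlyIncreasing-≥ mono (suc n) = ℕ.≤-<-trans (strictlyIncreasing-≥ mono n) (mono ℕ.≤-refl)

  invert : Diff → Diff
  invert g = record
    { homeo = record
        { bijection = mk↔ₛ′ from to from-to to-from
        ; increasing = λ s t s<t → ≰⇒> λ from-t≤from-s → ≤⇒≯ (to-monotone from-t≤from-s)
            (subst₂ _<_ (sym (cong value (to-from s))) (sym (cong value (to-from t))) s<t)
        ; to-continuous = from-continuous
        ; from-continuous = to-continuous
        }
    ; to-C¹ = from-C¹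
    ; from-C¹ = to-C¹
    }
    where
    open Diff g
    to-from : ∀ t → to (from t) ≡ t
    to-from = Inverse.strictlyInverseˡ bijection
    from-to : ∀ t → from (to t) ≡ t
    from-to = Inverse.strictlyInverseʳ bijection
    to-monotone : ∀ {s t} → value s ≤ value t → value (to s) ≤ value (to t)
    to-monotone {s} {t} s≤t with em {value s ≡ value t}
    ... | yes eq = ≤-reflexive (cong (λ r → value (to r)) (value-injective eq))
    ... | no neq = <⇒≤ (increasing s t (s≤t , neq))

  Conjugates : Diff → Sequences → Sequences → Set
  Conjugates g x y = ∀ t → Diff.to g (Diff.to (reduction x) t) ≡ Diff.to (reduction y) (Diff.to g t)

  conjugates : ∀ g x y →
               (∀ t → Diff.to g (Diff.to (reduction x) (Diff.from g t)) ≡ Diff.to (reduction y) t) →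
               Conjugates g x y
  conjugates g x y conj t = trans
    (cong (λ s → Diff.to g (Diff.to (reduction x) s)) (sym (Inverse.strictlyInverseʳ (Diff.bijection g) t)))
    (conj (Diff.to g t))

  conjugates-invert : ∀ g x y → Conjugates g x y → Conjugates (invert g) y x
  conjugates-invert g x y conj t = trans
    (cong (λ s → Diff.from g (Diff.to (reduction y) s)) (sym (Inverse.strictlyInverseˡ (Diff.bijection g) t)))
    (trans (cong (Diff.from g) (sym (conj (Diff.from g t)))) (Inverse.strictlyInverseʳ (Diff.bijection g) _))

  center-in-cell : ∀ n → Cell n (center n)
  center-in-cell n =
        (arith 1 (λ w → (κ 0 :< w ∷ []) ⊢ κ 4 :* w :< κ 6 :* w)
          (λ _ → lit 2 ⊗ hyp 0) 0 refl (halves n) (halves-positive n)) ,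
                (arith 1 (λ w → (κ 0 :< w ∷ []) ⊢ κ 6 :* w :< κ 8 :* w)
                  (λ _ → lit 2 ⊗ hyp 0) 0 refl (halves n) (halves-positive n))

  center-injective : ∀ {m n} → center m ≡ center n → m ≡ n
  center-injective {m} {n} eq = cell-unique {m} {n} (center-in-cell m) (subst (Cell n) (sym eq) (center-in-cell n))

  center-antitone : ∀ {m n} → m ℕ.≤ n → center n ≤ center m
  center-antitone {m} {n} m≤n =
        (arith 2 (λ v w → (w :≤ v ∷ []) ⊢ κ 6 :* w :≤ κ 6 :* v)
          (λ _ _ → lit 6 ⊗ hyp 0) 0 refl (halves m) (halves n) (halves-antitone m≤n))

  center-strictlyAntitone : ∀ {m n} → m ℕ.< n → center n < center m
  center-strictlyAntitone {m} {n} m<n = center-antitone {m} {n} (ℕ.<⇒≤ m<n) ,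
    λ eq → ℕ.<-irrefl (sym (center-injective {n} {m} eq)) m<n

  -- The components of { t ∣ f t < t } for f = reduction x are the intervals
  -- from center n to edge n.

  module Components (x : Sequences) where
    open Model x

    edge : ℕ → ℝ
    edge n = center n + num 2 * σ n

    Component : ℕ → Pred ℝ 0ℓ
    Component n t = center n < t × t < edge n

    edge-in-cell : ∀ n → Cell n (edge n)
    edge-in-cell n =
      (arith 2 (λ w s → (κ 0 :< w ∷ κ 0 :< s ∷ []) ⊢ κ 4 :* w :< κ 6 :* w :+ κ 2 :* s)
        (λ _ _ → lit 2 ⊗ hyp 0 ⊕ lit 2 ⊗ hyp 1) 0 refl (halves n) (σ n) (halves-positive n) (0<σ n)) ,
      (arith 2 (λ w s → (κ 0 :< w ∷ κ 2 :* s :≤ w ∷ []) ⊢ κ 6 :* w :+ κ 2 :* s :< κ 8 :* w)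
        (λ _ _ → hyp 0 ⊕ hyp 1) 0 refl (halves n) (σ n) (halves-positive n) (2σ≤w x n))

    component-in-cell : ∀ {n t} → Component n t → Cell n t
    component-in-cell {n} (l , u) = <-trans (proj₁ (center-in-cell n)) l , <-trans u (proj₂ (edge-in-cell n))

    center-not-in-component : ∀ {m n} → ¬ Component m (center n)
    center-not-in-component {m} {n} in-m with cell-unique {m} {n} (component-in-cell {m} in-m) (center-in-cell n)
    ... | refl = <-irrefl (proj₁ in-m)

    edge-not-in-component : ∀ {m n} → ¬ Component m (edge n)
    edge-not-in-component {m} {n} in-m with cell-unique {m} {n} (component-in-cell {m} in-m) (edge-in-cell n)
    ... | refl = <-irrefl (proj₂ in-m)

    component⇒decreasing : ∀ {n t} → Component n t → to t < t
    component⇒decreasing {n} {t} (l , u) = subst (_< t) (sym (to-in {n} (component-in-cell {n} (l , u))))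
      (arith 2 (λ t b → (κ 0 :< b ∷ []) ⊢ t :- b :< t) (λ _ _ → hyp 0) 0 refl t (bump n t) 0<bump)
      where
      0<bump : 0# < bump n t
      0<bump = *-positive (halves-positive n) (*-positive (0<σ n) (profile-positive
        (*-positive (<⇒0<- l) (⁻¹-positive (0<σ n)))
        (arith 4 (λ t c s i → (s :* i :≡ κ 1 ∷ κ 0 :< i ∷ t :< c :+ κ 2 :* s ∷ [])
             ⊢ (t :- c) :* i :< κ 2)
          (λ _ _ _ _ → hyp 1 ⊗ hyp 2 ⊕ multiple (κ 2) 0)
          0 refl t (center n) (σ n) (σ n ⁻¹) (*-inverse (0<σ n)) (⁻¹-positive (0<σ n)) u)))

    decreasing⇒component : ∀ {t} → to t < t → Component (cellIndex t) t
    decreasing⇒component {t} decreasing = ≰⇒> not-left , ≰⇒> not-right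
      where
      n : ℕ
      n = cellIndex t
      0<bump : 0# < bump n t
      0<bump = (arith 2 (λ t b → (t :- b :< t ∷ []) ⊢ κ 0 :< b)
                 (λ _ _ → hyp 0) 0 refl t (bump n t) decreasing)
      not-left : ¬ (t ≤ center n)
      not-left t≤c = ≤⇒≯
        (arith 3 (λ w s p → (p :≤ κ 0 ∷ κ 0 :≤ w :* s ∷ []) ⊢ w :* (s :* p) :≤ κ 0)
          (λ _ _ _ → hyp 0 ⊗ hyp 1)
          0 refl (halves n) (σ n) (profile (argument n t)) (profile-nonPositive argument≤0)
            (*-nonNegative (<⇒≤ (halves-positive n)) (<⇒≤ (0<σ n))))
        0<bump
        where
        argument≤0 : argument n t ≤ 0#
        argument≤0 = (arith 3 (λ t c i → (t :≤ c ∷ κ 0 :< i ∷ []) ⊢ (t :- c) :* i :≤ κ 0)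
                       (λ _ _ _ → hyp 0 ⊗ hyp 1)
                       0 refl t (center n) (σ n ⁻¹) t≤c (⁻¹-positive (0<σ n)))
      not-right : ¬ (edge n ≤ t)
      not-right e≤t = ≤⇒≯ (≤-reflexive (bump-far {n} {t} (inj₁
            (arith 3 (λ t c s → (c :+ κ 2 :* s :≤ t ∷ []) ⊢ κ 2 :* s :≤ t :- c)
              (λ _ _ _ → hyp 0) 0 refl t (center n) (σ n) e≤t)))) 0<bump

  cell-point : ∀ {n t} → Cell n t → [0,1]
  cell-point {n} {t} (l , u) = t , [
    (arith 2 (λ t w → (κ 0 :< w ∷ κ 4 :* w :< t ∷ []) ⊢ κ 0 :≤ t)
      (λ _ _ → lit 4 ⊗ hyp 0 ⊕ hyp 1) 0 refl t (halves n) (halves-positive n) l) , <⇒≤ (<-≤-trans u (8*halves≤1 n)) ]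

  center-point : ℕ → [0,1]
  center-point n = cell-point {n} (center-in-cell n)

  edge-point : Sequences → ℕ → [0,1]
  edge-point x n = cell-point {n} (Components.edge-in-cell x n)

  module Transport (x y : Sequences) (g : Diff) (conj : Conjugates g x y) where
    private
      module X = Components x
      module Y = Components y

    to-component : ∀ {n t} → X.Component n (value t) → ∃[ m ] Y.Component m (value (Diff.to g t))
    to-component {n} {t} in-n = _ , Y.decreasing⇒component
      (subst (λ s → value s < value (Diff.to g t)) (conj t)
        (Diff.increasing g _ _ (X.component⇒decreasing {n} in-n)))

  module Matching (x y : Sequences) (g : Diff) (conj : Conjugates g x y) where
    private
      module X = Components x
      module Y = Components y
    open Diff g using (to; from; increasing)

    from-increasing : ∀ s t → value s < value t → value (from s) < value (from t)
    from-increasing = Diff.increasing (invert g)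

    from-to : ∀ t → from (to t) ≡ t
    from-to = Inverse.strictlyInverseʳ (Diff.bijection g)

    from-component : ∀ {m} t → Y.Component m (value (to t)) → ∃[ n ] X.Component n (value t)
    from-component {m} t in-m =
      let n , in-n = Transport.to-component y x (invert g) (conjugates-invert g x y conj) {m} {to t} in-m
      in n , subst (λ s → X.Component n (value s)) (from-to t) in-n

    to-component : ∀ {n} t → X.Component n (value t) → ∃[ m ] Y.Component m (value (to t))
    to-component {n} t = Transport.to-component x y g conj {n} {t}

    -- An interval spanned by two points outside the components, and whose
    -- interior lies in one of them, is mapped onto a component.

    match : ∀ n → ∃[ m ] value (to (center-point n)) ≡ center m × value (to (edge-point x n)) ≡ Y.edge m
    match n = m , ≤-antisym c-upper c-lower , ≤-antisym e-upper e-lower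
      where
      c e : [0,1]
      c = center-point n
      e = edge-point x n
      0<σ : 0# < Model.σ x n
      0<σ = Model.0<σ x n
      midpoint-in : X.Component n (center n + Model.σ x n)
      midpoint-in = (arith 2 (λ c s → (κ 0 :< s ∷ []) ⊢ c :< c :+ s)
                      (λ _ _ → hyp 0) 0 refl (center n) (Model.σ x n) 0<σ) ,
                            (arith 2 (λ c s → (κ 0 :< s ∷ []) ⊢ c :+ s :< c :+ κ 2 :* s)
                              (λ _ _ → hyp 0) 0 refl (center n) (Model.σ x n) 0<σ)
      midpoint : [0,1]
      midpoint = cell-point {n} (X.component-in-cell {n} midpoint-in)
      image : ∃[ m ] Y.Component m (value (to midpoint))
      image = to-component {n} midpoint midpoint-in
      m : ℕ
      m = proj₁ image
      c<image : value (to c) < value (to midpoint)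
      c<image = increasing c midpoint (proj₁ midpoint-in)
      image<e : value (to midpoint) < value (to e)
      image<e = increasing midpoint e (proj₂ midpoint-in)
      c-outside : ∀ {m} → ¬ Y.Component m (value (to c))
      c-outside {m} in-m = let k , in-k = from-component {m} c in-m in X.center-not-in-component {k} {n} in-k
      e-outside : ∀ {m} → ¬ Y.Component m (value (to e))
      e-outside {m} in-m = let k , in-k = from-component {m} e in-m in X.edge-not-in-component {k} {n} in-k
      between : ∀ s → value (to c) < value s → value s < value (to e) → ∃[ k ] Y.Component k (value s)
      between s c<s s<e =
        let k , in-k = to-component {n} (from s)
              ( subst (λ r → value r < value (from s)) (from-to c) (from-increasing (to c) s c<s)
              , subst (λ r → value (from s) < value r) (from-to e) (from-increasing s (to e) s<e))
        in k , subst (λ r → Y.Component k (value r)) (Inverse.strictlyInverseˡ (Diff.bijection g) s) in-k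
      -- Every point strictly between `to c` and `to e` belongs to a component, so neither end of
      -- component `m` can lie there. Conversely, if `to c` or `to e` were inside component `m`,
      -- then pulling back would put `c` or `e` into a component.
      c-lower : center m ≤ value (to c)
      c-lower = ≮⇒≥ λ c<m →
        let k , in-k = between (center-point m) c<m (<-trans (proj₁ (proj₂ image)) image<e)
        in Y.center-not-in-component {k} {m} in-k
      c-upper : value (to c) ≤ center m
      c-upper = ≮⇒≥ λ m<c → c-outside {m} (m<c , <-trans c<image (proj₂ (proj₂ image)))
      e-upper : value (to e) ≤ Y.edge m
      e-upper = ≮⇒≥ λ m<e →
        let k , in-k = between (edge-point y m) (<-trans c<image (proj₂ (proj₂ image))) m<e
        in Y.edge-not-in-component {k} {m} in-k
      e-lower : Y.edge m ≤ value (to e)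
      e-lower = ≮⇒≥ λ e<m → e-outside {m} (<-trans (proj₁ (proj₂ image)) image<e , e<m)

    index : ℕ → ℕ
    index n = proj₁ (match n)

    index-center : ∀ n → to (center-point n) ≡ center-point (index n)
    index-center n = value-injective (proj₁ (proj₂ (match n)))

    index-mono : ∀ {m n} → m ℕ.< n → index m ℕ.< index n
    index-mono {m} {n} m<n = ℕ.≰⇒> λ n≤m → ≤⇒≯ (center-antitone {index n} {index m} n≤m)
      (subst₂ _<_ (proj₁ (proj₂ (match n))) (proj₁ (proj₂ (match m)))
        (increasing (center-point n) (center-point m) (center-strictlyAntitone {m} {n} m<n)))

  module FixedCenters (x y : Sequences) (g : Diff) (conj : Conjugates g x y) where
    private
      module M = Matching x y g conj
      module M⁻¹ = Matching y x (invert g) (conjugates-invert g x y conj)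

    index-inverse : ∀ n → M⁻¹.index (M.index n) ≡ n
    index-inverse n = center-injective {M⁻¹.index (M.index n)} {n} (cong value (trans
      (sym (M⁻¹.index-center (M.index n)))
      (trans (cong (Diff.from g) (sym (M.index-center n))) (M.from-to (center-point n)))))

    -- A strictly increasing map from `ℕ` to itself dominates the identity. This holds for `M.index`
    -- and for its inverse `M⁻¹.index`, which leaves only equality.
    index-identity : ∀ n → M.index n ≡ n
    index-identity n = ℕ.≤-antisym
      (subst (M.index n ℕ.≤_) (index-inverse n) (strictlyIncreasing-≥ M⁻¹.index-mono (M.index n)))
      (strictlyIncreasing-≥ M.index-mono n)

    center-fixed : ∀ n → value (Diff.to g (center-point n)) ≡ center n
    center-fixed n = trans (proj₁ (proj₂ (M.match n))) (cong center (index-identity n))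

    edge-matched : ∀ n → value (Diff.to g (edge-point x n)) ≡ Components.edge y n
    edge-matched n = trans (proj₂ (proj₂ (M.match n))) (cong (Components.edge y) (index-identity n))

  -- Extends functions on [0,1] to the line, where `mean-value` is stated. All points outside, even
  -- those beyond 1, go to 0: the choice is immaterial because only intervals inside [0,1] are
  -- considered.
  clamp : ℝ → [0,1]
  clamp t = choose em
    where
    choose : Dec (0# ≤ t × t ≤ 1#) → [0,1]
    choose (yes p) = t , [ p ]
    choose (no _)  = 0# , [ ≤-refl , 0≤1 ]

  clamp-value : ∀ {t} → 0# ≤ t → t ≤ 1# → value (clamp t) ≡ t
  clamp-value {t} 0≤t t≤1 with em {0# ≤ t × t ≤ 1#}
  ... | yes _  = refl
  ... | no out = contradiction (0≤t , t≤1) out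

  clamp-point : ∀ t → clamp (value t) ≡ t
  clamp-point t = value-injective (clamp-value (proj₁ (unit t)) (proj₂ (unit t)))

  -- Close to `u` a difference quotient is within `ε / 2` of `h′ u`, which is within `ε / 2` of 1.
  -- The mean value inequality carries these local slope bounds over to the whole interval.
  slopes-near-1 : ∀ (h h′ : [0,1] → ℝ) → (∀ t → HasDerivativeAt h t (h′ t)) → ∀ {p q ε} → 0# < ε →
    0# ≤ p → p ≤ q → q ≤ 1# → (∀ t → p ≤ value t → value t ≤ q → Within (½ * ε) (h′ t - 1#)) →
    Slopes (λ t → h (clamp t)) (1# - ε) (1# + ε) p q
  slopes-near-1 h h′ derivative {p} {q} {ε} 0<ε 0≤p p≤q q≤1 near =
    mean-value (λ t → h (clamp t)) (1# - ε) (1# + ε) p q p≤q local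
    where
    in-unit : ∀ {t} → p ≤ t → t ≤ q → value (clamp t) ≡ t
    in-unit p≤t t≤q = clamp-value (≤-trans 0≤p p≤t) (≤-trans t≤q q≤1)
    H : ℝ → ℝ
    H t = h (clamp t)
    quotient : ∀ u v {δ} → p ≤ u → u ≤ q → p ≤ v → v ≤ q → v ≢ u →
      (∀ s → value s ≢ value (clamp u) → ∣ value s - value (clamp u) ∣ < δ →
        ∣ (h s - h (clamp u)) / (value s - value (clamp u)) - h′ (clamp u) ∣ < ½ * ε) →
      ∣ v - u ∣ < δ → ∃[ k ] (1# - ε ≤ k × k ≤ 1# + ε) × H v - H u ≡ k * (v - u)
    quotient u v {δ} p≤u u≤q p≤v v≤q v≢u est close =
      k , bounds , (arith 3 (λ y d i → (d :* i :≡ κ 1 ∷ []) ⊢ y :≡ y :* i :* d)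
                     (λ y _ _ → multiple (:- y) 0)
                     0 refl (H v - H u) (v - u) ((v - u) ⁻¹) (*-inverseʳ (v - u) v-u≢0))
      where
      k : ℝ
      k = (H v - H u) * (v - u) ⁻¹
      v-u≢0 : v - u ≢ 0#
      v-u≢0 eq = v≢u
            (arith 2 (λ u v → (v :- u :≡ κ 0 ∷ []) ⊢ v :≡ u)
              (λ _ _ → multiple (κ 1) 0) 0 refl u v eq)
      cv = in-unit p≤v v≤q
      cu = in-unit p≤u u≤q
      k-near : Within (½ * ε) (k - h′ (clamp u))
      k-near = subst₂ (λ a b → Within (½ * ε) ((H v - H u) * (a - b) ⁻¹ - h′ (clamp u))) cv cu
        (∣∣<⇒within (est (clamp v) (λ eq → v≢u (trans (sym cv) (trans eq cu)))
          (subst₂ (λ a b → ∣ a - b ∣ < δ) (sym cv) (sym cu) close)))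
      derivative-near : Within (½ * ε) (h′ (clamp u) - 1#)
      derivative-near = near (clamp u) (subst (p ≤_) (sym cu) p≤u) (subst (_≤ q) (sym cu) u≤q)
      bounds : 1# - ε ≤ k × k ≤ 1# + ε
      bounds = (arith 4 (λ a k m ε → (κ 2 :* a :≡ κ 1 ∷ :- (a :* ε) :≤ k :- m ∷
                    :- (a :* ε) :≤ m :- κ 1 ∷ [])
                    ⊢ κ 1 :- ε :≤ k)
                 (λ _ _ _ ε → hyp 1 ⊕ hyp 2 ⊕ multiple ε 0)
                 0 refl ½ k (h′ (clamp u)) ε 2*½ (lower k-near) (lower derivative-near)) ,
               (arith 4 (λ a k m ε → (κ 2 :* a :≡ κ 1 ∷ k :- m :≤ a :* ε ∷ m :- κ 1 :≤ a :* ε ∷ [])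
                    ⊢ k :≤ κ 1 :+ ε)
                 (λ _ _ _ ε → hyp 1 ⊕ hyp 2 ⊕ multiple ε 0)
                 0 refl ½ k (h′ (clamp u)) ε 2*½ (upper k-near) (upper derivative-near))
    trivial : ∀ {u v} → v ≡ u → Slopes H (1# - ε) (1# + ε) u v
    trivial {u} refl =
          (arith 3 (λ u ε x → [] ⊢ (κ 1 :- ε) :* (u :- u) :≤ x :- x)
            (λ _ _ _ → lit 0) 0 refl u ε (H u)) ,
                  (arith 3 (λ u ε x → [] ⊢ x :- x :≤ (κ 1 :+ ε) :* (u :- u))
                    (λ _ _ _ → lit 0) 0 refl u ε (H u))
    local : ∀ u → p ≤ u → u ≤ q → ∃[ δ ] 0# < δ ×
      (∀ v → p ≤ v → v ≤ q → u ≤ v → v < u + δ → Slopes H (1# - ε) (1# + ε) u v) ×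
      (∀ v → p ≤ v → v ≤ q → v ≤ u → u - δ < v → Slopes H (1# - ε) (1# + ε) v u)
    local u p≤u u≤q =
      let δ , 0<δ , est = derivative (clamp u) (½ * ε) (½*-positive 0<ε)
      in δ , 0<δ ,
        (λ v p≤v v≤q u≤v v<u+δ → right v u≤v
          λ v≢u → quotient u v p≤u u≤q p≤v v≤q v≢u est (∣∣< (
                (arith 2 (λ u v → (u :≤ v ∷ []) ⊢ :- (v :- u) :≤ v :- u)
                  (λ _ _ → lit 2 ⊗ hyp 0) 0 refl u v u≤v) , ≤-refl)
                        (arith 3 (λ u v δ → (v :< u :+ δ ∷ []) ⊢ v :- u :< δ)
                          (λ _ _ _ → hyp 0) 0 refl u v δ v<u+δ))) ,
        (λ v p≤v v≤q v≤u u-δ<v → left v v≤u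
          λ v≢u → quotient u v p≤u u≤q p≤v v≤q v≢u est (∣∣< (
                (arith 2 (λ u v → [] ⊢ :- (u :- v) :≤ v :- u)
                  (λ _ _ → lit 0) 0 refl u v) ,
                        (arith 2 (λ u v → (v :≤ u ∷ []) ⊢ v :- u :≤ u :- v)
                          (λ _ _ → lit 2 ⊗ hyp 0) 0 refl u v v≤u))
                                (arith 3 (λ u v δ → (u :- δ :< v ∷ []) ⊢ u :- v :< δ)
                                  (λ _ _ _ → hyp 0) 0 refl u v δ u-δ<v)))
      where
      ∣∣< : ∀ {e x δ} → Within e x → e < δ → ∣ x ∣ < δ
      ∣∣< w e<δ = ≤-<-trans (∣∣≤ w) e<δ
      Quotient : ℝ → Set
      Quotient v = ∃[ k ] (1# - ε ≤ k × k ≤ 1# + ε) × H v - H u ≡ k * (v - u)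
      right : ∀ v → u ≤ v → (v ≢ u → Quotient v) → Slopes H (1# - ε) (1# + ε) u v
      right v u≤v quot = byCases em
        where
        byCases : Dec (v ≡ u) → Slopes H (1# - ε) (1# + ε) u v
        byCases (yes eq) = trivial eq
        byCases (no v≢u) = let k , (l , r) , eq = quot v≢u in
          (arith 6 (λ u v k ε x y → (u :≤ v ∷ κ 1 :- ε :≤ k ∷ y :- x :≡ k :* (v :- u) ∷ [])
               ⊢ (κ 1 :- ε) :* (v :- u) :≤ y :- x)
            (λ _ _ _ _ _ _ → hyp 0 ⊗ hyp 1 ⊕ multiple (:- (κ 1)) 2)
            0 refl u v k ε (H u) (H v) u≤v l eq) ,
          (arith 6 (λ u v k ε x y → (u :≤ v ∷ k :≤ κ 1 :+ ε ∷ y :- x :≡ k :* (v :- u) ∷ [])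
               ⊢ y :- x :≤ (κ 1 :+ ε) :* (v :- u))
            (λ _ _ _ _ _ _ → hyp 0 ⊗ hyp 1 ⊕ multiple (κ 1) 2) 0 refl u v k ε (H u) (H v) u≤v r eq)
      left : ∀ v → v ≤ u → (v ≢ u → Quotient v) → Slopes H (1# - ε) (1# + ε) v u
      left v v≤u quot = byCases em
        where
        byCases : Dec (v ≡ u) → Slopes H (1# - ε) (1# + ε) v u
        byCases (yes eq) = trivial (sym eq)
        byCases (no v≢u) = let k , (l , r) , eq = quot v≢u in
          (arith 6 (λ u v k ε x y → (v :≤ u ∷ κ 1 :- ε :≤ k ∷ y :- x :≡ k :* (v :- u) ∷ [])
               ⊢ (κ 1 :- ε) :* (u :- v) :≤ x :- y)
            (λ _ _ _ _ _ _ → hyp 0 ⊗ hyp 1 ⊕ multiple (κ 1) 2) 0 refl u v k ε (H u) (H v) v≤u l eq) ,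
          (arith 6 (λ u v k ε x y → (v :≤ u ∷ k :≤ κ 1 :+ ε ∷ y :- x :≡ k :* (v :- u) ∷ [])
               ⊢ x :- y :≤ (κ 1 :+ ε) :* (u :- v))
            (λ _ _ _ _ _ _ → hyp 0 ⊗ hyp 1 ⊕ multiple (:- (κ 1)) 2)
            0 refl u v k ε (H u) (H v) v≤u r eq)

  zero-point : [0,1]
  zero-point = 0# , [ ≤-refl , 0≤1 ]

  module Ratios (x y : Sequences) (g : Diff) (conj : Conjugates g x y) where
    private
      module C¹ = ContinuouslyDifferentiable (Diff.to-C¹ g)
      module C = FixedCenters x y g conj

    l : ℝ
    l = C¹.derivative zero-point

    to-0 : value (Diff.to g zero-point) ≡ 0#
    to-0 = ≤-antisym
      (≮⇒≥ λ 0<to0 → ≤⇒≯ (proj₁ (unit (Diff.from g zero-point)))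
        (subst (λ s → value (Diff.from g zero-point) < value s)
          (Inverse.strictlyInverseʳ (Diff.bijection g) zero-point)
          (Diff.increasing (invert g) zero-point (Diff.to g zero-point) 0<to0)))
      (proj₁ (unit (Diff.to g zero-point)))

    small-cells : ∀ δ → 0# < δ → ∃[ N ] (∀ n → N ℕ.≤ n → num 8 * halves n < δ)
    small-cells δ 0<δ = let N , small = halves→0 (⅛ * δ) (*-positive (halves-positive 0) 0<δ) in N , λ n N≤n →
      (arith 3 (λ w f δ → (w :< f ∷ κ 8 :* f :≡ δ ∷ []) ⊢ κ 8 :* w :< δ)
        (λ _ _ _ → lit 8 ⊗ hyp 0 ⊕ multiple (κ 1) 1) 0 refl (halves n) (⅛ * δ) δ (small n N≤n) 8f)
      where
      8f : num 8 * (⅛ * δ) ≡ δ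
      8f = (arith 2 (λ e δ → (κ 8 :* e :≡ κ 1 ∷ []) ⊢ κ 8 :* (e :* δ) :≡ δ)
             (λ _ δ → multiple δ 0) 0 refl ⅛ δ 8*⅛)

    0<center : ∀ n → 0# < center n
    0<center n = *-positive (num-positive 5) (halves-positive n)

    derivative-near-1 : ∀ ε → 0# < ε → Within ε (1# - l)
    derivative-near-1 ε 0<ε =
      let δ , 0<δ , est = C¹.hasDerivative zero-point ε 0<ε
          N , small = small-cells δ 0<δ
      in subst (λ q → Within ε (q - l)) (quotient N)
        (∣∣<⇒within (est (center-point N) (λ c≡0 → proj₂ (0<center N) (sym c≡0))
          (≤-<-trans (∣∣≤ (
                (arith 1 (λ w → (κ 0 :< w ∷ []) ⊢ :- (κ 8 :* w) :≤ κ 6 :* w :- κ 0)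
                  (λ _ → lit 14 ⊗ hyp 0) 0 refl (halves N) (halves-positive N)) ,
                        (arith 1 (λ w → (κ 0 :< w ∷ []) ⊢ κ 6 :* w :- κ 0 :≤ κ 8 :* w)
                          (λ _ → lit 2 ⊗ hyp 0) 0 refl (halves N) (halves-positive N)))) (small N ℕ.≤-refl))))
      where
      quotient : ∀ n → (value (Diff.to g (center-point n)) - value (Diff.to g zero-point)) / (center n - 0#) ≡ 1#
      quotient n = trans (cong₂ (λ a b → (a - b) / (center n - 0#)) (C.center-fixed n) to-0)
        (*-inverse (arith 1 (λ c → (κ 0 :< c ∷ []) ⊢ κ 0 :< c :- κ 0)
                     (λ _ → hyp 0) 0 refl (center n) (0<center n)))

    derivative-1 : l ≡ 1#
    derivative-1 = ≤-antisym
      (≤-from-slack l 1# 1# 0≤1 λ η 0<η →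
            (arith 2 (λ l η → (:- η :≤ κ 1 :- l ∷ []) ⊢ l :≤ κ 1 :+ η :* κ 1)
              (λ _ _ → hyp 0) 0 refl l η (lower (derivative-near-1 η 0<η))))
      (≤-from-slack 1# l 1# 0≤1 λ η 0<η →
            (arith 2 (λ l η → (κ 1 :- l :≤ η ∷ []) ⊢ κ 1 :≤ l :+ η :* κ 1)
              (λ _ _ → hyp 0) 0 refl l η (upper (derivative-near-1 η 0<η))))

    ratios : c₀ˣ y x
    ratios ε 0<ε =
      -- The slope bounds give the non-strict bound `e` on the ratio, whereas the limit asks for a
      -- strict one.
      let e = ½ * ε
          0<e = ½*-positive 0<ε
          δ , 0<δ , near = C¹.derivative-continuous zero-point (½ * e) (½*-positive 0<e)
          N , small = small-cells δ 0<δ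
      in N , λ n N≤n → ratio-near n (slopes-near-1 (λ t → value (Diff.to g t)) C¹.derivative C¹.hasDerivative 0<e
           (<⇒≤ (0<center n)) (center≤edge n) (proj₂ (unit (edge-point x n)))
           λ t c≤t t≤e → subst (λ m → Within (½ * e) (C¹.derivative t - m)) derivative-1
             (∣∣<⇒within (near t (≤-<-trans (∣∣≤ (from-zero n t t≤e)) (small n N≤n)))))
      where
      open Components x using (edge; edge-in-cell)
      center≤edge : ∀ n → center n ≤ edge n
      center≤edge n =
            (arith 2 (λ c s → (κ 0 :< s ∷ []) ⊢ c :≤ c :+ κ 2 :* s)
              (λ _ _ → lit 2 ⊗ hyp 0) 0 refl (center n) (Model.σ x n) (Model.0<σ x n))
      from-zero : ∀ n (t : [0,1]) → value t ≤ edge n → Within (num 8 * halves n) (value t - 0#)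
      from-zero n t t≤e =
        (arith 2 (λ t w → (κ 0 :≤ t ∷ κ 0 :< w ∷ []) ⊢ :- (κ 8 :* w) :≤ t :- κ 0)
          (λ _ _ → hyp 0 ⊕ lit 8 ⊗ hyp 1)
          0 refl (value t) (halves n) (proj₁ (unit t)) (halves-positive n)) ,
        (arith 3 (λ t e w → (t :≤ e ∷ e :< κ 8 :* w ∷ []) ⊢ t :- κ 0 :≤ κ 8 :* w)
          (λ _ _ _ → hyp 0 ⊕ hyp 1)
          0 refl (value t) (edge n) (halves n) t≤e (proj₂ (edge-in-cell n)))
      ratio-near : ∀ n → Slopes (λ t → value (Diff.to g (clamp t))) (1# - ½ * ε) (1# + ½ * ε) (center n) (edge n) →
                   ∣ value (y n) / value (x n) - 1# ∣ < ε
      ratio-near n (lo , hi) = ≤-<-trans (∣∣≤ (within-cancel 0<wX (subst (Within _) expand within))) (½*-< 0<ε)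
        where
        X Y w e : ℝ
        X = value (x n)
        Y = value (y n)
        w = halves n
        e = ½ * ε
        0<wX : 0# < w * X
        0<wX = *-positive (halves-positive n) (0<seq x n)
        image-center : value (Diff.to g (clamp (center n))) ≡ center n
        image-center = trans (cong (λ t → value (Diff.to g t)) (clamp-point (center-point n))) (C.center-fixed n)
        image-edge : value (Diff.to g (clamp (edge n))) ≡ Components.edge y n
        image-edge = trans (cong (λ t → value (Diff.to g t)) (clamp-point (edge-point x n))) (C.edge-matched n)
        expand : w * Y - w * X ≡ w * X * (Y / X - 1#)
        expand = (arith 4 (λ w X Y i → (X :* i :≡ κ 1 ∷ [])
                      ⊢ w :* Y :- w :* X :≡ w :* X :* (Y :* i :- κ 1))
                   (λ w _ Y _ → multiple (:- (Y :* w)) 0)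
                   0 refl w X Y (X ⁻¹) (*-inverse (0<seq x n)))
        within : Within (w * X * e) (w * Y - w * X)
        within =
          (arith 9 (λ c s s′ w X Y e a b → (κ 2 :* s :≡ w :* X ∷ κ 2 :* s′ :≡ w :* Y ∷ a :≡ c ∷
               b :≡ c :+ κ 2 :* s′ ∷ (κ 1 :- e) :* (c :+ κ 2 :* s :- c) :≤ b :- a ∷ [])
               ⊢ :- (w :* X :* e) :≤ w :* Y :- w :* X)
            (λ _ _ _ _ _ _ e _ _ → hyp 4 ⊕ multiple (e :- κ 1) 0 ⊕ multiple (κ 1) 1
              ⊕ multiple (:- (κ 1)) 2 ⊕ multiple (κ 1) 3)
            0 refl (center n) (Model.σ x n) (Model.σ y n) w X Y e (value (Diff.to g (clamp (center
              n)))) (value (Diff.to g (clamp (edge n)))) (2σ x n) (2σ y n) image-center image-edge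
              lo) ,
          (arith 9 (λ c s s′ w X Y e a b → (κ 2 :* s :≡ w :* X ∷ κ 2 :* s′ :≡ w :* Y ∷ a :≡ c ∷
               b :≡ c :+ κ 2 :* s′ ∷ b :- a :≤ (κ 1 :+ e) :* (c :+ κ 2 :* s :- c) ∷ [])
               ⊢ w :* Y :- w :* X :≤ w :* X :* e)
            (λ _ _ _ _ _ _ e _ _ → hyp 4 ⊕ multiple (κ 1 :+ e) 0 ⊕ multiple (:- (κ 1)) 1
              ⊕ multiple (κ 1) 2 ⊕ multiple (:- (κ 1)) 3)
            0 refl (center n) (Model.σ x n) (Model.σ y n) w X Y e (value (Diff.to g (clamp (center
              n)))) (value (Diff.to g (clamp (edge n)))) (2σ x n) (2σ y n) image-center image-edge
              hi)

  -- `Ratios` puts the target sequence into the numerator, so the inverse of `g`, which conjugates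
  -- in the opposite direction, yields the quotients in the required order.
  conjugate⇒c₀ˣ : ∀ x y → ConjugateDiff (reduction x) (reduction y) → c₀ˣ x y
  conjugate⇒c₀ˣ x y (g , conj) = Ratios.ratios y x (invert g) (conjugates-invert g x y (conjugates g x y conj))

  c₀ˣ-reducible : BorelReducible OpenSequences OpenDiff c₀ˣ ConjugateDiff
  c₀ˣ-reducible = reduction , continuous⇒Borel reduction reduction-continuous ,
    λ x y → mk⇔ (c₀ˣ⇒conjugate x y) (conjugate⇒c₀ˣ x y)

theorem3p19 : (∀ {ℓ} → ExcludedMiddle ℓ) → (R : RealNumbers) →
    let open Spaces R in
    BorelReducible OpenSequences OpenDiff c₀ˣ ConjugateDiff
theorem3p19 em R = Invariants.c₀ˣ-reducible em R
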